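{- Let $k\ge a\ge 1$ be integers. For $n\ge 0$ let $\overline{E}_{k,a}(n)$ be the number of lattice paths (of the kind described in the context) with major index $n$ that satisfy the special $(k,a)$-conditions, and let $\overline{B}_{k,a}(n)$ be the number of overpartitions of $n$ of the form $\lambda_1+\lambda_2+\cdots+\lambda_s$ such that $1$ occurs as a non-overlined part at most $a-1$ times, and $\lambda_j-\lambda_{j+k-1}\ge 1$ if $\lambda_j$ is overlined and $\lambda_j-\lambda_{j+k-1}\ge 2$ otherwise. Then $\overline{E}_{k,a}(n)=\overline{B}_{k,a}(n)$ for all $n\ge 0$, and \[ \sum_{n\ge0}\overline{E}_{k,a}(n)q^n=\sum_{N_1\geq\cdots\geq N_{k-1}\geq0} \frac{q^{\frac{(N_1+1)N_1}{2}+N_2^2+\cdots+N_{k-1}^2+N_{a+1}+\cdots+N_{k-1}} (-q)_{N_1-1}(1+q^{N_a})}{(q)_{N_1-N_2}\cdots(q)_{N_{k-2}-N_{k-1}}(q)_{N_{k-1}}} =\frac{(-q)_\infty(q^a,q^{2k-a},q^{2k};q^{2k})_\infty}{(q)_\infty}. \]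
   Context: Notation: $(a)_n=(a;q)_n=\prod_{i=0}^{n-1}(1-aq^i)$, $(a)_\infty=\prod_{i\ge0}(1-aq^i)$, $(a_1,\dots,a_j;q)_\infty=\prod_i(a_i;q)_\infty$; for negative $n$, $(a;q)_n=(a;q)_\infty/(aq^n;q)_\infty$ (so $(-q)_{ -1}=1/2$). Convention: $N_k=0$; empty sums such as $N_{a+1}+\cdots+N_{k-1}$ (when $a\ge k-1$) are $0$. An overpartition of $n$ is a non-increasing sequence of positive integers summing to $n$ in which the first occurrence of each integer may be overlined. Lattice paths: paths in the first quadrant starting on the $y$-axis and ending on the $x$-axis, using unit steps North-East $(x,y)\to(x+1,y+1)$, South-East $(x,y)\to(x+1,y-1)$, North $(x,y-1)\to(x,y)$, and East $(x,0)\to(x+1,0)$ (East steps occur only at height $0$). The height of a vertex is its $y$-coordinate and its weight is its $x$-coordinate. A peak is a vertex preceded by a North-East step (an NESE peak) or by a North step (an NSE peak) and followed by a South-East step. Paths are either empty or end with a South-East step; as stated in the paper, if the leftmost peak is an NSE peak, the path must start with an NE step, except when it starts at $(0,0)$ with an E step. The major index of a path is the sum of the weights of its peaks. A path satisfies the special $(k,a)$-conditions if it starts at height $k-a$ and all its heights are less than $k$.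
   Formalization: The path rules as described make the claim false (k=2, a=1, n=1: no path, one overpartition). Here a North step may occur only directly after a South-East or East step, and this replaces the rule that a leftmost NSE peak forces an NE start. -}

module Defs where

open import Data.Nat as ℕ using (ℕ; zero; suc; _≤ᵇ_; _≡ᵇ_; _∸_; _≤_)
open import Data.Nat.DivMod using (_/_)
open import Data.Integer using (+_)
open import Data.Rational as ℚ using (ℚ; 0ℚ; 1ℚ; ½; -_)
open import Data.Bool using (Bool; true; false; _∧_; _∨_; not; if_then_else_; T)
open import Data.List using (List; []; _∷_; map; concatMap; upTo; foldr; length)
open import Data.Maybe using (Maybe; just; nothing)
open import Data.Product using (Σ; _×_; _,_; ∃)
open import Relation.Binary.PropositionalEquality using (_≡_)

-- Unit steps: North-East (x,y)→(x+1,y+1), South-East (x,y)→(x+1,y-1),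
-- North (x,y-1)→(x,y), East (x,0)→(x+1,0).
data Step : Set where
  NE SE N E : Step

-- A path is its list of steps; its starting point on the y-axis is
-- fixed separately (for the special (k,a)-conditions it is (0, k - a)).
Path : Set
Path = List Step

-- "the previous step was an up-step (NE or N)", i.e. the current vertex
-- is a peak if the next step is SE.
isUp : Maybe Step → Bool
isUp (just NE) = true
isUp (just N)  = true
isUp _         = false

nAllowedAfter : Maybe Step → Bool
nAllowedAfter (just SE) = true
nAllowedAfter (just E)  = true
nAllowedAfter _         = false

endsOK : Maybe Step → Bool
endsOK nothing   = true   -- empty path
endsOK (just SE) = true
endsOK (just _)  = false

-- walkOK k h prev ps : the remaining steps ps, taken from a vertex of
-- height h reached by step prev, stay in the first quadrant, keep all
-- heights < k, take E steps only at height 0, obey the rule on North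
-- steps, and end on the x-axis with an SE step (or the path is empty).
walkOK : ℕ → ℕ → Maybe Step → Path → Bool
walkOK k h       prev []        = (h ≡ᵇ 0) ∧ endsOK prev
walkOK k h       prev (NE ∷ ps) = (suc h ℕ.<ᵇ k) ∧ walkOK k (suc h) (just NE) ps
walkOK k zero    prev (SE ∷ ps) = false
walkOK k (suc h) prev (SE ∷ ps) = walkOK k h (just SE) ps
walkOK k h       prev (N ∷ ps)  = (suc h ℕ.<ᵇ k) ∧ nAllowedAfter prev ∧ walkOK k (suc h) (just N) ps
walkOK k zero    prev (E ∷ ps)  = walkOK k zero (just E) ps
walkOK k (suc h) prev (E ∷ ps)  = false

SpecialPath : ℕ → ℕ → Path → Bool
SpecialPath k a ps = ((k ∸ a) ℕ.<ᵇ k) ∧ walkOK k (k ∸ a) nothing ps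

-- Major index: sum of the weights (x-coordinates) of the peaks.
-- majAux x prev ps : current vertex has weight x and was reached by prev.
majAux : ℕ → Maybe Step → Path → ℕ
majAux x prev []        = 0
majAux x prev (SE ∷ ps) = (if isUp prev then x else 0) ℕ.+ majAux (suc x) (just SE) ps
majAux x prev (N ∷ ps)  = majAux x (just N) ps
majAux x prev (s ∷ ps)  = majAux (suc x) (just s) ps

maj : Path → ℕ
maj = majAux 0 nothing

SpecialPaths : ℕ → ℕ → ℕ → Set
SpecialPaths k a n = Σ Path (λ p → T (SpecialPath k a p) × maj p ≡ n)

-- A part is (value , overlined?). An overpartition is a list of parts,
-- positive, non-increasing, where only the first occurrence (leftmost)
-- of a value may be overlined.
Part : Set
Part = ℕ × Bool

val : Part → ℕ
val (v , _) = v

ovl : Part → Bool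
ovl (_ , o) = o

weight : List Part → ℕ
weight = foldr (λ p s → val p ℕ.+ s) 0

isOverpartition : List Part → Bool
isOverpartition []                = true
isOverpartition ((v , o) ∷ [])    = 1 ≤ᵇ v
isOverpartition ((v , o) ∷ (w , o') ∷ ps) =
  (1 ≤ᵇ v) ∧ (w ≤ᵇ v) ∧ (not (v ≡ᵇ w) ∨ not o') ∧ isOverpartition ((w , o') ∷ ps)

nth : {A : Set} → List A → ℕ → Maybe A
nth []       _       = nothing
nth (x ∷ xs) zero    = just x
nth (x ∷ xs) (suc i) = nth xs i

nonOvlOnes : List Part → ℕ
nonOvlOnes []             = 0
nonOvlOnes ((v , o) ∷ ps) = (if (v ≡ᵇ 1) ∧ not o then 1 else 0) ℕ.+ nonOvlOnes ps

gapCond : ℕ → List Part → Bool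
gapCond k []       = true
gapCond k (p ∷ ps) = here (nth (p ∷ ps) (k ∸ 1)) ∧ gapCond k ps
  where
  here : Maybe Part → Bool
  here nothing  = true
  here (just r) = (val r ℕ.+ (if ovl p then 1 else 2)) ≤ᵇ val p

BressoudOvp : ℕ → ℕ → List Part → Bool
BressoudOvp k a ps = isOverpartition ps ∧ (nonOvlOnes ps ℕ.<ᵇ a) ∧ gapCond k ps

BOverpartitions : ℕ → ℕ → ℕ → Set
BOverpartitions k a n = Σ (List Part) (λ ps → T (BressoudOvp k a ps) × weight ps ≡ n)

PS : Set
PS = ℕ → ℚ

fromℕℚ : ℕ → ℚ
fromℕℚ c = + c ℚ./ 1

sumBelow : ℕ → (ℕ → ℚ) → ℚ
sumBelow zero    h = 0ℚ
sumBelow (suc n) h = sumBelow n h ℚ.+ h n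

_⊕_ : PS → PS → PS
(f ⊕ g) n = f n ℚ.+ g n

_⊗_ : PS → PS → PS
(f ⊗ g) n = sumBelow (suc n) (λ i → f i ℚ.* g (n ∸ i))

mono : ℚ → ℕ → PS
mono c m n = if m ≡ᵇ n then c else 0ℚ

oneS : PS
oneS = mono 1ℚ 0

prodBelow : ℕ → (ℕ → PS) → PS
prodBelow zero    F = oneS
prodBelow (suc n) F = prodBelow n F ⊗ F n

-- Reciprocal of a series with constant term 1 (only applied to such
-- series): b_0 = 1, b_n = - Σ_{i=1}^{n} f_i b_{n-i}.
-- recipTab f n j = b_j for j ≤ n.
recipTab : PS → ℕ → ℕ → ℚ
recipTab f zero    j = 1ℚ
recipTab f (suc n) j =
  if j ≤ᵇ n then recipTab f n j
  else - sumBelow (suc n) (λ i → f (suc i) ℚ.* recipTab f n (n ∸ i))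

recip : PS → PS
recip f n = recipTab f n n

_⊘_ : PS → PS → PS
f ⊘ g = f ⊗ recip g

poch : ℚ → ℕ → ℕ → ℕ → PS
poch c m s n = prodBelow n (λ i → oneS ⊕ mono (- c) (m ℕ.+ s ℕ.* i))

qPoch : ℕ → PS
qPoch = poch 1ℚ 1 1

mqPoch : ℕ → PS
mqPoch = poch (- 1ℚ) 1 1

-- (-q;q)_{n-1}, with the convention (-q;q)_{-1} = 1/2 for n = 0.
mqPochPred : ℕ → PS
mqPochPred zero    = mono ½ 0
mqPochPred (suc n) = mqPoch n

-- Coefficient n of a sequence of series converges (in the q-adic sense)
-- to c: it is eventually constant equal to c.
CoeffLimit : (ℕ → PS) → ℕ → ℚ → Set
CoeffLimit F n c = ∃ λ B → (B' : ℕ) → B ≤ B' → F B' n ≡ c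

tuples : ℕ → ℕ → List (List ℕ)
tuples zero    b = [] ∷ []
tuples (suc l) b = concatMap (λ x → map (x ∷_) (tuples l x)) (upTo (suc b))

-- N_i (1-based) of the tuple (N_1,…,N_{k-1}); 0 beyond (N_k = 0).
Nix : List ℕ → ℕ → ℕ
Nix Ns zero    = 0
Nix Ns (suc i) with nth Ns i
... | just v  = v
... | nothing = 0

-- Σ_{i=lo}^{hi} g i   (empty if hi < lo)
sumNat : ℕ → ℕ → (ℕ → ℕ) → ℕ
sumNat lo hi g = go (suc hi ∸ lo)
  where
  go : ℕ → ℕ
  go zero    = 0
  go (suc m) = go m ℕ.+ g (lo ℕ.+ m)

expo : ℕ → ℕ → List ℕ → ℕ
expo k a Ns =
  (suc (Nix Ns 1) ℕ.* Nix Ns 1) / 2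
  ℕ.+ sumNat 2 (k ∸ 1) (λ i → Nix Ns i ℕ.* Nix Ns i)
  ℕ.+ sumNat (suc a) (k ∸ 1) (Nix Ns)

-- denominator (q)_{N_1-N_2} ⋯ (q)_{N_{k-2}-N_{k-1}} (q)_{N_{k-1}}
-- = ∏_{i=1}^{k-1} (q)_{N_i - N_{i+1}} with N_k = 0
denom : ℕ → List ℕ → PS
denom k Ns = prodBelow (k ∸ 1) (λ j → qPoch (Nix Ns (suc j) ∸ Nix Ns (suc (suc j))))

summand : ℕ → ℕ → List ℕ → PS
summand k a Ns =
  ((mono 1ℚ (expo k a Ns) ⊗ mqPochPred (Nix Ns 1)) ⊗ (oneS ⊕ mono 1ℚ (Nix Ns a)))
  ⊘ denom k Ns

sumPS : List PS → PS
sumPS = foldr _⊕_ (λ _ → 0ℚ)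

multisumPartial : ℕ → ℕ → ℕ → PS
multisumPartial k a B = sumPS (map (summand k a) (tuples (k ∸ 1) B))

productPartial : ℕ → ℕ → ℕ → PS
productPartial k a B =
  (((poch (- 1ℚ) 1 1 B ⊗ poch 1ℚ a (2 ℕ.* k) B)
     ⊗ poch 1ℚ (2 ℕ.* k ∸ a) (2 ℕ.* k) B)
     ⊗ poch 1ℚ (2 ℕ.* k) (2 ℕ.* k) B)
  ⊘ poch 1ℚ 1 1 B

{-# OPTIONS --safe #-}
module Submission where

-- Everything is computed in ℚ[[q]] modulo q^(n+1), where q is nilpotent, so that all sums and
-- products are finite. The four quantities are equal to P Θ, where P = (-q)_∞ / (q)_∞ and
-- Θ = ∑ (-1)ʳ q^(k r² + (k - a) r) over all integers r.
--
-- Removing the first step of a lattice path gives a linear system for the series of the paths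
-- with N peaks, indexed by the initial height, which determines them by induction on N. Up to
-- the factor q^(N (N + 1) / 2) (-q)_{N-1}, it is solved both by the inner sums of the multiple
-- sum with N₁ = N and by the alternating sums ∑ (-1)ʳ q^(…) / ((q)_{N-r} (q)_{N+r}); the latter
-- are summed over N by creative telescoping, with value P Θ. Jacobi's triple product, as the
-- limit of its finite form, evaluates Θ. For the overpartitions, let bᵢ(m) be the series of
-- those with all parts > m in which m + 1 is non-overlined less than i times. Then
-- bᵢ(m) - bᵢ₋₁(m) = q^((m+1)(i-1)) (bₖ₋ᵢ₊₁(m+1) + q^(m+1) bₖ₋ᵢ(m+1)), and this recurrence is
-- solved by an explicit alternating series with value P Θ at m = 0 and i = a.

open import Defs renaming (N to N↑)
open import Data.Nat using (ℕ; _≤_)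
open import Data.Fin using (Fin)
open import Data.Product using (Σ; _×_)
open import Function.Bundles using (_↔_)

open import Algebra.Bundles using (CommutativeRing; RawRing)
open import Algebra.Solver.Ring.AlmostCommutativeRing using (fromCommutativeRing; _-Raw-AlmostCommutative⟶_)
import Algebra.Properties.AbelianGroup as GroupProperties
import Algebra.Properties.CommutativeSemigroup as SemigroupProperties
import Algebra.Properties.Ring as RingProperties
import Algebra.Properties.Semiring.Exp as Exp
import Algebra.Properties.Semiring.Mult as Mult
import Algebra.Solver.Ring as RingSolver
open import Data.Bool using (Bool; true; false; _∧_; _∨_; not; if_then_else_; T; T?)
import Data.Bool.Properties as Bool
open import Data.Empty using (⊥; ⊥-elim)
import Data.Fin as Fin
open import Data.Integer as ℤ using (+_)
import Data.Integer.Properties as ℤ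
open import Data.List using (List; []; _∷_; _++_; map; concatMap; upTo; applyUpTo; foldr; length; lookup; filter; replicate; cartesianProduct; cartesianProductWith)
import Data.List.Properties as List
open import Data.List.Membership.Propositional using (_∈_)
open import Data.List.Membership.Propositional.Properties using (∈-lookup; ∈-filter⁺; ∈-filter⁻; ∈-cartesianProductWith⁺; ∈-cartesianProductWith⁻; ∈-cartesianProduct⁺; ∈-upTo⁺)
open import Data.List.Relation.Unary.All as All using (All; []; _∷_)
import Data.List.Relation.Unary.All.Properties as All
open import Data.List.Relation.Unary.AllPairs using ([]; _∷_)
open import Data.List.Relation.Unary.Any using (here; there; index)
open import Data.List.Relation.Unary.Any.Properties using (lookup-index)
open import Data.List.Relation.Unary.Unique.Propositional using (Unique)
import Data.List.Relation.Unary.Unique.Propositional.Properties as Unique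
open import Data.Maybe using (Maybe; just; nothing)
open import Data.Nat as ℕ using (zero; suc; _<_; z≤n; s≤s; _∸_; _≡ᵇ_; _<ᵇ_; _≤ᵇ_)
open import Data.Nat.DivMod using (_/_; m*n/n≡m)
import Data.Nat.Properties as ℕ
open import Data.Nat.Tactic.RingSolver using (solve-∀)
open import Data.Product using (_,_; proj₁; proj₂; ∃-syntax)
open import Data.Rational as ℚ using (ℚ; 0ℚ; 1ℚ)
import Data.Rational.Properties as ℚ
open import Data.Rational.Unnormalised as ℚᵘ using (mkℚᵘ; *≡*)
import Data.Rational.Unnormalised.Properties as ℚᵘ
open import Data.Sum using (_⊎_; inj₁; inj₂)
open import Data.Unit using (⊤; tt)
open import Function using (_∘_)
open import Function.Bundles using (mk↔ₛ′)
open import Level using (0ℓ)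
open import Relation.Binary.PropositionalEquality as ≡ using (_≡_)
import Relation.Binary.Reasoning.Setoid as SetoidReasoning
open import Relation.Nullary using (yes; no)

-- The alternating sums form a Bailey pair relative to 1: `chain` is one step of the Bailey chain,
-- and the summation over N₁ is Bailey's lemma with one parameter equal to -1 and the other sent to
-- infinity. This specialisation leaves a denominator 1 + q^r in the term of index r. The factor 1 +
-- q^(N_a) of the multiple sum repairs it: it makes the summand a sum of two neighbouring solutions
-- of the linear system, and the two alternating sums add up to terms that carry exactly 1 + q^r. On
-- the side of the paths the same two neighbours appear because a North step is forbidden at the
-- start. The bijections of the statement come from counting: paths and overpartitions are both
-- listed explicitly, and the lists have equal length because both lengths are the same coefficient
-- of P Θ. The ring is abstract with a nilpotent element, so that the Pochhammer lemmas serve for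
-- base q and for base q^(2k). The linear system is set up for k = l + 2; the case k = 1 is treated
-- separately through `product-trivial`.

-- The ring solver with coefficients in ℤ, encoded as pairs (m , n) for m - n with m = 0 or n = 0.
module IntegerCoefficients (R : CommutativeRing 0ℓ 0ℓ) where
  open CommutativeRing R hiding (zero)
  open Mult semiring using (×-homo-+; ×1-homo-*) renaming (_×_ to _·_)
  open SetoidReasoning setoid
  open SemigroupProperties +-commutativeSemigroup using (interchange)
  open GroupProperties +-abelianGroup using (⁻¹-∙-comm; ⁻¹-involutive; ε⁻¹≈ε)
  open RingProperties ring using (-‿distribˡ-*; -‿distribʳ-*)

  private
    reduce : ℕ → ℕ → ℕ × ℕ
    reduce (suc m) (suc n) = reduce m n
    reduce m       n       = m , n

    difference : ℕ × ℕ → Carrier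
    difference (m , n) = (m · 1#) - (n · 1#)

    -- The first two clauses make the solver's constants 0 and 1 definitionally 0# and 1#.
    ⟦_⟧ : ℕ × ℕ → Carrier
    ⟦ zero     , zero ⟧ = 0#
    ⟦ suc zero , zero ⟧ = 1#
    ⟦ m        , n    ⟧ = difference (m , n)

    ⟦⟧≈difference : ∀ p → ⟦ p ⟧ ≈ difference p
    ⟦⟧≈difference (zero        , zero)  = sym (-‿inverseʳ 0#)
    ⟦⟧≈difference (suc zero    , zero)  = sym (trans (+-cong (+-identityʳ 1#) ε⁻¹≈ε) (+-identityʳ 1#))
    ⟦⟧≈difference (zero        , suc n) = refl
    ⟦⟧≈difference (suc zero    , suc n) = refl
    ⟦⟧≈difference (suc (suc m) , zero)  = refl
    ⟦⟧≈difference (suc (suc m) , suc n) = refl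

    reduce-correct : ∀ m n → difference (reduce m n) ≈ difference (m , n)
    reduce-correct zero    n       = refl
    reduce-correct (suc m) zero    = refl
    reduce-correct (suc m) (suc n) = begin
      difference (reduce m n) ≈⟨ reduce-correct m n ⟩
      m · 1# - n · 1# ≈⟨ +-identityˡ _ ⟨
      0# + (m · 1# - n · 1#) ≈⟨ +-congʳ (-‿inverseʳ 1#) ⟨
      (1# - 1#) + (m · 1# - n · 1#) ≈⟨ interchange _ _ _ _ ⟩
      (1# + m · 1#) + (- 1# - n · 1#) ≈⟨ +-congˡ (⁻¹-∙-comm _ _) ⟩
      (1# + m · 1#) - (1# + n · 1#) ∎

    ⟦reduce⟧ : ∀ m n → ⟦ reduce m n ⟧ ≈ difference (m , n)
    ⟦reduce⟧ m n = trans (⟦⟧≈difference (reduce m n)) (reduce-correct m n)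

    ℤ-rawRing : RawRing 0ℓ 0ℓ
    ℤ-rawRing = record
      { Carrier = ℕ × ℕ
      ; _≈_ = _≡_
      ; _+_ = λ (a , b) (c , d) → reduce (a ℕ.+ c) (b ℕ.+ d)
      ; _*_ = λ (a , b) (c , d) → reduce (a ℕ.* c ℕ.+ b ℕ.* d) (a ℕ.* d ℕ.+ b ℕ.* c)
      ; -_ = λ (a , b) → b , a
      ; 0# = 0 , 0
      ; 1# = 1 , 0
      }

    *-expand : ∀ a b c d → (a * c + b * d) - (a * d + b * c) ≈ (a - b) * (c - d)
    *-expand a b c d = begin
      (a * c + b * d) - (a * d + b * c) ≈⟨ +-congˡ (-‿cong (+-comm _ _)) ⟩
      (a * c + b * d) - (b * c + a * d) ≈⟨ +-congˡ (⁻¹-∙-comm _ _) ⟨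
      (a * c + b * d) + (- (b * c) - a * d) ≈⟨ interchange _ _ _ _ ⟩
      (a * c - b * c) + (b * d - a * d) ≈⟨ +-cong (+-congˡ (-‿distribˡ-* b c)) (trans (+-comm _ _) (+-cong (-‿distribʳ-* a d) (sym (⁻¹-involutive _)))) ⟩
      (a * c + (- b) * c) + (a * (- d) + - - (b * d)) ≈⟨ +-cong (sym (distribʳ c a (- b))) (+-congˡ (trans (-‿cong (-‿distribʳ-* b d)) (-‿distribˡ-* b (- d)))) ⟩
      (a - b) * c + (a * (- d) + (- b) * (- d)) ≈⟨ +-congˡ (sym (distribʳ (- d) a (- b))) ⟩
      (a - b) * c + (a - b) * (- d) ≈⟨ distribˡ (a - b) c (- d) ⟨
      (a - b) * (c - d) ∎

    morphism : ℤ-rawRing -Raw-AlmostCommutative⟶ fromCommutativeRing R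
    morphism = record
      { ⟦_⟧ = ⟦_⟧
      ; +-homo = λ (a , b) (c , d) → begin
          ⟦ reduce (a ℕ.+ c) (b ℕ.+ d) ⟧ ≈⟨ ⟦reduce⟧ (a ℕ.+ c) (b ℕ.+ d) ⟩
          (a ℕ.+ c) · 1# - (b ℕ.+ d) · 1# ≈⟨ +-cong (×-homo-+ 1# a c) (trans (-‿cong (×-homo-+ 1# b d)) (sym (⁻¹-∙-comm _ _))) ⟩
          (a · 1# + c · 1#) + (- (b · 1#) - d · 1#) ≈⟨ interchange _ _ _ _ ⟩
          difference (a , b) + difference (c , d) ≈⟨ +-cong (⟦⟧≈difference (a , b)) (⟦⟧≈difference (c , d)) ⟨
          ⟦ a , b ⟧ + ⟦ c , d ⟧ ∎
      ; *-homo = λ (a , b) (c , d) → begin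
          ⟦ reduce (a ℕ.* c ℕ.+ b ℕ.* d) (a ℕ.* d ℕ.+ b ℕ.* c) ⟧ ≈⟨ ⟦reduce⟧ (a ℕ.* c ℕ.+ b ℕ.* d) _ ⟩
          (a ℕ.* c ℕ.+ b ℕ.* d) · 1# - (a ℕ.* d ℕ.+ b ℕ.* c) · 1# ≈⟨ +-cong (sum-of-products a c b d) (-‿cong (sum-of-products a d b c)) ⟩
          ((a · 1#) * (c · 1#) + (b · 1#) * (d · 1#)) - ((a · 1#) * (d · 1#) + (b · 1#) * (c · 1#)) ≈⟨ *-expand _ _ _ _ ⟩
          difference (a , b) * difference (c , d) ≈⟨ *-cong (⟦⟧≈difference (a , b)) (⟦⟧≈difference (c , d)) ⟨
          ⟦ a , b ⟧ * ⟦ c , d ⟧ ∎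
      ; -‿homo = λ (a , b) → begin
          ⟦ b , a ⟧ ≈⟨ ⟦⟧≈difference (b , a) ⟩
          b · 1# - a · 1# ≈⟨ +-comm _ _ ⟩
          - (a · 1#) + b · 1# ≈⟨ +-congˡ (⁻¹-involutive _) ⟨
          - (a · 1#) - - (b · 1#) ≈⟨ ⁻¹-∙-comm _ _ ⟩
          - (a · 1# - b · 1#) ≈⟨ -‿cong (⟦⟧≈difference (a , b)) ⟨
          - ⟦ a , b ⟧ ∎
      ; 0-homo = refl
      ; 1-homo = refl
      }
      where
      sum-of-products : ∀ a c b d → (a ℕ.* c ℕ.+ b ℕ.* d) · 1# ≈ (a · 1#) * (c · 1#) + (b · 1#) * (d · 1#)
      sum-of-products a c b d = trans (×-homo-+ 1# (a ℕ.* c) (b ℕ.* d)) (+-cong (×1-homo-* a c) (×1-homo-* b d))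

    equal? : ∀ x y → Maybe (⟦ x ⟧ ≈ ⟦ y ⟧)
    equal? (a , b) (c , d) with a ℕ.≟ c | b ℕ.≟ d
    ... | yes ≡.refl | yes ≡.refl = just refl
    ... | _          | _          = nothing

  open RingSolver ℤ-rawRing (fromCommutativeRing R) morphism equal? public
    using (Polynomial; solve; _:=_; _:+_; _:*_; _:-_; :-_; con)

  :0 :1 : ∀ {n} → Polynomial n
  :0 = con (0 , 0)
  :1 = con (1 , 0)

-- Finite sums and products over an abstract commutative ring.

module Sums (R : CommutativeRing 0ℓ 0ℓ) where
  open CommutativeRing R hiding (zero)
  open SetoidReasoning setoid
  open SemigroupProperties +-commutativeSemigroup using (interchange)
  open IntegerCoefficients R

  ∑ : ℕ → (ℕ → Carrier) → Carrier
  ∑ zero    f = 0#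
  ∑ (suc n) f = ∑ n f + f n

  ∑-cong< : ∀ n {f g} → (∀ i → i < n → f i ≈ g i) → ∑ n f ≈ ∑ n g
  ∑-cong< zero    eq = refl
  ∑-cong< (suc n) eq = +-cong (∑-cong< n λ i i<n → eq i (ℕ.m<n⇒m<1+n i<n)) (eq n ℕ.≤-refl)

  ∑-cong : ∀ n {f g} → (∀ i → f i ≈ g i) → ∑ n f ≈ ∑ n g
  ∑-cong n eq = ∑-cong< n λ i _ → eq i

  ∑-zero : ∀ n {f} → (∀ i → f i ≈ 0#) → ∑ n f ≈ 0#
  ∑-zero zero    eq = refl
  ∑-zero (suc n) eq = trans (+-cong (∑-zero n eq) (eq n)) (+-identityˡ 0#)

  ∑-+ : ∀ n (f g : ℕ → Carrier) → ∑ n (λ i → f i + g i) ≈ ∑ n f + ∑ n g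
  ∑-+ zero    f g = sym (+-identityˡ 0#)
  ∑-+ (suc n) f g = trans (+-congʳ (∑-+ n f g)) (interchange _ _ _ _)

  ∑-*ˡ : ∀ n c (f : ℕ → Carrier) → c * ∑ n f ≈ ∑ n (λ i → c * f i)
  ∑-*ˡ zero    c f = zeroʳ c
  ∑-*ˡ (suc n) c f = trans (distribˡ c _ _) (+-congʳ (∑-*ˡ n c f))

  ∑-*ʳ : ∀ n c (f : ℕ → Carrier) → ∑ n f * c ≈ ∑ n (λ i → f i * c)
  ∑-*ʳ n c f = trans (*-comm _ c) (trans (∑-*ˡ n c f) (∑-cong n λ i → *-comm c _))

  ∑-neg : ∀ n (f : ℕ → Carrier) → - ∑ n f ≈ ∑ n (λ i → - f i)
  ∑-neg zero    f = solve 0 (:- :0 := :0) refl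
  ∑-neg (suc n) f = trans (solve 2 (λ x y → :- (x :+ y) := :- x :- y) refl _ _) (+-congʳ (∑-neg n f))

  ∑-- : ∀ n (f g : ℕ → Carrier) → ∑ n (λ i → f i - g i) ≈ ∑ n f - ∑ n g
  ∑-- n f g = trans (∑-+ n f (λ i → - g i)) (+-congˡ (sym (∑-neg n g)))

  ∑-swap : ∀ m n (f : ℕ → ℕ → Carrier) → ∑ m (λ i → ∑ n (f i)) ≈ ∑ n (λ j → ∑ m (λ i → f i j))
  ∑-swap zero    n f = sym (∑-zero n λ _ → refl)
  ∑-swap (suc m) n f = trans (+-congʳ (∑-swap m n f)) (sym (∑-+ n (λ j → ∑ m (λ i → f i j)) (f m)))

  ∑-head : ∀ n (f : ℕ → Carrier) → ∑ (suc n) f ≈ f 0 + ∑ n (λ i → f (suc i))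
  ∑-head zero    f = +-comm _ _
  ∑-head (suc n) f = trans (+-congʳ (∑-head n f)) (+-assoc _ _ _)

  ∑-truncate : ∀ {m n} f → m ≤ n → (∀ i → m ≤ i → f i ≈ 0#) → ∑ n f ≈ ∑ m f
  ∑-truncate {n = zero}  f z≤n f≈0 = refl
  ∑-truncate {m} {suc n} f m≤1+n f≈0 with ℕ.m≤n⇒m<n∨m≡n m≤1+n
  ... | inj₂ ≡.refl    = refl
  ... | inj₁ (s≤s m≤n) = trans (+-cong (∑-truncate f m≤n f≈0) (f≈0 n m≤n)) (+-identityʳ _)

  ∑-telescope : ∀ n (f : ℕ → Carrier) → ∑ n (λ i → f i - f (suc i)) ≈ f 0 - f n
  ∑-telescope zero    f = sym (-‿inverseʳ (f 0))
  ∑-telescope (suc n) f = trans (+-congʳ (∑-telescope n f)) (solve 3 (λ x y z → x :- y :+ (y :- z) := x :- z) refl _ _ _)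

  -- Bilateral sums are later reindexed by r ↦ r + 1 over a fixed range; a vanishing term at the
  -- upper end keeps the range unchanged.
  ∑-shift : ∀ n f → f n ≈ 0# → ∑ n f ≈ f 0 + ∑ n (λ i → f (suc i))
  ∑-shift n f fn≈0 = begin
    ∑ n f ≈⟨ +-identityʳ _ ⟨
    ∑ n f + 0# ≈⟨ +-congˡ fn≈0 ⟨
    ∑ (suc n) f ≈⟨ ∑-head n f ⟩
    f 0 + ∑ n (λ i → f (suc i)) ∎

  ∑-drop : ∀ m n (f : ℕ → Carrier) → (∀ i → i < m → f i ≈ 0#) → ∑ (m ℕ.+ n) f ≈ ∑ n (λ i → f (m ℕ.+ i))
  ∑-drop zero    n f f≈0 = refl
  ∑-drop (suc m) n f f≈0 = begin
    ∑ (suc m ℕ.+ n) f ≈⟨ ∑-head (m ℕ.+ n) f ⟩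
    f 0 + ∑ (m ℕ.+ n) (λ i → f (suc i)) ≈⟨ +-cong (f≈0 0 (s≤s z≤n)) (∑-drop m n (λ i → f (suc i)) λ i i<m → f≈0 (suc i) (s≤s i<m)) ⟩
    0# + ∑ n (λ i → f (suc m ℕ.+ i)) ≈⟨ +-identityˡ _ ⟩
    ∑ n (λ i → f (suc m ℕ.+ i)) ∎

  sum : List Carrier → Carrier
  sum = foldr _+_ 0#

  sum-++ : ∀ xs ys → sum (xs ++ ys) ≈ sum xs + sum ys
  sum-++ []       ys = sym (+-identityˡ _)
  sum-++ (x ∷ xs) ys = trans (+-congˡ (sum-++ xs ys)) (sym (+-assoc _ _ _))

  sum-applyUpTo : ∀ {A : Set} (f : A → Carrier) h n → sum (map f (applyUpTo h n)) ≈ ∑ n (λ i → f (h i))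
  sum-applyUpTo f h zero    = refl
  sum-applyUpTo f h (suc n) = trans (+-congˡ (sum-applyUpTo f (λ i → h (suc i)) n)) (sym (∑-head n (λ i → f (h i))))

  sum-concatMap : ∀ {A B : Set} (f : B → Carrier) (g : A → List B) xs → sum (map f (concatMap g xs)) ≈ sum (map (λ x → sum (map f (g x))) xs)
  sum-concatMap f g []       = refl
  sum-concatMap f g (x ∷ xs) = begin
    sum (map f (g x ++ concatMap g xs)) ≈⟨ reflexive (≡.cong sum (List.map-++ f (g x) _)) ⟩
    sum (map f (g x) ++ map f (concatMap g xs)) ≈⟨ sum-++ (map f (g x)) _ ⟩
    sum (map f (g x)) + sum (map f (concatMap g xs)) ≈⟨ +-congˡ (sum-concatMap f g xs) ⟩
    sum (map f (g x)) + _ ∎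

  sum-cartesianProductWith : ∀ {A B C : Set} (f : C → Carrier) (g : A → B → C) xs ys →
    sum (map f (cartesianProductWith g xs ys)) ≈ sum (map (λ x → sum (map (λ y → f (g x y)) ys)) xs)
  sum-cartesianProductWith f g []       ys = refl
  sum-cartesianProductWith f g (x ∷ xs) ys = begin
    sum (map f (map (g x) ys ++ cartesianProductWith g xs ys)) ≈⟨ reflexive (≡.cong sum (List.map-++ f (map (g x) ys) _)) ⟩
    sum (map f (map (g x) ys) ++ map f (cartesianProductWith g xs ys)) ≈⟨ sum-++ (map f (map (g x) ys)) _ ⟩
    sum (map f (map (g x) ys)) + sum (map f (cartesianProductWith g xs ys)) ≈⟨ +-cong (reflexive (≡.cong sum (≡.sym (List.map-∘ ys)))) (sum-cartesianProductWith f g xs ys) ⟩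
    sum (map (λ y → f (g x y)) ys) + _ ∎

  sum-cong : ∀ {A : Set} {f g : A → Carrier} → (∀ x → f x ≈ g x) → ∀ xs → sum (map f xs) ≈ sum (map g xs)
  sum-cong eq []       = refl
  sum-cong eq (x ∷ xs) = +-cong (eq x) (sum-cong eq xs)

  sum-*ˡ : ∀ {A : Set} c (f : A → Carrier) xs → sum (map (λ x → c * f x) xs) ≈ c * sum (map f xs)
  sum-*ˡ c f []       = sym (zeroʳ c)
  sum-*ˡ c f (x ∷ xs) = trans (+-congˡ (sum-*ˡ c f xs)) (sym (distribˡ c _ _))

  sum-∑-swap : ∀ {A : Set} n (f : A → ℕ → Carrier) xs → sum (map (λ x → ∑ n (f x)) xs) ≈ ∑ n (λ i → sum (map (λ x → f x i) xs))
  sum-∑-swap n f []       = sym (∑-zero n λ _ → refl)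
  sum-∑-swap n f (x ∷ xs) = trans (+-congˡ (sum-∑-swap n f xs)) (sym (∑-+ n (f x) _))

  ∏ : ℕ → (ℕ → Carrier) → Carrier
  ∏ zero    f = 1#
  ∏ (suc n) f = ∏ n f * f n

  ∏-cong : ∀ n {f g} → (∀ i → f i ≈ g i) → ∏ n f ≈ ∏ n g
  ∏-cong zero    eq = refl
  ∏-cong (suc n) eq = *-cong (∏-cong n eq) (eq n)

  ∏-head : ∀ n (f : ℕ → Carrier) → ∏ (suc n) f ≈ f 0 * ∏ n (λ i → f (suc i))
  ∏-head zero    f = *-comm _ _
  ∏-head (suc n) f = trans (*-congʳ (∏-head n f)) (*-assoc _ _ _)

-- Nilpotent powers, geometric inverses and Pochhammer symbols.

module Powers (R : CommutativeRing 0ℓ 0ℓ) where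
  open CommutativeRing R hiding (zero)
  open SetoidReasoning setoid
  open Exp semiring public using (_^_; ^-congʳ; ^-homo-*; ^-assocʳ)

  ^-split : ∀ x {m} n o → m ≡ n ℕ.+ o → x ^ m ≈ x ^ n * x ^ o
  ^-split x n o ≡.refl = ^-homo-* x n o

  -- The sign (-1)ʳ, in a form that an index shift by one negates definitionally.
  σ : ℕ → Carrier
  σ zero    = 1#
  σ (suc r) = - σ r

  nilpotent-above : ∀ {x n m} → x ^ n ≈ 0# → n ≤ m → x ^ m ≈ 0#
  nilpotent-above {x} {n} {m} eq n≤m = begin
    x ^ m ≈⟨ ^-split x n (m ℕ.∸ n) (≡.sym (ℕ.m+[n∸m]≡n n≤m)) ⟩
    x ^ n * x ^ (m ℕ.∸ n) ≈⟨ *-congʳ eq ⟩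
    0# * x ^ (m ℕ.∸ n) ≈⟨ zeroˡ _ ⟩
    0# ∎

  nilpotent-power : ∀ {x n} m → x ^ n ≈ 0# → (x ^ suc m) ^ n ≈ 0#
  nilpotent-power {x} {n} m eq = begin
    (x ^ suc m) ^ n ≈⟨ ^-assocʳ x (suc m) n ⟩
    x ^ (suc m ℕ.* n) ≈⟨ nilpotent-above eq (ℕ.m≤m+n n (m ℕ.* n)) ⟩
    0# ∎

module Inverses (R : CommutativeRing 0ℓ 0ℓ) (L : ℕ) where
  open CommutativeRing R hiding (zero)
  open SetoidReasoning setoid
  open IntegerCoefficients R
  open Sums R
  open Powers R

  geometric : Carrier → Carrier
  geometric x = ∑ L (x ^_)

  geometric-inverse : ∀ x → x ^ L ≈ 0# → (1# - x) * geometric x ≈ 1#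
  geometric-inverse x x^L≈0 = begin
    (1# - x) * ∑ L (x ^_) ≈⟨ ∑-*ˡ L _ _ ⟩
    ∑ L (λ i → (1# - x) * x ^ i) ≈⟨ ∑-cong L (λ i → solve 2 (λ x y → (:1 :- x) :* y := y :- x :* y) refl x (x ^ i)) ⟩
    ∑ L (λ i → x ^ i - x ^ suc i) ≈⟨ ∑-telescope L (x ^_) ⟩
    1# - x ^ L ≈⟨ +-congˡ (-‿cong x^L≈0) ⟩
    1# - 0# ≈⟨ solve 0 (:1 :- :0 := :1) refl ⟩
    1# ∎

-- The base is a parameter of its own: it is q for most of the proof and q^(2k) for the triple
-- product.
module Pochhammer (R : CommutativeRing 0ℓ 0ℓ) (L : ℕ) (p : CommutativeRing.Carrier R)
                  (p^L≈0 : CommutativeRing._≈_ R (Powers._^_ R p L) (CommutativeRing.0# R)) where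
  open CommutativeRing R hiding (zero)
  open SetoidReasoning setoid
  open IntegerCoefficients R
  open Powers R
  open Inverses R L

  p^≈0 : ∀ {m} → L ≤ m → p ^ m ≈ 0#
  p^≈0 = nilpotent-above {p} p^L≈0

  -- (p;p)ₙ
  ⟨p⟩ : ℕ → Carrier
  ⟨p⟩ zero    = 1#
  ⟨p⟩ (suc n) = ⟨p⟩ n * (1# - p ^ suc n)

  1/⟨p⟩ : ℕ → Carrier
  1/⟨p⟩ zero    = 1#
  1/⟨p⟩ (suc n) = 1/⟨p⟩ n * geometric (p ^ suc n)

  geometric-power : ∀ n → (1# - p ^ suc n) * geometric (p ^ suc n) ≈ 1#
  geometric-power n = geometric-inverse _ (nilpotent-power {p} {L} n p^L≈0)

  cancel-1-p^ : ∀ n {x y} → (1# - p ^ suc n) * x ≈ (1# - p ^ suc n) * y → x ≈ y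
  cancel-1-p^ n {x} {y} eq = begin
    x ≈⟨ *-identityˡ x ⟨
    1# * x ≈⟨ *-congʳ (geometric-power n) ⟨
    (1# - p ^ suc n) * geometric (p ^ suc n) * x ≈⟨ solve 3 (λ u v x → u :* v :* x := v :* (u :* x)) refl _ _ x ⟩
    geometric (p ^ suc n) * ((1# - p ^ suc n) * x) ≈⟨ *-congˡ eq ⟩
    geometric (p ^ suc n) * ((1# - p ^ suc n) * y) ≈⟨ solve 3 (λ u v x → u :* v :* x := v :* (u :* x)) refl _ _ y ⟨
    (1# - p ^ suc n) * geometric (p ^ suc n) * y ≈⟨ *-congʳ (geometric-power n) ⟩
    1# * y ≈⟨ *-identityˡ y ⟩
    y ∎

  1/⟨p⟩-step : ∀ n → (1# - p ^ suc n) * 1/⟨p⟩ (suc n) ≈ 1/⟨p⟩ n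
  1/⟨p⟩-step n = begin
    (1# - p ^ suc n) * (1/⟨p⟩ n * geometric (p ^ suc n)) ≈⟨ solve 3 (λ u v w → u :* (v :* w) := u :* w :* v) refl _ _ _ ⟩
    (1# - p ^ suc n) * geometric (p ^ suc n) * 1/⟨p⟩ n ≈⟨ *-congʳ (geometric-power n) ⟩
    1# * 1/⟨p⟩ n ≈⟨ *-identityˡ _ ⟩
    1/⟨p⟩ n ∎

  ⟨p⟩-inverse : ∀ n → ⟨p⟩ n * 1/⟨p⟩ n ≈ 1#
  ⟨p⟩-inverse zero    = *-identityˡ 1#
  ⟨p⟩-inverse (suc n) = begin
    ⟨p⟩ n * (1# - p ^ suc n) * 1/⟨p⟩ (suc n) ≈⟨ *-assoc _ _ _ ⟩
    ⟨p⟩ n * ((1# - p ^ suc n) * 1/⟨p⟩ (suc n)) ≈⟨ *-congˡ (1/⟨p⟩-step n) ⟩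
    ⟨p⟩ n * 1/⟨p⟩ n ≈⟨ ⟨p⟩-inverse n ⟩
    1# ∎

  1-p^≈1 : ∀ {n} → L ≤ n → 1# - p ^ n ≈ 1#
  1-p^≈1 L≤n = trans (+-congˡ (-‿cong (p^≈0 L≤n))) (solve 0 (:1 :- :0 := :1) refl)

  -- All factors from the `L`-th on are 1, so `⟨p⟩ L` plays the part of (p;p)_∞.
  ⟨p⟩-stable : ∀ {n} → L ≤ n → ⟨p⟩ n ≈ ⟨p⟩ L
  ⟨p⟩-stable {zero}  z≤n   = refl
  ⟨p⟩-stable {suc n} L≤1+n with ℕ.m≤n⇒m<n∨m≡n L≤1+n
  ... | inj₂ ≡.refl    = refl
  ... | inj₁ (s≤s L≤n) = trans (*-cong (⟨p⟩-stable L≤n) (1-p^≈1 L≤1+n)) (*-identityʳ _)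

  inverse-unique : ∀ {x y z} → x * y ≈ 1# → x * z ≈ 1# → y ≈ z
  inverse-unique {x} {y} {z} xy xz = begin
    y ≈⟨ *-identityˡ y ⟨
    1# * y ≈⟨ *-congʳ xz ⟨
    x * z * y ≈⟨ solve 3 (λ x y z → x :* z :* y := x :* y :* z) refl x y z ⟩
    x * y * z ≈⟨ *-congʳ xy ⟩
    1# * z ≈⟨ *-identityˡ z ⟩
    z ∎

  1/⟨p⟩-stable : ∀ {n} → L ≤ n → 1/⟨p⟩ n ≈ 1/⟨p⟩ L
  1/⟨p⟩-stable {n} L≤n = inverse-unique (trans (*-congʳ (sym (⟨p⟩-stable L≤n))) (⟨p⟩-inverse n)) (⟨p⟩-inverse L)

  -- ι n r = 1/(p;p)ₙ₋ᵣ, which is 0 for r > n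
  ι : ℕ → ℕ → Carrier
  ι n       zero    = 1/⟨p⟩ n
  ι zero    (suc r) = 0#
  ι (suc n) (suc r) = ι n r

  -- This is (1 - p^(n-r)) / (p;p)ₙ₋ᵣ = 1 / (p;p)ₙ₋ᵣ₋₁ multiplied by p^r. In this form no difference
  -- of exponents occurs, and it remains true for r ≥ n, where the last term vanishes.
  ι-law : ∀ n r → p ^ n * ι n r ≈ p ^ r * ι n r - p ^ r * ι n (suc r)
  ι-law zero    zero    = solve 0 (:1 :* :1 := :1 :* :1 :- :1 :* :0) refl
  ι-law (suc n) zero    = begin
    p ^ suc n * 1/⟨p⟩ (suc n) ≈⟨ solve 2 (λ x y → x :* y := :1 :* y :- :1 :* ((:1 :- x) :* y)) refl _ _ ⟩
    1# * 1/⟨p⟩ (suc n) - 1# * ((1# - p ^ suc n) * 1/⟨p⟩ (suc n)) ≈⟨ +-congˡ (-‿cong (*-congˡ (1/⟨p⟩-step n))) ⟩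
    1# * 1/⟨p⟩ (suc n) - 1# * 1/⟨p⟩ n ∎
  ι-law zero    (suc r) = solve 2 (λ x y → x :* :0 := y :* :0 :- y :* :0) refl _ _
  ι-law (suc n) (suc r) = begin
    p * p ^ n * ι n r ≈⟨ *-assoc _ _ _ ⟩
    p * (p ^ n * ι n r) ≈⟨ *-congˡ (ι-law n r) ⟩
    p * (p ^ r * ι n r - p ^ r * ι n (suc r)) ≈⟨ solve 4 (λ p x y z → p :* (x :* y :- x :* z) := p :* x :* y :- p :* x :* z) refl _ _ _ _ ⟩
    p * p ^ r * ι n r - p * p ^ r * ι n (suc r) ∎

  ι-zero : ∀ {n r} → n < r → ι n r ≈ 0#
  ι-zero {zero}  (s≤s _)   = refl
  ι-zero {suc n} (s≤s n<r) = ι-zero n<r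

  ι-+ : ∀ r n → ι (r ℕ.+ n) r ≡ 1/⟨p⟩ n
  ι-+ zero    n = ≡.refl
  ι-+ (suc r) n = ι-+ r n

  ι-∸ : ∀ {n r} → r ≤ n → ι n r ≡ 1/⟨p⟩ (n ℕ.∸ r)
  ι-∸ {n}     {zero}  _         = ≡.refl
  ι-∸ {suc n} {suc r} (s≤s r≤n) = ι-∸ r≤n

-- The number n (n - 1) / 2; hence `triangle (suc n)` is n (n + 1) / 2.
triangle : ℕ → ℕ
triangle zero    = 0
triangle (suc n) = triangle n ℕ.+ n

-- The linear system of the walk series and the uniqueness of its solution.

module PeakSystem (R : CommutativeRing 0ℓ 0ℓ) (L : ℕ) (q : CommutativeRing.Carrier R)
                  (q^L≈0 : CommutativeRing._≈_ R (Powers._^_ R q L) (CommutativeRing.0# R)) where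
  open CommutativeRing R hiding (zero)
  open SetoidReasoning setoid
  open IntegerCoefficients R
  open Powers R
  open Pochhammer R L q q^L≈0

  -- The linear system that the first-step decomposition imposes on the series of the walks
  -- with N < K peaks from height l - s, normalised by (-q;q)_N q^(N (N - 1) / 2).
  record IsPeakSystem (K l : ℕ) (X : ℕ → ℕ → Carrier) : Set where
    V : ℕ → ℕ → Carrier
    V s N = X s N - q ^ N * X (suc s) N
    field
      initial : ∀ {s} → s ≤ suc l → X s 0 ≈ 1#
      V-zero  : ∀ M → V 0 (suc M) ≈ X 0 M
      V-suc   : ∀ {s} → s < l → ∀ M → V (suc s) (suc M) ≈ X (suc s) M + q ^ suc M * V s (suc M)
      last    : ∀ {N} → N < K → X (suc l) N ≈ X l N

  module _ {K l X Y} (sysX : IsPeakSystem K l X) (sysY : IsPeakSystem K l Y) where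
    private
      module X = IsPeakSystem sysX
      module Y = IsPeakSystem sysY

    module _ (M : ℕ) (M<K : suc M < K) (X≈Y : ∀ {s} → s ≤ suc l → X s M ≈ Y s M) where

      -- The right-hand sides of `V-zero` and `V-suc` involve only level `M` and the preceding `V`,
      -- so `V` is settled on level `suc M` before any `X` of that level is known.
      V-unique : ∀ {s} → s ≤ l → X.V s (suc M) ≈ Y.V s (suc M)
      V-unique {zero}  _   = trans (X.V-zero M) (trans (X≈Y z≤n) (sym (Y.V-zero M)))
      V-unique {suc s} s<l = begin
        X.V (suc s) (suc M) ≈⟨ X.V-suc s<l M ⟩
        X (suc s) M + q ^ suc M * X.V s (suc M) ≈⟨ +-cong (X≈Y (ℕ.m≤n⇒m≤1+n s<l)) (*-congˡ (V-unique (ℕ.<⇒≤ s<l))) ⟩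
        Y (suc s) M + q ^ suc M * Y.V s (suc M) ≈⟨ Y.V-suc s<l M ⟨
        Y.V (suc s) (suc M) ∎

      -- The condition `last` closes the recursion: at s = l it turns `V` into (1 - q^(M+1)) X, and
      -- this factor is a unit because q is nilpotent. Smaller s are then reached by descending from
      -- l.
      last-unique : X l (suc M) ≈ Y l (suc M)
      last-unique = cancel-1-p^ M (trans (sym (V-last sysX)) (trans (V-unique ℕ.≤-refl) (V-last sysY)))
        where
        V-last : ∀ {W} (sys : IsPeakSystem K l W) → IsPeakSystem.V sys l (suc M) ≈ (1# - q ^ suc M) * W l (suc M)
        V-last sys = trans (+-congˡ (-‿cong (*-congˡ (IsPeakSystem.last sys M<K))))
                           (solve 2 (λ x w → w :- x :* w := (:1 :- x) :* w) refl _ _)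

      step-unique : ∀ d {s} → s ℕ.+ d ≡ l → X s (suc M) ≈ Y s (suc M)
      step-unique zero    {s} ≡.refl = ≡.subst (λ i → X i (suc M) ≈ Y i (suc M)) (ℕ.+-identityʳ s) last-unique
      step-unique (suc d) {s} eq = begin
        X s (suc M) ≈⟨ solve 2 (λ x y → x := x :- y :+ y) refl _ _ ⟩
        X.V s (suc M) + q ^ suc M * X (suc s) (suc M) ≈⟨ +-cong (V-unique (≡.subst (s ≤_) eq (ℕ.m≤m+n s (suc d)))) (*-congˡ (step-unique d (≡.trans (≡.sym (ℕ.+-suc s d)) eq))) ⟩
        Y.V s (suc M) + q ^ suc M * Y (suc s) (suc M) ≈⟨ solve 2 (λ x y → x := x :- y :+ y) refl _ _ ⟨
        Y s (suc M) ∎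

    peakSystem-unique : ∀ N → N < K → ∀ {s} → s ≤ suc l → X s N ≈ Y s N
    peakSystem-unique zero    _   s≤ = trans (X.initial s≤) (sym (Y.initial s≤))
    peakSystem-unique (suc M) M<K {s} s≤ with ℕ.m≤n⇒m<n∨m≡n s≤
    ... | inj₁ (s≤s s≤l) = step-unique M M<K (λ {t} → peakSystem-unique M (ℕ.<⇒≤ M<K) {t}) (l ℕ.∸ s) (ℕ.m+[n∸m]≡n s≤l)
    ... | inj₂ ≡.refl    = trans (X.last M<K) (trans (last-unique M M<K (λ {t} → peakSystem-unique M (ℕ.<⇒≤ M<K) {t})) (sym (Y.last M<K)))

-- The alternating sums as a solution of the system.

module AlternatingSum (R : CommutativeRing 0ℓ 0ℓ) (L : ℕ) (q : CommutativeRing.Carrier R)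
                      (q^L≈0 : CommutativeRing._≈_ R (Powers._^_ R q L) (CommutativeRing.0# R)) where
  open CommutativeRing R hiding (zero)
  open SetoidReasoning setoid
  open IntegerCoefficients R
  open Sums R
  open Powers R
  open Pochhammer R L q q^L≈0
  open PeakSystem R L q q^L≈0

  -- The kernel 1 / ((q)_{N-r} (q)_{N+r}) of Bailey pairs relative to 1.
  g : ℕ → ℕ → Carrier
  g N r = ι N r * 1/⟨p⟩ (N ℕ.+ r)

  module _ (κ : ℕ) where

    -- pos h r and neg h′ r are the terms of index r and - (r + 1) of the bilateral
    -- series ∑ (-1)ʳ q^(κ r² + r (r - 1) / 2 + h r), where h + h′ = κ + 1.
    pos neg : ℕ → ℕ → Carrier
    pos h  r = σ r * q ^ (κ ℕ.* r ℕ.* r ℕ.+ triangle r ℕ.+ h ℕ.* r)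
    neg h′ r = - σ r * q ^ (κ ℕ.* r ℕ.* r ℕ.+ triangle r ℕ.+ r ℕ.+ κ ℕ.* r ℕ.+ h′ ℕ.* suc r)

    pos-suc : ∀ h r → pos (suc h) r ≈ pos h r * q ^ r
    pos-suc h r = trans (*-congˡ (^-split q _ r (exponents (κ ℕ.* r ℕ.* r ℕ.+ triangle r) h r))) (sym (*-assoc _ _ _))
      where
      exponents : ∀ e h r → e ℕ.+ suc h ℕ.* r ≡ e ℕ.+ h ℕ.* r ℕ.+ r
      exponents = solve-∀

    neg-suc : ∀ h r → neg (suc h) r ≈ neg h r * q ^ suc r
    neg-suc h r = trans (*-congˡ (^-split q _ (suc r) (exponents (κ ℕ.* r ℕ.* r ℕ.+ triangle r ℕ.+ r ℕ.+ κ ℕ.* r) h r))) (sym (*-assoc _ _ _))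
      where
      exponents : ∀ e h r → e ℕ.+ suc h ℕ.* suc r ≡ e ℕ.+ h ℕ.* suc r ℕ.+ suc r
      exponents = solve-∀

    -- At h = κ + 1 the exponent is invariant under r ↦ -(r + 1), while the sign changes.
    pos-neg-cancel : ∀ r → pos (suc κ) r + neg 0 r ≈ 0#
    pos-neg-cancel r = begin
      pos (suc κ) r + neg 0 r ≈⟨ +-congʳ (*-congˡ (^-congʳ q (exponents κ r (triangle r)))) ⟩
      _ ≈⟨ solve 2 (λ s e → s :* e :+ (:- s) :* e := :0) refl _ _ ⟩
      0# ∎
      where
      exponents : ∀ κ r t → κ ℕ.* r ℕ.* r ℕ.+ t ℕ.+ suc κ ℕ.* r ≡ κ ℕ.* r ℕ.* r ℕ.+ t ℕ.+ r ℕ.+ κ ℕ.* r ℕ.+ 0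
      exponents = solve-∀

    pos-0-suc : ∀ r → pos 0 (suc r) ≈ neg κ r
    pos-0-suc r = *-congˡ (^-congʳ q (exponents κ r (triangle r)))
      where
      exponents : ∀ κ r t → κ ℕ.* suc r ℕ.* suc r ℕ.+ (t ℕ.+ r) ℕ.+ 0 ≡ κ ℕ.* r ℕ.* r ℕ.+ t ℕ.+ r ℕ.+ κ ℕ.* r ℕ.+ κ ℕ.* suc r
      exponents = solve-∀

    pos-1-suc : ∀ r → pos 1 (suc r) ≈ neg (suc κ) r
    pos-1-suc r = trans (pos-suc 0 (suc r)) (trans (*-congʳ (pos-0-suc r)) (sym (neg-suc κ r)))

    module _ (K : ℕ) where

      -- The bilateral sum of these terms against `g`, folded so that -(r + 1) is paired with r; `g`
      -- is even in its index, which gives `g N (suc r)`. Carrying both h and h′ avoids the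
      -- subtraction κ + 1 - h.
      Z : ℕ → ℕ → ℕ → Carrier
      Z h h′ N = ∑ K λ r → pos h r * g N r + neg h′ r * g N (suc r)

      -- The companion kernel 1 / ((q)_{N-r-1} (q)_{N+r}) is invariant under r ↦ -(r + 1), so both
      -- terms of a pair share it. Differences of `Z` at N give `W` at N, and differences of `W` at
      -- N give `Z` at N - 1; together they make up the system.
      W : ℕ → ℕ → ℕ → Carrier
      W h h′ N = ∑ K λ r → (pos h r + neg h′ r) * (ι N (suc r) * 1/⟨p⟩ (N ℕ.+ r))

      Z-difference : ∀ h h′ N → Z (suc h) h′ N - q ^ N * Z h (suc h′) N ≈ W (suc h) h′ N
      Z-difference h h′ N = begin
        Z (suc h) h′ N - q ^ N * Z h (suc h′) N ≈⟨ +-congˡ (-‿cong (∑-*ˡ K _ _)) ⟩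
        Z (suc h) h′ N - ∑ K _ ≈⟨ ∑-- K _ _ ⟨
        ∑ K _ ≈⟨ ∑-cong K term ⟩
        W (suc h) h′ N ∎
        where
        term : ∀ r → (pos (suc h) r * g N r + neg h′ r * g N (suc r)) - q ^ N * (pos h r * g N r + neg (suc h′) r * g N (suc r))
                     ≈ (pos (suc h) r + neg h′ r) * (ι N (suc r) * 1/⟨p⟩ (N ℕ.+ r))
        term r rewrite ℕ.+-suc N r = begin
          (pos (suc h) r * (i * c) + b * (i′ * c′)) - A * (a * (i * c) + neg (suc h′) r * (i′ * c′))
            ≈⟨ +-cong (+-congʳ (*-congʳ (pos-suc h r))) (-‿cong (*-congˡ (+-congˡ (*-congʳ (neg-suc h′ r))))) ⟩
          (a * Q * (i * c) + b * (i′ * c′)) - A * (a * (i * c) + b * (q * Q) * (i′ * c′))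
            ≈⟨ solve 9 (λ a b i c i′ c′ A Q q → (a :* Q :* (i :* c) :+ b :* (i′ :* c′)) :- A :* (a :* (i :* c) :+ b :* (q :* Q) :* (i′ :* c′))
                        := a :* c :* (Q :* i :- A :* i) :+ b :* i′ :* ((:1 :- q :* (A :* Q)) :* c′)) refl a b i c i′ c′ A Q q ⟩
          a * c * (Q * i - A * i) + b * i′ * ((1# - q * (A * Q)) * c′)
            ≈⟨ +-cong (*-congˡ (+-congˡ (-‿cong (ι-law N r)))) (*-congˡ (trans (*-congʳ (+-congˡ (-‿cong (*-congˡ (sym (^-homo-* q N r)))))) (1/⟨p⟩-step (N ℕ.+ r)))) ⟩
          a * c * (Q * i - (Q * i - Q * i′)) + b * i′ * c
            ≈⟨ solve 6 (λ a b i c i′ Q → a :* c :* (Q :* i :- (Q :* i :- Q :* i′)) :+ b :* i′ :* c := (a :* Q :+ b) :* (i′ :* c)) refl a b i c i′ Q ⟩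
          (a * Q + b) * (i′ * c)
            ≈⟨ *-congʳ (+-congʳ (pos-suc h r)) ⟨
          (pos (suc h) r + b) * (i′ * c) ∎
          where
          a = pos h r
          b = neg h′ r
          i = ι N r
          i′ = ι N (suc r)
          c = 1/⟨p⟩ (N ℕ.+ r)
          c′ = 1/⟨p⟩ (suc (N ℕ.+ r))
          A = q ^ N
          Q = q ^ r

      W-difference : ∀ h h′ M → W h (suc h′) (suc M) - q ^ suc M * W (suc h) h′ (suc M) ≈ Z h (suc h′) M
      W-difference h h′ M = begin
        W h (suc h′) (suc M) - q ^ suc M * W (suc h) h′ (suc M) ≈⟨ +-congˡ (-‿cong (∑-*ˡ K _ _)) ⟩
        W h (suc h′) (suc M) - ∑ K _ ≈⟨ ∑-- K _ _ ⟨
        ∑ K _ ≈⟨ ∑-cong K term ⟩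
        Z h (suc h′) M ∎
        where
        term : ∀ r → (pos h r + neg (suc h′) r) * (ι M r * 1/⟨p⟩ (suc M ℕ.+ r)) - q ^ suc M * ((pos (suc h) r + neg h′ r) * (ι M r * 1/⟨p⟩ (suc M ℕ.+ r)))
                     ≈ pos h r * g M r + neg (suc h′) r * g M (suc r)
        term r rewrite ℕ.+-suc M r = begin
          (a + neg (suc h′) r) * (i * c′) - q * A * ((pos (suc h) r + b) * (i * c′))
            ≈⟨ +-cong (*-congʳ (+-congˡ (neg-suc h′ r))) (-‿cong (*-congˡ (*-congʳ (+-congʳ (pos-suc h r))))) ⟩
          (a + b * (q * Q)) * (i * c′) - q * A * ((a * Q + b) * (i * c′))
            ≈⟨ solve 7 (λ a b i c′ A Q q → (a :+ b :* (q :* Q)) :* (i :* c′) :- q :* A :* ((a :* Q :+ b) :* (i :* c′))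
                        := a :* i :* ((:1 :- q :* (A :* Q)) :* c′) :+ b :* q :* c′ :* (Q :* i :- A :* i)) refl a b i c′ A Q q ⟩
          a * i * ((1# - q * (A * Q)) * c′) + b * q * c′ * (Q * i - A * i)
            ≈⟨ +-cong (*-congˡ (trans (*-congʳ (+-congˡ (-‿cong (*-congˡ (sym (^-homo-* q M r)))))) (1/⟨p⟩-step (M ℕ.+ r)))) (*-congˡ (+-congˡ (-‿cong (ι-law M r)))) ⟩
          a * i * c + b * q * c′ * (Q * i - (Q * i - Q * i′))
            ≈⟨ solve 8 (λ a b i c i′ c′ Q q → a :* i :* c :+ b :* q :* c′ :* (Q :* i :- (Q :* i :- Q :* i′)) := a :* (i :* c) :+ b :* (q :* Q) :* (i′ :* c′)) refl a b i c i′ c′ Q q ⟩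
          a * (i * c) + b * (q * Q) * (i′ * c′)
            ≈⟨ +-congˡ (*-congʳ (neg-suc h′ r)) ⟨
          a * (i * c) + neg (suc h′) r * (i′ * c′) ∎
          where
          a = pos h r
          b = neg h′ r
          i = ι M r
          i′ = ι M (suc r)
          c = 1/⟨p⟩ (M ℕ.+ r)
          c′ = 1/⟨p⟩ (suc (M ℕ.+ r))
          A = q ^ M
          Q = q ^ r

      W-top : ∀ N → W (suc κ) 0 N ≈ 0#
      W-top N = ∑-zero K λ r → trans (*-congʳ (pos-neg-cancel r)) (zeroˡ _)

      -- The reflection r ↦ -r fixes `g` and exchanges h = 0 with h = 1, as κ r² + r (r - 1) / 2
      -- becomes κ r² + r (r + 1) / 2. In folded form the positive terms of each sum become the
      -- negative terms of the other, which requires the index shift on both sides.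
      Z-reflect : ∀ N → N < K → Z 0 (suc κ) N ≈ Z 1 κ N
      Z-reflect N N<K = begin
        Z 0 (suc κ) N ≈⟨ ∑-+ K _ _ ⟩
        ∑ K (λ r → pos 0 r * g N r) + ∑ K (λ r → neg (suc κ) r * g N (suc r)) ≈⟨ +-congʳ (∑-shift K _ (vanish (pos 0 K))) ⟩
        pos 0 0 * g N 0 + ∑ K (λ r → pos 0 (suc r) * g N (suc r)) + ∑ K (λ r → neg (suc κ) r * g N (suc r))
          ≈⟨ +-cong (+-congˡ (∑-cong K λ r → *-congʳ (pos-0-suc r))) (∑-cong K λ r → *-congʳ (sym (pos-1-suc r))) ⟩
        pos 1 0 * g N 0 + ∑ K (λ r → neg κ r * g N (suc r)) + ∑ K (λ r → pos 1 (suc r) * g N (suc r))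
          ≈⟨ solve 3 (λ x y z → x :+ y :+ z := x :+ z :+ y) refl _ _ _ ⟩
        pos 1 0 * g N 0 + ∑ K (λ r → pos 1 (suc r) * g N (suc r)) + ∑ K (λ r → neg κ r * g N (suc r))
          ≈⟨ +-congʳ (∑-shift K _ (vanish (pos 1 K))) ⟨
        ∑ K (λ r → pos 1 r * g N r) + ∑ K (λ r → neg κ r * g N (suc r)) ≈⟨ ∑-+ K _ _ ⟨
        Z 1 κ N ∎
        where
        vanish : ∀ x → x * g N K ≈ 0#
        vanish x = trans (*-congˡ (trans (*-congʳ (ι-zero N<K)) (zeroˡ _))) (zeroʳ x)

      Z-initial : 0 < K → ∀ h h′ → Z h h′ 0 ≈ 1#
      Z-initial (s≤s {n = K′} _) h h′ = begin
        Z h h′ 0 ≈⟨ ∑-head K′ _ ⟩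
        pos h 0 * g 0 0 + neg h′ 0 * (0# * 1/⟨p⟩ 1) + ∑ K′ _ ≈⟨ +-cong (+-congʳ (*-congʳ (*-congˡ (^-congʳ q (exponent κ h))))) (∑-zero K′ λ r → solve 4 (λ a b c d → a :* (:0 :* b) :+ c :* (:0 :* d) := :0) refl _ _ _ _) ⟩
        1# * 1# * (1# * 1#) + neg h′ 0 * (0# * 1/⟨p⟩ 1) + 0# ≈⟨ solve 2 (λ x y → :1 :* :1 :* (:1 :* :1) :+ x :* (:0 :* y) :+ :0 := :1) refl _ _ ⟩
        1# ∎
        where
        exponent : ∀ κ h → κ ℕ.* 0 ℕ.* 0 ℕ.+ 0 ℕ.+ h ℕ.* 0 ≡ 0
        exponent = solve-∀

  -- Here κ = l + 1 and s = h′ - 1. The difference `V` is a sum `W`; the antisymmetry in `W-top`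
  -- yields `V-zero`, and the reflection at h = 0 yields `last`.
  Z-isPeakSystem : ∀ l {K} → 0 < K → IsPeakSystem K l (λ s N → Z (suc l) K (suc l ℕ.∸ s) (suc s) N)
  Z-isPeakSystem l {K} 0<K = record
    { initial = λ {s} _ → Z-initial (suc l) K 0<K (suc l ℕ.∸ s) (suc s)
    ; V-zero  = λ M → begin
        V 0 (suc M) ≈⟨ Z-difference (suc l) K l 1 (suc M) ⟩
        W′ (suc l) 1 (suc M) ≈⟨ solve 2 (λ x y → x := x :- y :* :0) refl _ _ ⟩
        W′ (suc l) 1 (suc M) - q ^ suc M * 0# ≈⟨ +-congˡ (-‿cong (*-congˡ (W-top (suc l) K (suc M)))) ⟨
        W′ (suc l) 1 (suc M) - q ^ suc M * W′ (suc (suc l)) 0 (suc M) ≈⟨ W-difference (suc l) K (suc l) 0 M ⟩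
        Z (suc l) K (suc l) 1 M ∎
    ; V-suc   = λ {s} s<l M → begin
        V (suc s) (suc M) ≈⟨ V≈W (suc s) (suc M) s<l ⟩
        W′ (l ℕ.∸ s) (2 ℕ.+ s) (suc M) ≈⟨ solve 3 (λ x y A → x := x :- A :* y :+ A :* y) refl _ _ _ ⟩
        W′ (l ℕ.∸ s) (2 ℕ.+ s) (suc M) - q ^ suc M * W′ (suc (l ℕ.∸ s)) (suc s) (suc M) + q ^ suc M * W′ (suc (l ℕ.∸ s)) (suc s) (suc M)
                                                                       ≈⟨ +-cong (W-difference (suc l) K (l ℕ.∸ s) (suc s) M) (*-congˡ (reflexive (≡.cong (λ h → W′ h (suc s) (suc M)) (≡.sym (ℕ.+-∸-assoc 1 (ℕ.<⇒≤ s<l)))))) ⟩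
        Z (suc l) K (l ℕ.∸ s) (2 ℕ.+ s) M + q ^ suc M * W′ (suc l ℕ.∸ s) (suc s) (suc M)
                                                                       ≈⟨ +-congˡ (*-congˡ (V≈W s (suc M) (ℕ.<⇒≤ s<l))) ⟨
        Z (suc l) K (l ℕ.∸ s) (2 ℕ.+ s) M + q ^ suc M * V s (suc M) ∎
    ; last    = λ {N} N<K → trans (reflexive (≡.cong (λ h → Z (suc l) K h (2 ℕ.+ l) N) (ℕ.n∸n≡0 l)))
                           (trans (Z-reflect (suc l) K N N<K)
                                  (reflexive (≡.cong (λ h → Z (suc l) K h (suc l) N) (≡.sym (≡.trans (ℕ.+-∸-assoc 1 (ℕ.≤-refl {l})) (≡.cong suc (ℕ.n∸n≡0 l)))))))
    }
    where
    W′ = W (suc l) K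
    V : ℕ → ℕ → Carrier
    V s N = Z (suc l) K (suc l ℕ.∸ s) (suc s) N - q ^ N * Z (suc l) K (l ℕ.∸ s) (2 ℕ.+ s) N
    V≈W : ∀ s N → s ≤ l → V s N ≈ W′ (suc l ℕ.∸ s) (suc s) N
    V≈W s N s≤l rewrite ℕ.+-∸-assoc 1 s≤l = Z-difference (suc l) K (l ℕ.∸ s) (suc s) N

triangle-+ : ∀ r s → triangle (suc (r ℕ.+ s)) ≡ triangle (suc r) ℕ.+ (triangle (suc s) ℕ.+ r ℕ.* s)
triangle-+ r zero    rewrite ℕ.+-identityʳ r | ℕ.*-zeroʳ r = ≡.sym (ℕ.+-identityʳ _)
triangle-+ r (suc s) rewrite ℕ.+-suc r s | triangle-+ r s = rearrange (triangle r) (triangle s) r s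
  where
  rearrange : ∀ t u r s → t ℕ.+ r ℕ.+ (u ℕ.+ s ℕ.+ r ℕ.* s) ℕ.+ suc (r ℕ.+ s) ≡ t ℕ.+ r ℕ.+ (u ℕ.+ s ℕ.+ suc s ℕ.+ r ℕ.* suc s)
  rearrange = solve-∀

triangle-square : ∀ r → triangle r ℕ.+ triangle r ℕ.+ r ≡ r ℕ.* r
triangle-square zero    = ≡.refl
triangle-square (suc r) = ≡.trans (rearrange (triangle r) r) (≡.trans (≡.cong (ℕ._+ suc (r ℕ.+ r)) (triangle-square r)) (square r))
  where
  rearrange : ∀ t r → t ℕ.+ r ℕ.+ (t ℕ.+ r) ℕ.+ suc r ≡ t ℕ.+ t ℕ.+ r ℕ.+ suc (r ℕ.+ r)
  rearrange = solve-∀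
  square : ∀ r → r ℕ.* r ℕ.+ suc (r ℕ.+ r) ≡ suc r ℕ.* suc r
  square = solve-∀

n≤triangle : ∀ n → n ≤ triangle (suc n)
n≤triangle n = ℕ.m≤n+m n (triangle n)

-- Summation over N against the weight, by creative telescoping.

module WeightedSum (R : CommutativeRing 0ℓ 0ℓ) (L : ℕ) (q : CommutativeRing.Carrier R)
                   (q^L≈0 : CommutativeRing._≈_ R (Powers._^_ R q L) (CommutativeRing.0# R))
                   (½ : CommutativeRing.Carrier R)
                   (½+½≈1 : CommutativeRing._≈_ R (CommutativeRing._+_ R ½ ½) (CommutativeRing.1# R)) where
  open CommutativeRing R hiding (zero)
  open SetoidReasoning setoid
  open IntegerCoefficients R
  open Sums R
  open Powers R
  open Pochhammer R L q q^L≈0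
  open AlternatingSum R L q q^L≈0

  ⟨-q⟩ : ℕ → Carrier
  ⟨-q⟩ zero    = 1#
  ⟨-q⟩ (suc n) = ⟨-q⟩ n * (1# + q ^ suc n)

  -- (-q;q)ₙ₋₁, with (-q;q)₋₁ = ½
  ⟨-q⟩₋₁ : ℕ → Carrier
  ⟨-q⟩₋₁ zero    = ½
  ⟨-q⟩₋₁ (suc n) = ⟨-q⟩ n

  ⟨-q⟩-pred : ∀ n → ⟨-q⟩ n ≈ (1# + q ^ n) * ⟨-q⟩₋₁ n
  ⟨-q⟩-pred zero    = trans (sym ½+½≈1) (solve 1 (λ h → h :+ h := (:1 :+ :1) :* h) refl ½)
  ⟨-q⟩-pred (suc n) = *-comm _ _

  ⟨-q⟩-stable : ∀ {n} → L ≤ n → ⟨-q⟩ n ≈ ⟨-q⟩ L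
  ⟨-q⟩-stable {zero}  z≤n   = refl
  ⟨-q⟩-stable {suc n} L≤1+n with ℕ.m≤n⇒m<n∨m≡n L≤1+n
  ... | inj₂ ≡.refl    = refl
  ... | inj₁ (s≤s L≤n) = trans (*-cong (⟨-q⟩-stable L≤n) (trans (+-congˡ (p^≈0 L≤1+n)) (+-identityʳ 1#))) (*-identityʳ _)

  -- (-q)_∞ / (q)_∞
  P : Carrier
  P = ⟨-q⟩ L * 1/⟨p⟩ L

  w : ℕ → Carrier
  w N = q ^ triangle (suc N) * ⟨-q⟩₋₁ N

  -- The product `w N * g N r` at N = r + s, divided by q^(r (r + 1) / 2). After this division (1 +
  -- q^r) times the sum over s no longer depends on r.
  t : ℕ → ℕ → Carrier
  t r s = q ^ (triangle (suc s) ℕ.+ r ℕ.* s) * ⟨-q⟩₋₁ (r ℕ.+ s) * (1/⟨p⟩ s * 1/⟨p⟩ (r ℕ.+ r ℕ.+ s))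

  module _ (r : ℕ) where
    private
      ρ = q ^ r

    -- Creative telescoping: G is a rational multiple of t r that makes (1 + q^r) ∑ₛ t r s
    -- independent of r, up to a boundary term.
    certificate : Carrier → Carrier
    certificate S = (1# + ρ) + ρ * (1# - ρ * ρ * q) * S

    G : ℕ → Carrier
    G s = certificate (q ^ s) * (1# - q ^ s) * (q ^ (triangle (suc s) ℕ.+ r ℕ.* s) * ⟨-q⟩₋₁ (r ℕ.+ s) * (1/⟨p⟩ s * 1/⟨p⟩ (suc (r ℕ.+ r ℕ.+ s))))

    t-telescopes : ∀ s → (1# + ρ) * t r s - (1# + q * ρ) * t (suc r) s ≈ G s - G (suc s)
    t-telescopes s = begin
      (1# + ρ) * t r s - (1# + q * ρ) * t (suc r) s ≈⟨ +-cong (*-congˡ t-r) (-‿cong (*-congˡ t-suc)) ⟩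
      -- Once every reciprocal is expressed through `x` and `y″`, the claim is a polynomial identity
      -- in q, ρ = q^r and S = q^s.
      _ ≈⟨ solve 7 (λ ρ q S e m x y →
          (:1 :+ ρ) :* (e :* m :* (x :* ((:1 :- ρ :* ρ :* q :* S) :* ((:1 :- ρ :* ρ :* q :* q :* S) :* y)))) :- (:1 :+ q :* ρ) :* (e :* S :* ((:1 :+ ρ :* S) :* m) :* (x :* y))
          := (((:1 :+ ρ) :+ ρ :* (:1 :- ρ :* ρ :* q) :* S) :* (:1 :- S) :* (e :* m :* (x :* ((:1 :- ρ :* ρ :* q :* q :* S) :* y)))
              :- ((:1 :+ ρ) :+ ρ :* (:1 :- ρ :* ρ :* q) :* (q :* S)) :* (e :* (q :* ρ :* S) :* ((:1 :+ ρ :* S) :* m) :* (x :* y)))) refl ρ q S e m x y″ ⟩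
      _ ≈⟨ +-cong (*-congˡ (*-congˡ (*-congˡ (sym y′-step)))) (-‿cong (sym G-suc)) ⟩
      G s - G (suc s) ∎
      where
      S = q ^ s
      e = q ^ (triangle (suc s) ℕ.+ r ℕ.* s)
      m = ⟨-q⟩₋₁ (r ℕ.+ s)
      x = 1/⟨p⟩ s
      n = r ℕ.+ r ℕ.+ s
      y″ = 1/⟨p⟩ (suc (suc n))
      q^n : q ^ n ≈ ρ * ρ * S
      q^n = trans (^-homo-* q (r ℕ.+ r) s) (*-congʳ (^-homo-* q r r))
      y′-step : 1/⟨p⟩ (suc n) ≈ (1# - ρ * ρ * q * q * S) * y″
      y′-step = trans (sym (1/⟨p⟩-step (suc n))) (*-congʳ (+-congˡ (-‿cong (trans (*-congˡ (*-congˡ q^n)) (solve 3 (λ q ρ S → q :* (q :* (ρ :* ρ :* S)) := ρ :* ρ :* q :* q :* S) refl q ρ S)))))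
      y-step : 1/⟨p⟩ n ≈ (1# - ρ * ρ * q * S) * ((1# - ρ * ρ * q * q * S) * y″)
      y-step = trans (sym (1/⟨p⟩-step n)) (*-cong (+-congˡ (-‿cong (trans (*-congˡ q^n) (solve 3 (λ q ρ S → q :* (ρ :* ρ :* S) := ρ :* ρ :* q :* S) refl q ρ S)))) y′-step)
      t-r : t r s ≈ e * m * (x * ((1# - ρ * ρ * q * S) * ((1# - ρ * ρ * q * q * S) * y″)))
      t-r = *-congˡ (*-congˡ y-step)
      m-step : ⟨-q⟩ (r ℕ.+ s) ≈ (1# + ρ * S) * m
      m-step = trans (⟨-q⟩-pred (r ℕ.+ s)) (*-congʳ (+-congˡ (^-homo-* q r s)))
      t-suc : t (suc r) s ≈ e * S * ((1# + ρ * S) * m) * (x * y″)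
      t-suc = *-cong (*-cong (^-split q _ s (exponents (triangle (suc s)) r s)) m-step) (*-congˡ (reflexive (≡.cong (λ i → 1/⟨p⟩ (suc (i ℕ.+ s))) (ℕ.+-suc r r))))
        where
        exponents : ∀ e r s → e ℕ.+ suc r ℕ.* s ≡ e ℕ.+ r ℕ.* s ℕ.+ s
        exponents = solve-∀
      G-suc : G (suc s) ≈ certificate (q * S) * (e * (q * ρ * S) * ((1# + ρ * S) * m) * (x * y″))
      G-suc = begin
        certificate (q * S) * (1# - q * S) * (q ^ (triangle (suc (suc s)) ℕ.+ r ℕ.* suc s) * ⟨-q⟩₋₁ (r ℕ.+ suc s) * (1/⟨p⟩ (suc s) * 1/⟨p⟩ (suc (r ℕ.+ r ℕ.+ suc s))))
          ≈⟨ *-congˡ (*-cong (*-cong exponent (trans (reflexive (≡.cong ⟨-q⟩₋₁ (ℕ.+-suc r s))) m-step)) (*-congˡ (reflexive (≡.cong (λ i → 1/⟨p⟩ (suc i)) (ℕ.+-suc (r ℕ.+ r) s))))) ⟩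
        certificate (q * S) * (1# - q * S) * (e * (q * ρ * S) * ((1# + ρ * S) * m) * (1/⟨p⟩ (suc s) * y″))
          ≈⟨ solve 6 (λ c u e m x y → c :* u :* (e :* m :* (x :* y)) := c :* (e :* m :* (u :* x :* y))) refl (certificate (q * S)) (1# - q * S) (e * (q * ρ * S)) ((1# + ρ * S) * m) (1/⟨p⟩ (suc s)) y″ ⟩
        certificate (q * S) * (e * (q * ρ * S) * ((1# + ρ * S) * m) * ((1# - q * S) * 1/⟨p⟩ (suc s) * y″))
          ≈⟨ *-congˡ (*-congˡ (*-congʳ (1/⟨p⟩-step s))) ⟩
        certificate (q * S) * (e * (q * ρ * S) * ((1# + ρ * S) * m) * (x * y″)) ∎
        where
        exponents : ∀ e r s → e ℕ.+ suc s ℕ.+ r ℕ.* suc s ≡ e ℕ.+ r ℕ.* s ℕ.+ (1 ℕ.+ r ℕ.+ s)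
        exponents = solve-∀
        exponent : q ^ (triangle (suc (suc s)) ℕ.+ r ℕ.* suc s) ≈ e * (q * ρ * S)
        exponent = trans (^-split q _ (1 ℕ.+ r ℕ.+ s) (exponents (triangle (suc s)) r s)) (*-congˡ (trans (*-congˡ (^-homo-* q r s)) (sym (*-assoc q ρ S))))

  module _ {K : ℕ} (L≤K : L ≤ K) where

    -- Both boundary terms of the telescoping vanish: `G r 0` contains 1 - q^0, and `G r K` contains
    -- a power of q with exponent at least `L`.
    ∑t-invariant : ∀ r → (1# + q ^ r) * ∑ K (t r) ≈ (1# + q ^ suc r) * ∑ K (t (suc r))
    ∑t-invariant r = begin
      x ≈⟨ solve 2 (λ x y → x := x :- y :+ y) refl x y ⟩
      x - y + y ≈⟨ +-congʳ difference ⟩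
      0# + y ≈⟨ +-identityˡ y ⟩
      y ∎
      where
      x = (1# + q ^ r) * ∑ K (t r)
      y = (1# + q ^ suc r) * ∑ K (t (suc r))
      difference : x - y ≈ 0#
      difference = begin
        x - y ≈⟨ +-cong (∑-*ˡ K _ _) (-‿cong (∑-*ˡ K _ _)) ⟩
        ∑ K _ - ∑ K _ ≈⟨ ∑-- K _ _ ⟨
        ∑ K _ ≈⟨ ∑-cong K (t-telescopes r) ⟩
        ∑ K (λ s → G r s - G r (suc s)) ≈⟨ ∑-telescope K (G r) ⟩
        G r 0 - G r K ≈⟨ +-congˡ (-‿cong (*-congˡ (*-congʳ (trans (*-congʳ (p^≈0 (ℕ.≤-trans L≤K (ℕ.≤-trans (n≤triangle K) (ℕ.m≤m+n _ _))))) (zeroˡ _))))) ⟩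
        G r 0 - _ * (0# * _) ≈⟨ solve 4 (λ c x y z → c :* (:1 :- :1) :* x :- y :* (:0 :* z) := :0) refl _ _ _ _ ⟩
        0# ∎

    ∑t-invariant⁺ : ∀ d r → (1# + q ^ r) * ∑ K (t r) ≈ (1# + q ^ (d ℕ.+ r)) * ∑ K (t (d ℕ.+ r))
    ∑t-invariant⁺ zero    r = refl
    ∑t-invariant⁺ (suc d) r = trans (∑t-invariant⁺ d r) (∑t-invariant (d ℕ.+ r))

    -- By invariance r may be moved beyond `L`. There 1 + q^r is 1, only s = 0 survives, and the
    -- Pochhammer symbols are stable. The shift is `suc L` rather than `L` because `⟨-q⟩₋₁` lags one
    -- factor behind.
    ∑t-value : 0 < K → ∀ r → (1# + q ^ r) * ∑ K (t r) ≈ P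
    ∑t-value (s≤s {n = K′} _) r = begin
      (1# + q ^ r) * ∑ K (t r) ≈⟨ ∑t-invariant⁺ (suc L) r ⟩
      (1# + q ^ R′) * ∑ K (t R′) ≈⟨ *-cong (trans (+-congˡ (p^≈0 L≤R′)) (+-identityʳ 1#)) (∑-head K′ (t R′)) ⟩
      1# * (t R′ 0 + ∑ K′ (λ s → t R′ (suc s))) ≈⟨ *-congˡ (+-congˡ (∑-zero K′ vanish)) ⟩
      1# * (t R′ 0 + 0#) ≈⟨ *-congˡ (+-congʳ (*-cong (*-cong (^-congʳ q (ℕ.*-zeroʳ R′)) (trans (reflexive (≡.cong ⟨-q⟩₋₁ (ℕ.+-identityʳ R′))) (⟨-q⟩-stable (ℕ.m≤m+n L r)))) (*-congˡ (1/⟨p⟩-stable (ℕ.≤-trans L≤R′ (ℕ.≤-trans (ℕ.m≤m+n R′ R′) (ℕ.m≤m+n _ 0))))))) ⟩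
      1# * (1# * ⟨-q⟩ L * (1# * 1/⟨p⟩ L) + 0#) ≈⟨ solve 2 (λ x y → :1 :* (:1 :* x :* (:1 :* y) :+ :0) := x :* y) refl _ _ ⟩
      P ∎
      where
      R′ = suc L ℕ.+ r
      L≤R′ : L ≤ R′
      L≤R′ = ℕ.m≤n⇒m≤1+n (ℕ.m≤m+n L r)
      vanish : ∀ s → t R′ (suc s) ≈ 0#
      vanish s = trans (*-congʳ (trans (*-congʳ (p^≈0 (ℕ.≤-trans L≤R′ (ℕ.≤-trans (ℕ.m≤m*n R′ (suc s)) (ℕ.m≤n+m _ (triangle (suc (suc s)))))))) (zeroˡ _))) (zeroˡ _)

    w-vanish : ∀ {N} → L ≤ N → w N ≈ 0#
    w-vanish {N} L≤N = trans (*-congʳ (p^≈0 (ℕ.≤-trans L≤N (n≤triangle N)))) (zeroˡ _)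

    ∑wg-shift : ∀ r → ∑ K (λ N → w N * g N r) ≈ q ^ triangle (suc r) * ∑ K (t r)
    ∑wg-shift r = begin
      ∑ K f ≈⟨ ∑-truncate f (ℕ.m≤n+m K r) (λ N K≤N → trans (*-congʳ (w-vanish (ℕ.≤-trans L≤K K≤N))) (zeroˡ _)) ⟨
      ∑ (r ℕ.+ K) f ≈⟨ ∑-drop r K f (λ N N<r → trans (*-congˡ (trans (*-congʳ (ι-zero N<r)) (zeroˡ _))) (zeroʳ _)) ⟩
      ∑ K (λ s → f (r ℕ.+ s)) ≈⟨ ∑-cong K term ⟩
      ∑ K (λ s → q ^ triangle (suc r) * t r s) ≈⟨ ∑-*ˡ K _ _ ⟨
      q ^ triangle (suc r) * ∑ K (t r) ∎
      where
      f = λ N → w N * g N r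
      rearrange : ∀ r s → r ℕ.+ s ℕ.+ r ≡ r ℕ.+ r ℕ.+ s
      rearrange = solve-∀
      term : ∀ s → w (r ℕ.+ s) * g (r ℕ.+ s) r ≈ q ^ triangle (suc r) * t r s
      term s rewrite ι-+ r s | rearrange r s = begin
        q ^ triangle (suc (r ℕ.+ s)) * ⟨-q⟩₋₁ (r ℕ.+ s) * (1/⟨p⟩ s * 1/⟨p⟩ (r ℕ.+ r ℕ.+ s)) ≈⟨ *-congʳ (*-congʳ (^-split q (triangle (suc r)) _ (triangle-+ r s))) ⟩
        _ * _ * ⟨-q⟩₋₁ (r ℕ.+ s) * (1/⟨p⟩ s * 1/⟨p⟩ (r ℕ.+ r ℕ.+ s)) ≈⟨ solve 4 (λ a b c d → a :* b :* c :* d := a :* (b :* c :* d)) refl _ _ _ _ ⟩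
        q ^ triangle (suc r) * t r s ∎

    -- This is Bailey's lemma relative to 1 with ρ₁ = -1 and ρ₂ → ∞, applied to a single index r.
    ∑wg-value : 0 < K → ∀ r → (1# + q ^ r) * ∑ K (λ N → w N * g N r) ≈ P * q ^ triangle (suc r)
    ∑wg-value 0<K r = begin
      (1# + q ^ r) * ∑ K (λ N → w N * g N r) ≈⟨ *-congˡ (∑wg-shift r) ⟩
      (1# + q ^ r) * (q ^ triangle (suc r) * ∑ K (t r)) ≈⟨ solve 3 (λ x y z → x :* (y :* z) := x :* z :* y) refl _ _ _ ⟩
      (1# + q ^ r) * ∑ K (t r) * q ^ triangle (suc r) ≈⟨ *-congʳ (∑t-value 0<K r) ⟩
      P * q ^ triangle (suc r) ∎

    -- For h + a = k, the folded form of ∑ (-1)ʳ q^(k r² + h r) over all integers r: the subtracted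
    -- power belongs to the index -(r + 1).
    Θ : ℕ → ℕ → ℕ → Carrier
    Θ k h a = ∑ K λ r → σ r * (q ^ (k ℕ.* r ℕ.* r ℕ.+ h ℕ.* r) - q ^ (k ℕ.* r ℕ.* r ℕ.+ k ℕ.* r ℕ.+ a ℕ.* suc r))

    -- Adding the two neighbours multiplies the term r by 1 + q^r, precisely the factor in
    -- `∑wg-value`. The power q^(r (r + 1) / 2) obtained there joins r (r - 1) / 2 to form r², which
    -- raises κ to κ + 1.
    weighted-Z : 0 < K → ∀ κ h h′ → ∑ K (λ N → w N * (Z κ K (suc h) h′ N + Z κ K h (suc h′) N)) ≈ P * Θ (suc κ) h (suc h′)
    weighted-Z 0<K κ h h′ = begin
      ∑ K (λ N → w N * (Z κ K (suc h) h′ N + Z κ K h (suc h′) N))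
        ≈⟨ ∑-cong K (λ N → trans (*-congˡ (sym (∑-+ K _ _))) (∑-*ˡ K _ _)) ⟩
      ∑ K (λ N → ∑ K (λ r → w N * (pos κ (suc h) r * g N r + neg κ h′ r * g N (suc r) + (pos κ h r * g N r + neg κ (suc h′) r * g N (suc r)))))
        ≈⟨ ∑-swap K K _ ⟩
      ∑ K (λ r → ∑ K (λ N → w N * (pos κ (suc h) r * g N r + neg κ h′ r * g N (suc r) + (pos κ h r * g N r + neg κ (suc h′) r * g N (suc r)))))
        ≈⟨ ∑-cong K (λ r → trans (∑-cong K (regroup r)) (trans (∑-+ K _ _) (+-cong (sym (∑-*ˡ K _ _)) (sym (∑-*ˡ K _ _))))) ⟩
      ∑ K (λ r → pos κ h r * (1# + q ^ r) * ∑ K (λ N → w N * g N r) + neg κ h′ r * (1# + q ^ suc r) * ∑ K (λ N → w N * g N (suc r)))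
        ≈⟨ ∑-cong K term ⟩
      ∑ K (λ r → P * (σ r * (q ^ (suc κ ℕ.* r ℕ.* r ℕ.+ h ℕ.* r) - q ^ (suc κ ℕ.* r ℕ.* r ℕ.+ suc κ ℕ.* r ℕ.+ suc h′ ℕ.* suc r))))
        ≈⟨ ∑-*ˡ K _ _ ⟨
      P * Θ (suc κ) h (suc h′) ∎
      where
      regroup : ∀ r N → w N * (pos κ (suc h) r * g N r + neg κ h′ r * g N (suc r) + (pos κ h r * g N r + neg κ (suc h′) r * g N (suc r)))
                ≈ pos κ h r * (1# + q ^ r) * (w N * g N r) + neg κ h′ r * (1# + q ^ suc r) * (w N * g N (suc r))
      regroup r N = trans (*-congˡ (+-cong (+-congʳ (*-congʳ (pos-suc κ h r))) (+-congˡ (*-congʳ (neg-suc κ h′ r)))))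
        (solve 7 (λ w a Q b Q′ i j → w :* (a :* Q :* i :+ b :* j :+ (a :* i :+ b :* Q′ :* j)) := a :* (:1 :+ Q) :* (w :* i) :+ b :* (:1 :+ Q′) :* (w :* j)) refl _ _ _ _ _ _ _)
      exponent₁ : ∀ κ r h t s → t ℕ.+ t ℕ.+ r ≡ s → κ ℕ.* r ℕ.* r ℕ.+ t ℕ.+ h ℕ.* r ℕ.+ (t ℕ.+ r) ≡ s ℕ.+ κ ℕ.* r ℕ.* r ℕ.+ h ℕ.* r
      exponent₁ κ r h t s ≡.refl = rearrange κ r h t
        where
        rearrange : ∀ κ r h t → κ ℕ.* r ℕ.* r ℕ.+ t ℕ.+ h ℕ.* r ℕ.+ (t ℕ.+ r) ≡ t ℕ.+ t ℕ.+ r ℕ.+ κ ℕ.* r ℕ.* r ℕ.+ h ℕ.* r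
        rearrange = solve-∀
      expand₁ : ∀ κ r h → r ℕ.* r ℕ.+ κ ℕ.* r ℕ.* r ℕ.+ h ℕ.* r ≡ suc κ ℕ.* r ℕ.* r ℕ.+ h ℕ.* r
      expand₁ = solve-∀
      exponent₂ : ∀ κ r h t s → t ℕ.+ t ℕ.+ r ≡ s → κ ℕ.* r ℕ.* r ℕ.+ t ℕ.+ r ℕ.+ κ ℕ.* r ℕ.+ h ℕ.* suc r ℕ.+ (t ℕ.+ r ℕ.+ suc r) ≡ s ℕ.+ κ ℕ.* r ℕ.* r ℕ.+ suc κ ℕ.* r ℕ.+ suc h ℕ.* suc r
      exponent₂ κ r h t s ≡.refl = rearrange κ r h t
        where
        rearrange : ∀ κ r h t → κ ℕ.* r ℕ.* r ℕ.+ t ℕ.+ r ℕ.+ κ ℕ.* r ℕ.+ h ℕ.* suc r ℕ.+ (t ℕ.+ r ℕ.+ suc r) ≡ t ℕ.+ t ℕ.+ r ℕ.+ κ ℕ.* r ℕ.* r ℕ.+ suc κ ℕ.* r ℕ.+ suc h ℕ.* suc r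
        rearrange = solve-∀
      expand₂ : ∀ κ r h → r ℕ.* r ℕ.+ κ ℕ.* r ℕ.* r ℕ.+ suc κ ℕ.* r ℕ.+ suc h ℕ.* suc r ≡ suc κ ℕ.* r ℕ.* r ℕ.+ suc κ ℕ.* r ℕ.+ suc h ℕ.* suc r
      expand₂ = solve-∀
      pos-weight : ∀ r → pos κ h r * q ^ triangle (suc r) ≈ σ r * q ^ (suc κ ℕ.* r ℕ.* r ℕ.+ h ℕ.* r)
      pos-weight r = trans (*-assoc _ _ _) (*-congˡ (sym (^-split q (κ ℕ.* r ℕ.* r ℕ.+ triangle r ℕ.+ h ℕ.* r) (triangle (suc r)) (≡.sym (≡.trans (exponent₁ κ r h (triangle r) _ (triangle-square r)) (expand₁ κ r h))))))
      neg-weight : ∀ r → neg κ h′ r * q ^ triangle (suc (suc r)) ≈ - σ r * q ^ (suc κ ℕ.* r ℕ.* r ℕ.+ suc κ ℕ.* r ℕ.+ suc h′ ℕ.* suc r)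
      neg-weight r = trans (*-assoc _ _ _) (*-congˡ (sym (^-split q (κ ℕ.* r ℕ.* r ℕ.+ triangle r ℕ.+ r ℕ.+ κ ℕ.* r ℕ.+ h′ ℕ.* suc r) (triangle (suc (suc r))) (≡.sym (≡.trans (exponent₂ κ r h′ (triangle r) _ (triangle-square r)) (expand₂ κ r h′))))))
      term : ∀ r → pos κ h r * (1# + q ^ r) * ∑ K (λ N → w N * g N r) + neg κ h′ r * (1# + q ^ suc r) * ∑ K (λ N → w N * g N (suc r))
             ≈ P * (σ r * (q ^ (suc κ ℕ.* r ℕ.* r ℕ.+ h ℕ.* r) - q ^ (suc κ ℕ.* r ℕ.* r ℕ.+ suc κ ℕ.* r ℕ.+ suc h′ ℕ.* suc r)))
      term r = begin
        pos κ h r * (1# + q ^ r) * ∑ K (λ N → w N * g N r) + neg κ h′ r * (1# + q ^ suc r) * ∑ K (λ N → w N * g N (suc r))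
          ≈⟨ +-cong (trans (*-assoc _ _ _) (*-congˡ (∑wg-value 0<K r))) (trans (*-assoc _ _ _) (*-congˡ (∑wg-value 0<K (suc r)))) ⟩
        pos κ h r * (P * q ^ triangle (suc r)) + neg κ h′ r * (P * q ^ triangle (suc (suc r)))
          ≈⟨ solve 5 (λ a P x b y → a :* (P :* x) :+ b :* (P :* y) := P :* (a :* x :+ b :* y)) refl _ _ _ _ _ ⟩
        P * (pos κ h r * q ^ triangle (suc r) + neg κ h′ r * q ^ triangle (suc (suc r)))
          ≈⟨ *-congˡ (+-cong (pos-weight r) (neg-weight r)) ⟩
        P * (σ r * q ^ (suc κ ℕ.* r ℕ.* r ℕ.+ h ℕ.* r) + - σ r * q ^ (suc κ ℕ.* r ℕ.* r ℕ.+ suc κ ℕ.* r ℕ.+ suc h′ ℕ.* suc r))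
          ≈⟨ solve 4 (λ P s x y → P :* (s :* x :+ (:- s) :* y) := P :* (s :* (x :- y))) refl _ _ _ _ ⟩
        P * (σ r * (q ^ (suc κ ℕ.* r ℕ.* r ℕ.+ h ℕ.* r) - q ^ (suc κ ℕ.* r ℕ.* r ℕ.+ suc κ ℕ.* r ℕ.+ suc h′ ℕ.* suc r))) ∎

-- Jacobi's triple product as the limit of its finite form.

module JacobiTripleProduct (R : CommutativeRing 0ℓ 0ℓ) (L : ℕ) (p : CommutativeRing.Carrier R)
                           (p^L≈0 : CommutativeRing._≈_ R (Powers._^_ R p L) (CommutativeRing.0# R)) where
  open CommutativeRing R hiding (zero)
  open SetoidReasoning setoid
  open IntegerCoefficients R
  open Sums R
  open Powers R
  open Pochhammer R L p p^L≈0
  open AlternatingSum R L p p^L≈0 using (g)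

  -- ϑ z r = (-z)ʳ p^(r (r - 1) / 2)
  ϑ : Carrier → ℕ → Carrier
  ϑ z zero    = 1#
  ϑ z (suc r) = - (z * p ^ r) * ϑ z r

  ϑ-closed : ∀ z r → ϑ z r ≈ σ r * (z ^ r * p ^ triangle r)
  ϑ-closed z zero    = solve 0 (:1 := :1 :* (:1 :* :1)) refl
  ϑ-closed z (suc r) = begin
    - (z * p ^ r) * ϑ z r ≈⟨ *-congˡ (ϑ-closed z r) ⟩
    - (z * p ^ r) * (σ r * (z ^ r * p ^ triangle r)) ≈⟨ solve 5 (λ z P s Z T → :- (z :* P) :* (s :* (Z :* T)) := :- s :* (z :* Z :* (T :* P))) refl _ _ _ _ _ ⟩
    - σ r * (z ^ suc r * (p ^ triangle r * p ^ r)) ≈⟨ *-congˡ (*-congˡ (sym (^-homo-* p (triangle r) r))) ⟩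
    - σ r * (z ^ suc r * p ^ triangle (suc r)) ∎

  ⟨_⟩ : Carrier → ℕ → Carrier
  ⟨ z ⟩ zero    = 1#
  ⟨ z ⟩ (suc n) = ⟨ z ⟩ n * (1# - z * p ^ n)

  module _ (z z′ : Carrier) (zz′≈p : z * z′ ≈ p) (K : ℕ) where

    -- Bilateral forms of (z)ₙ (z′)ₙ / (p)₂ₙ and (z)ₙ (z′)ₙ₊₁ / (p)₂ₙ₊₁. Interleaving the two
    -- families makes each step add a single factor, first one with z′ and then one with z.
    S S′ : ℕ → Carrier
    S n = ∑ K λ r → ϑ z r * g n r + ϑ z′ (suc r) * g n (suc r)
    S′ n = ∑ K λ r → ϑ z r * (ι n r * 1/⟨p⟩ (suc (n ℕ.+ r))) + ϑ z′ (suc r) * (ι n r * 1/⟨p⟩ (suc (n ℕ.+ r)))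

    private
      module _ (n : ℕ) where
        u : ℕ → Carrier
        u r = ι n r * 1/⟨p⟩ (suc (n ℕ.+ r))

        u-vanish : ∀ x → n < K → x * u K ≈ 0#
        u-vanish x n<K = trans (*-congˡ (trans (*-congʳ (ι-zero n<K)) (zeroˡ _))) (zeroʳ x)

        g-vanish : ∀ x → n < K → x * g n K ≈ 0#
        g-vanish x n<K = trans (*-congˡ (trans (*-congʳ (ι-zero n<K)) (zeroˡ _))) (zeroʳ x)

        c-step : ∀ r → (1# - p * (p ^ n * p ^ r)) * 1/⟨p⟩ (suc (n ℕ.+ r)) ≈ 1/⟨p⟩ (n ℕ.+ r)
        c-step r = trans (*-congʳ (+-congˡ (-‿cong (*-congˡ (sym (^-homo-* p n r)))))) (1/⟨p⟩-step (n ℕ.+ r))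

        c-step₂ : ∀ r → (1# - p * p * (p ^ n * p ^ r)) * 1/⟨p⟩ (suc (suc (n ℕ.+ r))) ≈ 1/⟨p⟩ (suc (n ℕ.+ r))
        c-step₂ r = trans (*-congʳ (+-congˡ (-‿cong (trans (*-assoc _ _ _) (*-congˡ (*-congˡ (sym (^-homo-* p n r)))))))) (1/⟨p⟩-step (suc (n ℕ.+ r)))

    -- Up to a power of p, 1 - p^(2n+1) is a combination of 1 - p^(n+r+1) and 1 - p^(n-r), each of
    -- which cancels a factor of one Pochhammer symbol. One half of the result is `S n`; the other
    -- is -z′ pⁿ times its image under r ↦ -r, which is `S n` again by `reindex`.
    even-step : ∀ n → n < K → (1# - p ^ suc n * p ^ n) * S′ n ≈ (1# - z′ * p ^ n) * S n
    even-step n n<K = begin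
      (1# - p * B * B) * S′ n ≈⟨ ∑-*ˡ K _ _ ⟩
      ∑ K _ ≈⟨ ∑-cong K term ⟩
      ∑ K (λ r → (a r * g n r + b (suc r) * g n (suc r)) - z′ * B * (a (suc r) * g n (suc r) + b r * g n r))
                                                                ≈⟨ trans (∑-- K _ _) (+-congˡ (-‿cong (sym (∑-*ˡ K _ _)))) ⟩
      S n - z′ * B * ∑ K (λ r → a (suc r) * g n (suc r) + b r * g n r)
                                                                ≈⟨ +-congˡ (-‿cong (*-congˡ reindex)) ⟩
      S n - z′ * B * S n ≈⟨ solve 2 (λ x y → x :- y :* x := (:1 :- y) :* x) refl _ _ ⟩
      (1# - z′ * B) * S n ∎
      where
      B = p ^ n
      a = ϑ z
      b = ϑ z′
      reindex : ∑ K (λ r → a (suc r) * g n (suc r) + b r * g n r) ≈ S n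
      reindex = begin
        ∑ K (λ r → a (suc r) * g n (suc r) + b r * g n r) ≈⟨ ∑-+ K _ _ ⟩
        ∑ K (λ r → a (suc r) * g n (suc r)) + ∑ K (λ r → b r * g n r) ≈⟨ +-congˡ (∑-shift K _ (g-vanish n _ n<K)) ⟩
        ∑ K (λ r → a (suc r) * g n (suc r)) + (1# * g n 0 + ∑ K (λ r → b (suc r) * g n (suc r))) ≈⟨ solve 3 (λ x y z → x :+ (y :+ z) := (y :+ x) :+ z) refl _ _ _ ⟩
        (1# * g n 0 + ∑ K (λ r → a (suc r) * g n (suc r))) + ∑ K (λ r → b (suc r) * g n (suc r)) ≈⟨ +-congʳ (∑-shift K _ (g-vanish n _ n<K)) ⟨
        ∑ K (λ r → a r * g n r) + ∑ K (λ r → b (suc r) * g n (suc r)) ≈⟨ ∑-+ K _ _ ⟨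
        S n ∎
      term : ∀ r → (1# - p * B * B) * (a r * u n r + b (suc r) * u n r)
             ≈ (a r * g n r + b (suc r) * g n (suc r)) - z′ * B * (a (suc r) * g n (suc r) + b r * g n r)
      term r rewrite ℕ.+-suc n r = begin
        (1# - p * B * B) * (x * (i * c′) + - (z′ * Q) * y * (i * c′))
          ≈⟨ solve 8 (λ p z′ x y i c′ B Q →
               (:1 :- p :* B :* B) :* (x :* (i :* c′) :+ :- (z′ :* Q) :* y :* (i :* c′))
               := x :* c′ :* (i :* (:1 :- p :* (B :* Q)) :+ p :* B :* (Q :* i :- B :* i)) :- z′ :* y :* c′ :* ((Q :* i :- B :* i) :+ B :* i :* (:1 :- p :* (B :* Q))))
               refl p z′ x y i c′ B Q ⟩
        x * c′ * (i * (1# - p * (B * Q)) + p * B * (Q * i - B * i)) - z′ * y * c′ * ((Q * i - B * i) + B * i * (1# - p * (B * Q)))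
          ≈⟨ +-cong (*-congˡ (+-congˡ (*-cong (*-congʳ (sym zz′≈p)) law))) (-‿cong (*-congˡ (+-congʳ law))) ⟩
        x * c′ * (i * (1# - p * (B * Q)) + z * z′ * B * (Q * j)) - z′ * y * c′ * (Q * j + B * i * (1# - p * (B * Q)))
          ≈⟨ solve 10 (λ p z z′ x y i j c′ B Q →
               x :* c′ :* (i :* (:1 :- p :* (B :* Q)) :+ z :* z′ :* B :* (Q :* j)) :- z′ :* y :* c′ :* (Q :* j :+ B :* i :* (:1 :- p :* (B :* Q)))
               := (x :* (i :* ((:1 :- p :* (B :* Q)) :* c′)) :+ :- (z′ :* Q) :* y :* (j :* c′)) :- z′ :* B :* (:- (z :* Q) :* x :* (j :* c′) :+ y :* (i :* ((:1 :- p :* (B :* Q)) :* c′))))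
               refl p z z′ x y i j c′ B Q ⟩
        (x * (i * ((1# - p * (B * Q)) * c′)) + - (z′ * Q) * y * (j * c′)) - z′ * B * (- (z * Q) * x * (j * c′) + y * (i * ((1# - p * (B * Q)) * c′)))
          ≈⟨ +-cong (+-congʳ (*-congˡ (*-congˡ (c-step n r)))) (-‿cong (*-congˡ (+-congˡ (*-congˡ (*-congˡ (c-step n r)))))) ⟩
        (x * (i * c) + - (z′ * Q) * y * (j * c′)) - z′ * B * (- (z * Q) * x * (j * c′) + y * (i * c)) ∎
        where
        x = a r
        y = b r
        i = ι n r
        j = ι n (suc r)
        c = 1/⟨p⟩ (n ℕ.+ r)
        c′ = 1/⟨p⟩ (suc (n ℕ.+ r))
        Q = p ^ r
        law : Q * i - B * i ≈ Q * j
        law = trans (+-congˡ (-‿cong (ι-law n r))) (solve 2 (λ x y → x :- (x :- y) := y) refl _ _)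

    -- The splitting is that of `even-step`, now for 1 - p^(2n+2). The term r = 0 has no mirror
    -- image -r and is treated on its own in `first`.
    odd-step : ∀ n → suc n < K → (1# - p ^ suc n * p ^ suc n) * S (suc n) ≈ (1# - z * p ^ n) * S′ n
    odd-step n n<K = begin
      (1# - A * A) * S (suc n)
        ≈⟨ *-congˡ (trans (∑-+ K _ _) (+-congʳ (∑-shift K _ (g-vanish (suc n) _ n<K)))) ⟩
      (1# - A * A) * (1# * g (suc n) 0 + ∑ K (λ r → a (suc r) * g (suc n) (suc r)) + ∑ K (λ r → b (suc r) * g (suc n) (suc r)))
        ≈⟨ solve 4 (λ A x y w → (:1 :- A :* A) :* (:1 :* x :+ y :+ w) := (:1 :- A :* A) :* x :+ ((:1 :- A :* A) :* y :+ (:1 :- A :* A) :* w)) refl _ _ _ _ ⟩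
      (1# - A * A) * g (suc n) 0 + ((1# - A * A) * ∑ K (λ r → a (suc r) * g (suc n) (suc r)) + (1# - A * A) * ∑ K (λ r → b (suc r) * g (suc n) (suc r)))
        ≈⟨ +-cong first (+-cong (trans (∑-*ˡ K _ _) (trans (∑-cong K pos-term) (trans (∑-- K _ _) (+-congˡ (-‿cong (sym (∑-*ˡ K _ _)))))))
                                (trans (∑-*ˡ K _ _) (trans (∑-cong K neg-term) (trans (∑-- K _ _) (+-congˡ (-‿cong (sym (∑-*ˡ K _ _)))))))) ⟩
      (1# * u n 0 - z * B * (b 1 * u n 0)) + ((∑ K (λ r → a (suc r) * u n (suc r)) - z * B * ∑ K (λ r → a r * u n r)) + (∑ K (λ r → b (suc r) * u n r) - z * B * ∑ K (λ r → b (suc (suc r)) * u n (suc r))))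
        ≈⟨ solve 7 (λ x m y X₁ X Y Y₁ → (x :- m :* y) :+ ((X₁ :- m :* X) :+ (Y :- m :* Y₁)) := (x :+ X₁ :+ Y) :- m :* (X :+ (y :+ Y₁))) refl _ _ _ _ _ _ _ ⟩
      (1# * u n 0 + ∑ K (λ r → a (suc r) * u n (suc r)) + ∑ K (λ r → b (suc r) * u n r)) - z * B * (∑ K (λ r → a r * u n r) + (b 1 * u n 0 + ∑ K (λ r → b (suc (suc r)) * u n (suc r))))
        ≈⟨ +-cong (+-congʳ (∑-shift K _ (u-vanish n _ (ℕ.<⇒≤ n<K)))) (-‿cong (*-congˡ (+-congˡ (∑-shift K _ (u-vanish n _ (ℕ.<⇒≤ n<K)))))) ⟨
      (∑ K (λ r → a r * u n r) + ∑ K (λ r → b (suc r) * u n r)) - z * B * (∑ K (λ r → a r * u n r) + ∑ K (λ r → b (suc r) * u n r))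
        ≈⟨ solve 2 (λ x y → x :- y :* x := (:1 :- y) :* x) refl _ _ ⟩
      (1# - z * B) * (∑ K (λ r → a r * u n r) + ∑ K (λ r → b (suc r) * u n r))
        ≈⟨ *-congˡ (∑-+ K _ _) ⟨
      (1# - z * B) * S′ n ∎
      where
      A = p ^ suc n
      B = p ^ n
      a = ϑ z
      b = ϑ z′
      first : (1# - A * A) * g (suc n) 0 ≈ 1# * u n 0 - z * B * (b 1 * u n 0)
      first rewrite ℕ.+-identityʳ n = begin
        (1# - A * A) * (c′ * c′) ≈⟨ solve 2 (λ A c → (:1 :- A :* A) :* (c :* c) := :1 :* ((:1 :- A) :* c :* c) :+ A :* ((:1 :- A) :* c :* c)) refl A c′ ⟩
        1# * ((1# - A) * c′ * c′) + A * ((1# - A) * c′ * c′)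
                                              ≈⟨ +-cong (*-congˡ (*-congʳ (1/⟨p⟩-step n))) (*-cong (*-congʳ (sym zz′≈p)) (*-congʳ (1/⟨p⟩-step n))) ⟩
        1# * (c * c′) + z * z′ * B * (c * c′) ≈⟨ solve 4 (λ z z′ B x → :1 :* x :+ z :* z′ :* B :* x := :1 :* x :- z :* B :* (:- (z′ :* :1) :* :1 :* x)) refl z z′ B _ ⟩
        1# * (c * c′) - z * B * (- (z′ * 1#) * 1# * (c * c′)) ∎
        where
        c = 1/⟨p⟩ n
        c′ = 1/⟨p⟩ (suc n)
      module _ (r : ℕ) where
        i = ι n r
        j = ι n (suc r)
        c′ = 1/⟨p⟩ (suc (n ℕ.+ r))
        c″ = 1/⟨p⟩ (suc (suc (n ℕ.+ r)))
        Q = p ^ r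
        law : Q * i - B * i ≈ Q * j
        law = trans (+-congˡ (-‿cong (ι-law n r))) (solve 2 (λ x y → x :- (x :- y) := y) refl _ _)
      pos-term : ∀ r → (1# - A * A) * (a (suc r) * g (suc n) (suc r)) ≈ a (suc r) * u n (suc r) - z * B * (a r * u n r)
      pos-term r rewrite ℕ.+-suc n r = begin
        (1# - p * B * (p * B)) * (- (z * Q r) * a r * (i r * c″ r))
          ≈⟨ solve 7 (λ p z B Q x i c → (:1 :- p :* B :* (p :* B)) :* (:- (z :* Q) :* x :* (i :* c))
               := :- z :* x :* c :* (Q :* i :- B :* i) :- z :* B :* (x :* (i :* ((:1 :- p :* p :* (B :* Q)) :* c)))) refl p z B (Q r) (a r) (i r) (c″ r) ⟩
        - z * a r * c″ r * (Q r * i r - B * i r) - z * B * (a r * (i r * ((1# - p * p * (B * Q r)) * c″ r)))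
          ≈⟨ +-cong (*-congˡ (law r)) (-‿cong (*-congˡ (*-congˡ (*-congˡ (c-step₂ n r))))) ⟩
        - z * a r * c″ r * (Q r * j r) - z * B * (a r * (i r * c′ r))
          ≈⟨ +-congʳ (solve 5 (λ z x c Q j → :- z :* x :* c :* (Q :* j) := :- (z :* Q) :* x :* (j :* c)) refl _ _ _ _ _) ⟩
        - (z * Q r) * a r * (j r * c″ r) - z * B * (a r * (i r * c′ r)) ∎
      neg-term : ∀ r → (1# - A * A) * (b (suc r) * g (suc n) (suc r)) ≈ b (suc r) * u n r - z * B * (b (suc (suc r)) * u n (suc r))
      neg-term r rewrite ℕ.+-suc n r = begin
        (1# - p * B * (p * B)) * (y * (i r * c″ r))
          ≈⟨ solve 6 (λ p B Q y i c → (:1 :- p :* B :* (p :* B)) :* (y :* (i :* c))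
               := y :* (i :* ((:1 :- p :* p :* (B :* Q)) :* c)) :+ p :* B :* p :* y :* c :* (Q :* i :- B :* i)) refl p B (Q r) y (i r) (c″ r) ⟩
        y * (i r * ((1# - p * p * (B * Q r)) * c″ r)) + p * B * p * y * c″ r * (Q r * i r - B * i r)
          ≈⟨ +-cong (*-congˡ (*-congˡ (c-step₂ n r))) (*-cong (*-congʳ (*-congʳ (*-congʳ (*-congʳ (sym zz′≈p))))) (law r)) ⟩
        y * (i r * c′ r) + z * z′ * B * p * y * c″ r * (Q r * j r)
          ≈⟨ +-congˡ (solve 8 (λ p z z′ B Q y j c → z :* z′ :* B :* p :* y :* c :* (Q :* j) := :- (z :* B :* (:- (z′ :* (p :* Q)) :* y :* (j :* c)))) refl _ _ _ _ _ _ _ _) ⟩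
        y * (i r * c′ r) - z * B * (- (z′ * (p * Q r)) * y * (j r * c″ r)) ∎
        where
        y = b (suc r)

    finite-triple-product : 0 < K → ∀ n → n < K → S n * ⟨p⟩ (n ℕ.+ n) ≈ ⟨ z ⟩ n * ⟨ z′ ⟩ n
    finite-triple-product (s≤s {n = K′} _) zero _ = begin
      S 0 * 1# ≈⟨ *-identityʳ _ ⟩
      S 0 ≈⟨ ∑-head K′ _ ⟩
      1# * (1# * 1#) + ϑ z′ 1 * (0# * 1/⟨p⟩ 1) + ∑ K′ _ ≈⟨ +-congˡ (∑-zero K′ λ r → solve 4 (λ a b c d → a :* (:0 :* b) :+ c :* (:0 :* d) := :0) refl _ _ _ _) ⟩
      1# * (1# * 1#) + ϑ z′ 1 * (0# * 1/⟨p⟩ 1) + 0# ≈⟨ solve 2 (λ x y → :1 :* (:1 :* :1) :+ x :* (:0 :* y) :+ :0 := :1 :* :1) refl _ _ ⟩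
      1# * 1# ∎
    finite-triple-product 0<K (suc n) n<K = begin
      S (suc n) * ⟨p⟩ (suc n ℕ.+ suc n) ≈⟨ *-congˡ (trans (reflexive (≡.cong (λ i → ⟨p⟩ (suc i)) (ℕ.+-suc n n))) (*-cong (*-congˡ (+-congˡ (-‿cong (^-homo-* p (suc n) n)))) (+-congˡ (-‿cong (trans (reflexive (≡.cong (p ^_) (≡.sym (ℕ.+-suc (suc n) n)))) (^-homo-* p (suc n) (suc n))))))) ⟩
      S (suc n) * (⟨p⟩ (n ℕ.+ n) * (1# - p ^ suc n * p ^ n) * (1# - p ^ suc n * p ^ suc n)) ≈⟨ solve 4 (λ s x y w → s :* (x :* y :* w) := w :* s :* x :* y) refl _ _ _ _ ⟩
      (1# - p ^ suc n * p ^ suc n) * S (suc n) * ⟨p⟩ (n ℕ.+ n) * (1# - p ^ suc n * p ^ n) ≈⟨ *-congʳ (*-congʳ (odd-step n n<K)) ⟩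
      (1# - z * p ^ n) * S′ n * ⟨p⟩ (n ℕ.+ n) * (1# - p ^ suc n * p ^ n) ≈⟨ solve 4 (λ s x y w → s :* x :* y :* w := s :* y :* (w :* x)) refl _ _ _ _ ⟩
      (1# - z * p ^ n) * ⟨p⟩ (n ℕ.+ n) * ((1# - p ^ suc n * p ^ n) * S′ n) ≈⟨ *-congˡ (even-step n (ℕ.<⇒≤ n<K)) ⟩
      (1# - z * p ^ n) * ⟨p⟩ (n ℕ.+ n) * ((1# - z′ * p ^ n) * S n) ≈⟨ solve 4 (λ s x y w → s :* x :* (y :* w) := w :* x :* (s :* y)) refl _ _ _ _ ⟩
      S n * ⟨p⟩ (n ℕ.+ n) * ((1# - z * p ^ n) * (1# - z′ * p ^ n)) ≈⟨ *-congʳ (finite-triple-product 0<K n (ℕ.<⇒≤ n<K)) ⟩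
      ⟨ z ⟩ n * ⟨ z′ ⟩ n * ((1# - z * p ^ n) * (1# - z′ * p ^ n)) ≈⟨ solve 4 (λ s x y w → s :* x :* (y :* w) := s :* y :* (x :* w)) refl _ _ _ _ ⟩
      ⟨ z ⟩ (suc n) * ⟨ z′ ⟩ (suc n) ∎

    module _ (z^L≈0 : z ^ L ≈ 0#) (z′^L≈0 : z′ ^ L ≈ 0#) where

      ϑ-vanish : ∀ {y r} → y ^ L ≈ 0# → L ≤ r → ϑ y r ≈ 0#
      ϑ-vanish {y} {r} y^L≈0 L≤r = trans (ϑ-closed y r) (trans (*-congˡ (trans (*-congʳ (nilpotent-above {y} y^L≈0 L≤r)) (zeroˡ _))) (zeroʳ _))

      -- For r ≤ L and n ≥ 2 L both n - r and n + r are at least `L`, so all Pochhammer symbols are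
      -- stable and cancel; for r ≥ L the term itself vanishes because y^L = 0. This is the source
      -- of the bound 2 L.
      ϑg-limit : ∀ {y n} → y ^ L ≈ 0# → L ℕ.+ L ≤ n → ∀ r → ϑ y r * g n r * (⟨p⟩ (n ℕ.+ n) * ⟨p⟩ n) ≈ ϑ y r
      ϑg-limit {y} {n} y^L≈0 2L≤n r with ℕ.≤-total L r
      ... | inj₁ L≤r = trans (*-congʳ (*-congʳ (ϑ-vanish y^L≈0 L≤r))) (trans (solve 2 (λ a b → :0 :* a :* b := :0) refl _ _) (sym (ϑ-vanish y^L≈0 L≤r)))
      ... | inj₂ r≤L = begin
        ϑ y r * (ι n r * 1/⟨p⟩ (n ℕ.+ r)) * (⟨p⟩ (n ℕ.+ n) * ⟨p⟩ n) ≈⟨ *-cong (*-congˡ (*-cong ι-stable (1/⟨p⟩-stable (ℕ.≤-trans L≤n (ℕ.m≤m+n n r))))) (*-cong (⟨p⟩-stable (ℕ.≤-trans L≤n (ℕ.m≤m+n n n))) (⟨p⟩-stable L≤n)) ⟩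
        ϑ y r * (1/⟨p⟩ L * 1/⟨p⟩ L) * (⟨p⟩ L * ⟨p⟩ L) ≈⟨ solve 3 (λ t c d → t :* (c :* c) :* (d :* d) := t :* ((d :* c) :* (d :* c))) refl _ _ _ ⟩
        ϑ y r * ((⟨p⟩ L * 1/⟨p⟩ L) * (⟨p⟩ L * 1/⟨p⟩ L)) ≈⟨ *-congˡ (*-cong (⟨p⟩-inverse L) (⟨p⟩-inverse L)) ⟩
        ϑ y r * (1# * 1#) ≈⟨ solve 1 (λ t → t :* (:1 :* :1) := t) refl _ ⟩
        ϑ y r ∎
        where
        L≤n : L ≤ n
        L≤n = ℕ.≤-trans (ℕ.m≤m+n L L) 2L≤n
        r≤n : r ≤ n
        r≤n = ℕ.≤-trans r≤L L≤n
        ι-stable : ι n r ≈ 1/⟨p⟩ L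
        ι-stable = trans (reflexive (≡.trans (≡.cong (λ m → ι m r) (≡.sym (ℕ.m+[n∸m]≡n r≤n))) (ι-+ r (n ℕ.∸ r))))
                         (1/⟨p⟩-stable (ℕ.≤-trans (ℕ.≤-reflexive (≡.sym (ℕ.m+n∸n≡m L L))) (ℕ.∸-mono 2L≤n r≤L)))

      triple-product : ∀ {n} → L ℕ.+ L ≤ n → n < K → ⟨ z ⟩ n * ⟨ z′ ⟩ n * ⟨p⟩ n ≈ ∑ K (λ r → ϑ z r + ϑ z′ (suc r))
      triple-product {n} 2L≤n n<K = begin
        ⟨ z ⟩ n * ⟨ z′ ⟩ n * ⟨p⟩ n ≈⟨ *-congʳ (finite-triple-product (ℕ.≤-<-trans z≤n n<K) n n<K) ⟨
        S n * ⟨p⟩ (n ℕ.+ n) * ⟨p⟩ n ≈⟨ *-assoc _ _ _ ⟩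
        S n * (⟨p⟩ (n ℕ.+ n) * ⟨p⟩ n) ≈⟨ ∑-*ʳ K _ _ ⟩
        ∑ K _ ≈⟨ ∑-cong K (λ r → trans (distribʳ _ _ _) (+-cong (ϑg-limit z^L≈0 2L≤n r) (ϑg-limit z′^L≈0 2L≤n (suc r)))) ⟩
        ∑ K (λ r → ϑ z r + ϑ z′ (suc r)) ∎

-- The recurrence of the overpartition series and its alternating solution.

module OverpartitionSeries (R : CommutativeRing 0ℓ 0ℓ) (L : ℕ) (q : CommutativeRing.Carrier R)
                           (q^L≈0 : CommutativeRing._≈_ R (Powers._^_ R q L) (CommutativeRing.0# R))
                           (½ : CommutativeRing.Carrier R)
                           (½+½≈1 : CommutativeRing._≈_ R (CommutativeRing._+_ R ½ ½) (CommutativeRing.1# R)) where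
  open CommutativeRing R hiding (zero)
  open SetoidReasoning setoid
  open IntegerCoefficients R
  open Sums R
  open Powers R
  open Inverses R L
  open Pochhammer R L q q^L≈0
  open WeightedSum R L q q^L≈0 ½ ½+½≈1

  -- Writing 1 / (1 + x) as (1 - x) / (1 - x²) reduces it to `geometric-power`.
  1/1+q^ : ℕ → Carrier
  1/1+q^ n = (1# - q ^ suc n) * geometric (q ^ suc (n ℕ.+ suc n))

  1/1+q^-inverse : ∀ n → (1# + q ^ suc n) * 1/1+q^ n ≈ 1#
  1/1+q^-inverse n = begin
    (1# + x) * ((1# - x) * y) ≈⟨ solve 2 (λ x y → (:1 :+ x) :* ((:1 :- x) :* y) := (:1 :- x :* x) :* y) refl x y ⟩
    (1# - x * x) * y ≈⟨ *-congʳ (+-congˡ (-‿cong (^-homo-* q (suc n) (suc n)))) ⟨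
    (1# - q ^ suc (n ℕ.+ suc n)) * y ≈⟨ geometric-power (n ℕ.+ suc n) ⟩
    1# ∎
    where
    x = q ^ suc n
    y = geometric (q ^ suc (n ℕ.+ suc n))

  1/⟨-q⟩ : ℕ → Carrier
  1/⟨-q⟩ zero    = 1#
  1/⟨-q⟩ (suc n) = 1/⟨-q⟩ n * 1/1+q^ n

  ⟨-q⟩-inverse : ∀ n → ⟨-q⟩ n * 1/⟨-q⟩ n ≈ 1#
  ⟨-q⟩-inverse zero    = *-identityˡ 1#
  ⟨-q⟩-inverse (suc n) = begin
    ⟨-q⟩ n * (1# + q ^ suc n) * (1/⟨-q⟩ n * 1/1+q^ n) ≈⟨ solve 4 (λ a b c d → a :* b :* (c :* d) := a :* c :* (b :* d)) refl _ _ _ _ ⟩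
    ⟨-q⟩ n * 1/⟨-q⟩ n * ((1# + q ^ suc n) * 1/1+q^ n) ≈⟨ *-cong (⟨-q⟩-inverse n) (1/1+q^-inverse n) ⟩
    1# * 1# ≈⟨ *-identityˡ 1# ⟩
    1# ∎

  1/⟨-q⟩-step : ∀ n → (1# + q ^ suc n) * 1/⟨-q⟩ (suc n) ≈ 1/⟨-q⟩ n
  1/⟨-q⟩-step n = begin
    (1# + q ^ suc n) * (1/⟨-q⟩ n * 1/1+q^ n) ≈⟨ solve 3 (λ a b c → a :* (b :* c) := b :* (a :* c)) refl _ _ _ ⟩
    1/⟨-q⟩ n * ((1# + q ^ suc n) * 1/1+q^ n) ≈⟨ *-congˡ (1/1+q^-inverse n) ⟩
    1/⟨-q⟩ n * 1# ≈⟨ *-identityʳ _ ⟩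
    1/⟨-q⟩ n ∎

  -- It equals 1 at m = 0, where `C` becomes the theta series, and 1 / P at r = 0 once m ≥ L, where
  -- `C` reduces to this one value. Raising m or r by one multiplies it by simple factors of the
  -- form 1 ± q^j and their inverses.
  ratio : ℕ → ℕ → Carrier
  ratio r m = ⟨-q⟩ r * 1/⟨p⟩ r * (⟨p⟩ (r ℕ.+ m) * 1/⟨-q⟩ (r ℕ.+ m))

  ratio-0 : ∀ r → ratio r 0 ≈ 1#
  ratio-0 r rewrite ℕ.+-identityʳ r = begin
    ⟨-q⟩ r * 1/⟨p⟩ r * (⟨p⟩ r * 1/⟨-q⟩ r) ≈⟨ solve 4 (λ a b c d → a :* b :* (c :* d) := a :* d :* (c :* b)) refl _ _ _ _ ⟩
    ⟨-q⟩ r * 1/⟨-q⟩ r * (⟨p⟩ r * 1/⟨p⟩ r) ≈⟨ *-cong (⟨-q⟩-inverse r) (⟨p⟩-inverse r) ⟩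
    1# * 1# ≈⟨ *-identityˡ 1# ⟩
    1# ∎

  ratio-m : ∀ r m → ratio r (suc m) * (1# + q ^ suc (r ℕ.+ m)) ≈ ratio r m * (1# - q ^ suc (r ℕ.+ m))
  ratio-m r m rewrite ℕ.+-suc r m = begin
    a * (⟨p⟩ n * (1# - x) * 1/⟨-q⟩ (suc n)) * (1# + x) ≈⟨ solve 5 (λ a b u c v → a :* (b :* u :* c) :* v := a :* (b :* (v :* c)) :* u) refl _ _ _ _ _ ⟩
    a * (⟨p⟩ n * ((1# + x) * 1/⟨-q⟩ (suc n))) * (1# - x) ≈⟨ *-congʳ (*-congˡ (*-congˡ (1/⟨-q⟩-step n))) ⟩
    a * (⟨p⟩ n * 1/⟨-q⟩ n) * (1# - x) ∎
    where
    n = r ℕ.+ m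
    x = q ^ suc n
    a = ⟨-q⟩ r * 1/⟨p⟩ r

  ratio-r : ∀ r m → ratio (suc r) m * (1# - q ^ suc r) ≈ ratio r (suc m) * (1# + q ^ suc r)
  ratio-r r m rewrite ℕ.+-suc r m = begin
    ⟨-q⟩ r * (1# + x) * 1/⟨p⟩ (suc r) * b * (1# - x) ≈⟨ solve 5 (λ a v c b u → a :* v :* c :* b :* u := a :* (u :* c) :* b :* v) refl _ _ _ _ _ ⟩
    ⟨-q⟩ r * ((1# - x) * 1/⟨p⟩ (suc r)) * b * (1# + x) ≈⟨ *-congʳ (*-congʳ (*-congˡ (1/⟨p⟩-step r))) ⟩
    ⟨-q⟩ r * 1/⟨p⟩ r * b * (1# + x) ∎
    where
    x = q ^ suc r
    b = ⟨p⟩ (suc (r ℕ.+ m)) * 1/⟨-q⟩ (suc (r ℕ.+ m))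

  module _ {K : ℕ} (L≤K : L ≤ K) (0<K : 0 < K) (κ : ℕ) where
    private
      k = suc κ

    base : ℕ → ℕ → ℕ
    base m r = k ℕ.* m ℕ.* r ℕ.+ k ℕ.* r ℕ.* r

    -- To be read with i + j = k: a deformation of the folded theta series in m. Multiplied by `P`
    -- it solves the recurrence of `b`, the index j taking the place of k - i.
    C : ℕ → ℕ → ℕ → Carrier
    C i j m = ∑ K λ r → σ r * ratio r m * (q ^ (base m r ℕ.+ j ℕ.* r) - q ^ (base m r ℕ.+ k ℕ.* r ℕ.+ i ℕ.* (m ℕ.+ suc r)))

    C-zero : ∀ m → C 0 k m ≈ 0#
    C-zero m = ∑-zero K λ r → trans (*-congˡ (+-congˡ (-‿cong (^-congʳ q (ℕ.+-identityʳ (base m r ℕ.+ k ℕ.* r)))))) (solve 2 (λ a b → a :* (b :- b) := :0) refl _ _)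

    C-at-0 : ∀ i j → C i j 0 ≈ Θ L≤K k j i
    C-at-0 i j = ∑-cong K λ r → *-cong (trans (*-congˡ (ratio-0 r)) (*-identityʳ _))
      (+-cong (^-congʳ q (exponent₁ κ r j)) (-‿cong (^-congʳ q (exponent₂ κ r i))))
      where
      exponent₁ : ∀ κ r j → suc κ ℕ.* 0 ℕ.* r ℕ.+ suc κ ℕ.* r ℕ.* r ℕ.+ j ℕ.* r ≡ suc κ ℕ.* r ℕ.* r ℕ.+ j ℕ.* r
      exponent₁ = solve-∀
      exponent₂ : ∀ κ r i → suc κ ℕ.* 0 ℕ.* r ℕ.+ suc κ ℕ.* r ℕ.* r ℕ.+ suc κ ℕ.* r ℕ.+ i ℕ.* (0 ℕ.+ suc r) ≡ suc κ ℕ.* r ℕ.* r ℕ.+ suc κ ℕ.* r ℕ.+ i ℕ.* suc r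
      exponent₂ = solve-∀

    -- All powers in the terms r ≥ 1, and the subtracted one at r = 0, have exponent at least `L`;
    -- what remains is the reciprocal of `P`. The subtracted exponent at r = 0 has the factor
    -- `suc i`; for index 0 the two powers cancel instead, as in `C-zero`.
    C-stable : ∀ {m} → L ≤ m → ∀ i j → P * C (suc i) j m ≈ 1#
    C-stable {m} L≤m i j = begin
      P * C (suc i) j m ≈⟨ *-congˡ (head 0<K) ⟩
      P * (1/⟨-q⟩ L * ⟨p⟩ L) ≈⟨ solve 4 (λ a b c d → a :* b :* (c :* d) := (a :* c) :* (d :* b)) refl _ _ _ _ ⟩
      (⟨-q⟩ L * 1/⟨-q⟩ L) * (⟨p⟩ L * 1/⟨p⟩ L) ≈⟨ *-cong (⟨-q⟩-inverse L) (⟨p⟩-inverse L) ⟩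
      1# * 1# ≈⟨ *-identityˡ 1# ⟩
      1# ∎
      where
      1/⟨-q⟩-stable : 1/⟨-q⟩ m ≈ 1/⟨-q⟩ L
      1/⟨-q⟩-stable = inverse-unique (trans (*-congʳ (sym (⟨-q⟩-stable L≤m))) (⟨-q⟩-inverse m)) (⟨-q⟩-inverse L)
      exponent : ∀ κ m j → suc κ ℕ.* m ℕ.* 0 ℕ.+ suc κ ℕ.* 0 ℕ.* 0 ℕ.+ j ℕ.* 0 ≡ 0
      exponent = solve-∀
      large : ∀ r → L ≤ base m (suc r)
      large r = ℕ.≤-trans L≤m (ℕ.≤-trans (ℕ.≤-trans (ℕ.m≤n*m m k) (ℕ.m≤m*n (k ℕ.* m) (suc r))) (ℕ.m≤m+n _ _))
      head : 0 < K → C (suc i) j m ≈ 1/⟨-q⟩ L * ⟨p⟩ L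
      head (s≤s {n = K′} _) = begin
        C (suc i) j m ≈⟨ ∑-head K′ _ ⟩
        1# * (1# * 1# * (⟨p⟩ m * 1/⟨-q⟩ m)) * (q ^ (base m 0 ℕ.+ j ℕ.* 0) - q ^ (base m 0 ℕ.+ k ℕ.* 0 ℕ.+ suc i ℕ.* (m ℕ.+ 1))) + ∑ K′ _
          ≈⟨ +-cong (*-cong (*-congˡ (*-congˡ (*-cong (⟨p⟩-stable L≤m) 1/⟨-q⟩-stable)))
                            (+-cong (^-congʳ q (exponent κ m j)) (-‿cong (p^≈0 (ℕ.≤-trans L≤m (ℕ.≤-trans (ℕ.m≤m+n m 1) (ℕ.≤-trans (ℕ.m≤m+n _ (i ℕ.* (m ℕ.+ 1))) (ℕ.m≤n+m _ (base m 0 ℕ.+ k ℕ.* 0)))))))))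
                    (∑-zero K′ λ r → trans (*-congˡ (+-cong (p^≈0 (ℕ.≤-trans (large r) (ℕ.m≤m+n _ _))) (-‿cong (p^≈0 (ℕ.≤-trans (large r) (ℕ.≤-trans (ℕ.m≤m+n _ _) (ℕ.m≤m+n _ _)))))))
                                           (solve 1 (λ a → a :* (:0 :- :0) := :0) refl _)) ⟩
        1# * (1# * 1# * (⟨p⟩ L * 1/⟨-q⟩ L)) * (1# - 0#) + 0# ≈⟨ solve 2 (λ a b → :1 :* (:1 :* :1 :* (a :* b)) :* (:1 :- :0) :+ :0 := b :* a) refl _ _ ⟩
        1/⟨-q⟩ L * ⟨p⟩ L ∎

    -- The difference of the two `C` at m is the sum of all f r + h r, and by `ratio-r` and
    -- `ratio-m` the terms at m + 1 give f (r + 1) + h r. Shifting `f` by one costs nothing: `f 0`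
    -- contains 1 - q^0, and `f K` contains a vanishing power of q.
    C-step : ∀ i j m → i ℕ.+ suc j ≡ k → C (suc i) j m ≈ C i (suc j) m + q ^ (suc m ℕ.* i) * (C (suc j) i (suc m) + q ^ suc m * C j (suc i) (suc m))
    C-step i j m i+j≡k = begin
      C (suc i) j m ≈⟨ solve 2 (λ x y → x := y :+ (x :- y)) refl _ _ ⟩
      C i (suc j) m + (C (suc i) j m - C i (suc j) m) ≈⟨ +-congˡ difference ⟩
      C i (suc j) m + q ^ (suc m ℕ.* i) * (C (suc j) i (suc m) + q ^ suc m * C j (suc i) (suc m)) ∎
      where
      f h : ℕ → Carrier
      f r = σ r * (ratio r m * (1# - q ^ r)) * q ^ (base m r ℕ.+ j ℕ.* r)
      h r = σ r * (ratio r m * (1# - q ^ suc (r ℕ.+ m))) * q ^ (base m r ℕ.+ k ℕ.* r ℕ.+ i ℕ.* suc (r ℕ.+ m))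
      left-term : ∀ r → σ r * ratio r m * (q ^ (base m r ℕ.+ j ℕ.* r) - q ^ (base m r ℕ.+ k ℕ.* r ℕ.+ suc i ℕ.* (m ℕ.+ suc r)))
                        - σ r * ratio r m * (q ^ (base m r ℕ.+ suc j ℕ.* r) - q ^ (base m r ℕ.+ k ℕ.* r ℕ.+ i ℕ.* (m ℕ.+ suc r))) ≈ f r + h r
      left-term r = trans
        (+-cong (*-congˡ (+-congˡ (-‿cong (^-split q (base m r ℕ.+ k ℕ.* r ℕ.+ i ℕ.* suc (r ℕ.+ m)) (suc (r ℕ.+ m)) (e₁ (base m r ℕ.+ k ℕ.* r) i m r)))))
                (-‿cong (*-congˡ (+-cong (^-split q (base m r ℕ.+ j ℕ.* r) r (e₂ (base m r) j r)) (-‿cong (^-congʳ q (e₃ (base m r ℕ.+ k ℕ.* r) i m r)))))))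
        (solve 6 (λ s ρ x y Q M → s :* ρ :* (x :- y :* M) :- s :* ρ :* (x :* Q :- y) := s :* (ρ :* (:1 :- Q)) :* x :+ s :* (ρ :* (:1 :- M)) :* y) refl _ _ _ _ _ _)
        where
        e₁ : ∀ e i m r → e ℕ.+ suc i ℕ.* (m ℕ.+ suc r) ≡ e ℕ.+ i ℕ.* suc (r ℕ.+ m) ℕ.+ suc (r ℕ.+ m)
        e₁ = solve-∀
        e₂ : ∀ e j r → e ℕ.+ suc j ℕ.* r ≡ e ℕ.+ j ℕ.* r ℕ.+ r
        e₂ = solve-∀
        e₃ : ∀ e i m r → e ℕ.+ i ℕ.* (m ℕ.+ suc r) ≡ e ℕ.+ i ℕ.* suc (r ℕ.+ m)
        e₃ = solve-∀
      A = q ^ (suc m ℕ.* i)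
      B = q ^ suc m
      right-term : ∀ r → A * (σ r * ratio r (suc m) * (q ^ (base (suc m) r ℕ.+ i ℕ.* r) - q ^ (base (suc m) r ℕ.+ k ℕ.* r ℕ.+ suc j ℕ.* (suc m ℕ.+ suc r)))
                              + B * (σ r * ratio r (suc m) * (q ^ (base (suc m) r ℕ.+ suc i ℕ.* r) - q ^ (base (suc m) r ℕ.+ k ℕ.* r ℕ.+ j ℕ.* (suc m ℕ.+ suc r)))))
                         ≈ f (suc r) + h r
      right-term r = begin
        A * (s * ρ⁺ * (x₁ - y₁) + B * (s * ρ⁺ * (x₂ - y₂)))
          ≈⟨ solve 8 (λ A B s ρ x₁ y₁ x₂ y₂ → A :* (s :* ρ :* (x₁ :- y₁) :+ B :* (s :* ρ :* (x₂ :- y₂)))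
               := :- s :* ρ :* (A :* y₁ :+ A :* (B :* y₂)) :+ s :* ρ :* (A :* x₁ :+ A :* (B :* x₂))) refl A B s ρ⁺ x₁ y₁ x₂ y₂ ⟩
        - s * ρ⁺ * (A * y₁ + A * (B * y₂)) + s * ρ⁺ * (A * x₁ + A * (B * x₂))
          ≈⟨ +-cong (*-congˡ (+-cong (join₂ (suc m ℕ.* i) y₁ᵉ Yᵉ (suc r) (e₁ i j m r k i+j≡k)) (join₃ (suc m ℕ.* i) (suc m) y₂ᵉ Yᵉ 0 (e₂ i j m r k i+j≡k))))
                    (*-congˡ (+-cong (join₂ (suc m ℕ.* i) x₁ᵉ Xᵉ 0 (e₃ i m r κ)) (join₃ (suc m ℕ.* i) (suc m) x₂ᵉ Xᵉ (suc (r ℕ.+ m)) (e₄ i m r κ)))) ⟩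
        - s * ρ⁺ * (Y * q ^ suc r + Y * 1#) + s * ρ⁺ * (X * 1# + X * q ^ suc (r ℕ.+ m))
          ≈⟨ solve 6 (λ s ρ Y Q X M → :- s :* ρ :* (Y :* Q :+ Y :* :1) :+ s :* ρ :* (X :* :1 :+ X :* M) := :- s :* (ρ :* (:1 :+ Q)) :* Y :+ s :* (ρ :* (:1 :+ M)) :* X) refl s ρ⁺ Y _ X _ ⟩
        - s * (ρ⁺ * (1# + q ^ suc r)) * Y + s * (ρ⁺ * (1# + q ^ suc (r ℕ.+ m))) * X
          ≈⟨ +-cong (*-congʳ (*-congˡ (sym (ratio-r r m)))) (*-congʳ (*-congˡ (ratio-m r m))) ⟩
        f (suc r) + h r ∎
        where
        s = σ r
        ρ⁺ = ratio r (suc m)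
        Xᵉ = base m r ℕ.+ k ℕ.* r ℕ.+ i ℕ.* suc (r ℕ.+ m)
        X = q ^ Xᵉ
        Yᵉ = base m (suc r) ℕ.+ j ℕ.* suc r
        Y = q ^ Yᵉ
        x₁ᵉ = base (suc m) r ℕ.+ i ℕ.* r
        x₁ = q ^ x₁ᵉ
        y₁ᵉ = base (suc m) r ℕ.+ k ℕ.* r ℕ.+ suc j ℕ.* (suc m ℕ.+ suc r)
        y₁ = q ^ y₁ᵉ
        x₂ᵉ = base (suc m) r ℕ.+ suc i ℕ.* r
        x₂ = q ^ x₂ᵉ
        y₂ᵉ = base (suc m) r ℕ.+ k ℕ.* r ℕ.+ j ℕ.* (suc m ℕ.+ suc r)
        y₂ = q ^ y₂ᵉ
        join₂ : ∀ a b c d → a ℕ.+ b ≡ c ℕ.+ d → q ^ a * q ^ b ≈ q ^ c * q ^ d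
        join₂ a b c d eq = trans (sym (^-homo-* q a b)) (^-split q c d eq)
        join₃ : ∀ a b c d e → a ℕ.+ (b ℕ.+ c) ≡ d ℕ.+ e → q ^ a * (q ^ b * q ^ c) ≈ q ^ d * q ^ e
        join₃ a b c d e eq = trans (*-congˡ (sym (^-homo-* q b c))) (join₂ a (b ℕ.+ c) d e eq)
        e₁ : ∀ i j m r k → i ℕ.+ suc j ≡ k → suc m ℕ.* i ℕ.+ (k ℕ.* suc m ℕ.* r ℕ.+ k ℕ.* r ℕ.* r ℕ.+ k ℕ.* r ℕ.+ suc j ℕ.* (suc m ℕ.+ suc r))
             ≡ k ℕ.* m ℕ.* suc r ℕ.+ k ℕ.* suc r ℕ.* suc r ℕ.+ j ℕ.* suc r ℕ.+ suc r
        e₁ i j m r _ ≡.refl = rearrange i j m r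
          where
          rearrange : ∀ i j m r → suc m ℕ.* i ℕ.+ ((i ℕ.+ suc j) ℕ.* suc m ℕ.* r ℕ.+ (i ℕ.+ suc j) ℕ.* r ℕ.* r ℕ.+ (i ℕ.+ suc j) ℕ.* r ℕ.+ suc j ℕ.* (suc m ℕ.+ suc r))
                      ≡ (i ℕ.+ suc j) ℕ.* m ℕ.* suc r ℕ.+ (i ℕ.+ suc j) ℕ.* suc r ℕ.* suc r ℕ.+ j ℕ.* suc r ℕ.+ suc r
          rearrange = solve-∀
        e₂ : ∀ i j m r k → i ℕ.+ suc j ≡ k → suc m ℕ.* i ℕ.+ (suc m ℕ.+ (k ℕ.* suc m ℕ.* r ℕ.+ k ℕ.* r ℕ.* r ℕ.+ k ℕ.* r ℕ.+ j ℕ.* (suc m ℕ.+ suc r)))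
             ≡ k ℕ.* m ℕ.* suc r ℕ.+ k ℕ.* suc r ℕ.* suc r ℕ.+ j ℕ.* suc r ℕ.+ 0
        e₂ i j m r _ ≡.refl = rearrange i j m r
          where
          rearrange : ∀ i j m r → suc m ℕ.* i ℕ.+ (suc m ℕ.+ ((i ℕ.+ suc j) ℕ.* suc m ℕ.* r ℕ.+ (i ℕ.+ suc j) ℕ.* r ℕ.* r ℕ.+ (i ℕ.+ suc j) ℕ.* r ℕ.+ j ℕ.* (suc m ℕ.+ suc r)))
                      ≡ (i ℕ.+ suc j) ℕ.* m ℕ.* suc r ℕ.+ (i ℕ.+ suc j) ℕ.* suc r ℕ.* suc r ℕ.+ j ℕ.* suc r ℕ.+ 0
          rearrange = solve-∀
        e₃ : ∀ i m r κ → suc m ℕ.* i ℕ.+ (suc κ ℕ.* suc m ℕ.* r ℕ.+ suc κ ℕ.* r ℕ.* r ℕ.+ i ℕ.* r) ≡ suc κ ℕ.* m ℕ.* r ℕ.+ suc κ ℕ.* r ℕ.* r ℕ.+ suc κ ℕ.* r ℕ.+ i ℕ.* suc (r ℕ.+ m) ℕ.+ 0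
        e₃ = solve-∀
        e₄ : ∀ i m r κ → suc m ℕ.* i ℕ.+ (suc m ℕ.+ (suc κ ℕ.* suc m ℕ.* r ℕ.+ suc κ ℕ.* r ℕ.* r ℕ.+ suc i ℕ.* r)) ≡ suc κ ℕ.* m ℕ.* r ℕ.+ suc κ ℕ.* r ℕ.* r ℕ.+ suc κ ℕ.* r ℕ.+ i ℕ.* suc (r ℕ.+ m) ℕ.+ suc (r ℕ.+ m)
        e₄ = solve-∀
      f-vanish : f K ≈ 0#
      f-vanish = trans (*-congˡ (p^≈0 (ℕ.≤-trans L≤K (ℕ.≤-trans (large 0<K) (ℕ.≤-trans (ℕ.m≤n+m _ (k ℕ.* m ℕ.* K)) (ℕ.m≤m+n _ _)))))) (zeroʳ _)
        where
        large : ∀ {n} → 0 < n → n ≤ k ℕ.* n ℕ.* n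
        large {suc n} _ = ℕ.m≤n*m (suc n) (k ℕ.* suc n)
      difference : C (suc i) j m - C i (suc j) m ≈ A * (C (suc j) i (suc m) + B * C j (suc i) (suc m))
      difference = begin
        C (suc i) j m - C i (suc j) m ≈⟨ ∑-- K _ _ ⟨
        ∑ K _ ≈⟨ ∑-cong K left-term ⟩
        ∑ K (λ r → f r + h r) ≈⟨ ∑-+ K f h ⟩
        ∑ K f + ∑ K h ≈⟨ +-congʳ (∑-shift K f f-vanish) ⟩
        f 0 + ∑ K (λ r → f (suc r)) + ∑ K h ≈⟨ +-congʳ (+-congʳ (solve 3 (λ a b c → a :* (b :* (:1 :- :1)) :* c := :0) refl _ _ _)) ⟩
        0# + ∑ K (λ r → f (suc r)) + ∑ K h ≈⟨ +-congʳ (+-identityˡ _) ⟩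
        ∑ K (λ r → f (suc r)) + ∑ K h ≈⟨ ∑-+ K (λ r → f (suc r)) h ⟨
        ∑ K (λ r → f (suc r) + h r) ≈⟨ ∑-cong K right-term ⟨
        ∑ K _ ≈⟨ trans (*-congˡ (trans (+-congˡ (∑-*ˡ K _ _)) (sym (∑-+ K _ _)))) (∑-*ˡ K _ _) ⟨
        A * (C (suc j) i (suc m) + B * C j (suc i) (suc m)) ∎

    -- Overpartitions with parts in m + 1, …, m + d, in which m + 1 occurs non-overlined less
    -- than i times, by the multiplicity f of the non-overlined part m + 1.
    b : ℕ → ℕ → ℕ → Carrier
    b zero    m zero    = 0#
    b zero    m (suc i) = 1#
    b (suc d) m i       = ∑ i λ f → q ^ (suc m ℕ.* f) * (b d (suc m) (k ℕ.∸ f) + q ^ suc m * b d (suc m) (k ℕ.∸ suc f))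

    -- Both sides obey one recurrence in i, with values at m + 1 on the right. The recursion on d
    -- ends at some m ≥ L, where nonempty overpartitions with parts above m are invisible modulo
    -- q^L; the invariant m + d ≥ L records this.
    b-closed : ∀ d m i j → i ℕ.+ j ≡ k → L ≤ m ℕ.+ d → b d m i ≈ P * C i j m
    b-closed zero    m zero    j ≡.refl _ = sym (trans (*-congˡ (C-zero m)) (zeroʳ P))
    b-closed zero    m (suc i) j eq L≤m = sym (C-stable (≡.subst (L ≤_) (ℕ.+-identityʳ m) L≤m) i j)
    b-closed (suc d) m zero    j ≡.refl _ = sym (trans (*-congˡ (C-zero m)) (zeroʳ P))
    b-closed (suc d) m (suc i) j eq L≤m+d = begin
      b (suc d) m i + q ^ (suc m ℕ.* i) * (b d (suc m) (k ℕ.∸ i) + q ^ suc m * b d (suc m) (k ℕ.∸ suc i))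
        ≈⟨ +-cong (b-closed (suc d) m i (suc j) eq′ L≤m+d)
                  (*-congˡ (+-cong (trans (reflexive (≡.cong (b d (suc m)) (complement eq′))) (b-closed d (suc m) (suc j) i (≡.trans (ℕ.+-comm (suc j) i) eq′) L≤))
                                   (*-congˡ (trans (reflexive (≡.cong (b d (suc m)) (complement eq))) (b-closed d (suc m) j (suc i) (≡.trans (ℕ.+-comm j (suc i)) eq) L≤))))) ⟩
      P * C i (suc j) m + q ^ (suc m ℕ.* i) * (P * C (suc j) i (suc m) + q ^ suc m * (P * C j (suc i) (suc m)))
        ≈⟨ solve 6 (λ P x A y B w → P :* x :+ A :* (P :* y :+ B :* (P :* w)) := P :* (x :+ A :* (y :+ B :* w))) refl _ _ _ _ _ _ ⟩
      P * (C i (suc j) m + q ^ (suc m ℕ.* i) * (C (suc j) i (suc m) + q ^ suc m * C j (suc i) (suc m)))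
        ≈⟨ *-congˡ (C-step i j m eq′) ⟨
      P * C (suc i) j m ∎
      where
      eq′ : i ℕ.+ suc j ≡ k
      eq′ = ≡.trans (ℕ.+-suc i j) eq
      L≤ : L ≤ suc m ℕ.+ d
      L≤ = ≡.subst (L ≤_) (ℕ.+-suc m d) L≤m+d
      complement : ∀ {i j} → i ℕ.+ j ≡ k → k ℕ.∸ i ≡ j
      complement {i} {j} eq = ≡.trans (≡.cong (ℕ._∸ i) (≡.sym eq)) (ℕ.m+n∸m≡n i j)

    b-theta : ∀ {d a h} → a ℕ.+ h ≡ k → L ≤ d → b d 0 a ≈ P * Θ L≤K k h a
    b-theta {d} {a} {h} eq L≤d = trans (b-closed d 0 a h eq L≤d) (*-congˡ (C-at-0 a h))

  -- For k = 1 the recurrence admits only the empty overpartition, so `b` is 1. This supplies the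
  -- common value in the case k = 1, to which the peak system does not extend.
  product-trivial : ∀ {K} (L≤K : L ≤ K) → 0 < K → P * Θ L≤K 1 0 1 ≈ 1#
  product-trivial L≤K 0<K = trans (sym (b-theta L≤K 0<K 0 {d = L} {1} {0} ≡.refl ℕ.≤-refl)) (b-one L 0)
    where
    b-nil : ∀ d m → b L≤K 0<K 0 d m 0 ≈ 0#
    b-nil zero    m = refl
    b-nil (suc d) m = refl
    b-one : ∀ d m → b L≤K 0<K 0 d m 1 ≈ 1#
    b-one zero    m = refl
    b-one (suc d) m = begin
      0# + q ^ (m ℕ.* 0) * (b L≤K 0<K 0 d (suc m) 1 + q ^ suc m * b L≤K 0<K 0 d (suc m) 0)
        ≈⟨ +-congˡ (*-cong (^-congʳ q (ℕ.*-zeroʳ m)) (+-cong (b-one d (suc m)) (*-congˡ (b-nil d (suc m))))) ⟩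
      0# + 1# * (1# + q ^ suc m * 0#)
        ≈⟨ solve 1 (λ x → :0 :+ :1 :* (:1 :+ x :* :0) := :1) refl _ ⟩
      1# ∎

-- The multiple sum as a solution of the system.

module MultipleSum (R : CommutativeRing 0ℓ 0ℓ) (L : ℕ) (q : CommutativeRing.Carrier R)
                   (q^L≈0 : CommutativeRing._≈_ R (Powers._^_ R q L) (CommutativeRing.0# R))
                   (½ : CommutativeRing.Carrier R)
                   (½+½≈1 : CommutativeRing._≈_ R (CommutativeRing._+_ R ½ ½) (CommutativeRing.1# R))
                   {K : ℕ} (L≤K : L ≤ K) (0<K : 0 < K) where
  open CommutativeRing R hiding (zero)
  open SetoidReasoning setoid
  open IntegerCoefficients R
  open Sums R
  open Powers R
  open Pochhammer R L q q^L≈0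
  open PeakSystem R L q q^L≈0
  open AlternatingSum R L q q^L≈0
  open WeightedSum R L q q^L≈0 ½ ½+½≈1

  predecessor : (ℕ → Carrier) → ℕ → Carrier
  predecessor A zero    = 0#
  predecessor A (suc M) = A M

  -- One step of the Bailey chain relative to 1, both parameters sent to infinity.
  chain : (ℕ → Carrier) → ℕ → Carrier
  chain A N = ∑ K λ M → q ^ (M ℕ.* M) * ι N M * A M

  -- Y l s N is the sum over N ≥ N₂ ≥ … ≥ N_{l+1} ≥ 0 of the summands of the multiple sum
  -- with N₁ = N, without the weight w N, and with linear exponent N_{s+2} + … + N_{l+1}.
  Y : ℕ → ℕ → ℕ → Carrier
  Y zero    s       N = 1/⟨p⟩ N
  Y (suc l) zero    N = chain (λ M → q ^ M * Y l 0 M) N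
  Y (suc l) (suc s) N = chain (Y l s) N

  -- The neighbour of `Y l s` in which N_{s+1} joins the linear exponent; for s = 0 this is N₁ = N
  -- itself. The sum of the two carries the factor 1 + q^(N_a) for a = s + 1.
  Y⁻ : ℕ → ℕ → ℕ → Carrier
  Y⁻ l zero    N = q ^ N * Y l 0 N
  Y⁻ l (suc s) N = Y l s N

  -- The relation `V-suc` with `V` written out: three neighbouring values of s and the preceding N.
  -- In this form it is inherited by `chain`.
  Tridiagonal : (A⁺ A⁻ A : ℕ → Carrier) → Set
  Tridiagonal A⁺ A⁻ A = ∀ N → q ^ N * (A⁺ N + A⁻ N) ≈ A N + q ^ N * q ^ N * A N - predecessor A N

  predecessor-chain : ∀ A N → predecessor (chain A) N ≈ ∑ K (λ M → q ^ (M ℕ.* M) * ι N (suc M) * A M)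
  predecessor-chain A zero    = sym (∑-zero K λ M → trans (*-congʳ (zeroʳ _)) (zeroˡ _))
  predecessor-chain A (suc N) = refl

  private
    law : ∀ N M → q ^ M * ι N M - q ^ N * ι N M ≈ q ^ M * ι N (suc M)
    law N M = trans (+-congˡ (-‿cong (ι-law N M))) (solve 2 (λ x y → x :- (x :- y) := y) refl _ _)

  -- Under the sum, `ι-law` trades q^N for q^M, where the hypothesis applies. The predecessor of `A`
  -- that it produces is moved back to `A` by summation by parts, with `f` as the telescoping
  -- quantity: `f 0` vanishes since `predecessor A 0` is 0, and `f K` since q^(K²) is 0.
  chain-tridiagonal : ∀ {A⁺ A⁻ A} → Tridiagonal A⁺ A⁻ A → Tridiagonal (chain A⁺) (chain A⁻) (chain A)
  chain-tridiagonal {A⁺} {A⁻} {A} tri N = begin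
    B * (chain A⁺ N + chain A⁻ N) ≈⟨ *-congˡ (∑-+ K _ _) ⟨
    B * ∑ K _ ≈⟨ ∑-*ˡ K _ _ ⟩
    ∑ K _ ≈⟨ ∑-cong K term ⟩
    ∑ K (λ M → (e M * i M * A M + B * B * (e M * i M * A M) - e M * j M * A M) + (f (suc M) - f M))
                                                        ≈⟨ trans (∑-+ K _ _) (+-cong (trans (∑-- K _ _) (+-congʳ (trans (∑-+ K _ _) (+-congˡ (sym (∑-*ˡ K _ _)))))) telescoped) ⟩
    chain A N + B * B * chain A N - ∑ K (λ M → e M * j M * A M) + 0#
                                                        ≈⟨ +-identityʳ _ ⟩
    chain A N + B * B * chain A N - ∑ K (λ M → e M * j M * A M)
                                                        ≈⟨ +-congˡ (-‿cong (predecessor-chain A N)) ⟨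
    chain A N + B * B * chain A N - predecessor (chain A) N ∎
    where
    B = q ^ N
    e i j f : ℕ → Carrier
    e M = q ^ (M ℕ.* M)
    i M = ι N M
    j M = ι N (suc M)
    f M = e M * (i M - j M) * predecessor A M
    square : ∀ M → suc M ℕ.* suc M ≡ M ℕ.* M ℕ.+ M ℕ.+ suc M
    square = solve-∀
    f-suc : ∀ M → f (suc M) ≈ e M * q ^ M * B * j M * A M
    f-suc M = begin
      e (suc M) * (j M - ι N (suc (suc M))) * A M ≈⟨ *-congʳ (*-congʳ (trans (^-split q (M ℕ.* M ℕ.+ M) (suc M) (square M)) (*-congʳ (^-homo-* q (M ℕ.* M) M)))) ⟩
      e M * q ^ M * q ^ suc M * (j M - ι N (suc (suc M))) * A M
                                                        ≈⟨ solve 6 (λ e Q Q′ j j′ A → e :* Q :* Q′ :* (j :- j′) :* A := e :* Q :* (Q′ :* j :- Q′ :* j′) :* A) refl _ _ _ _ _ _ ⟩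
      e M * q ^ M * (q ^ suc M * j M - q ^ suc M * ι N (suc (suc M))) * A M
                                                        ≈⟨ *-congʳ (*-congˡ (ι-law N (suc M))) ⟨
      e M * q ^ M * (B * j M) * A M ≈⟨ *-congʳ (*-assoc _ _ _) ⟨
      e M * q ^ M * B * j M * A M ∎
    telescoped : ∑ K (λ M → f (suc M) - f M) ≈ 0#
    telescoped = begin
      ∑ K (λ M → f (suc M) - f M) ≈⟨ ∑-cong K (λ M → solve 2 (λ x y → x :- y := :- (y :- x)) refl _ _) ⟩
      ∑ K (λ M → - (f M - f (suc M))) ≈⟨ ∑-neg K _ ⟨
      - ∑ K (λ M → f M - f (suc M)) ≈⟨ -‿cong (∑-telescope K f) ⟩
      - (f 0 - f K) ≈⟨ -‿cong (+-congˡ (-‿cong (trans (*-congʳ (*-congʳ (p^≈0 (ℕ.≤-trans L≤K (square-above K))))) (*-congʳ (zeroˡ _))))) ⟩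
      - (1# * (i 0 - j 0) * 0# - 0# * predecessor A K) ≈⟨ solve 2 (λ x y → :- (:1 :* x :* :0 :- :0 :* y) := :0) refl _ _ ⟩
      0# ∎
      where
      square-above : ∀ n → n ≤ n ℕ.* n
      square-above zero    = z≤n
      square-above (suc n) = ℕ.m≤m*n (suc n) (suc n)
    term : ∀ M → B * (e M * i M * A⁺ M + e M * i M * A⁻ M) ≈ (e M * i M * A M + B * B * (e M * i M * A M) - e M * j M * A M) + (f (suc M) - f M)
    term M = begin
      B * (e M * i M * A⁺ M + e M * i M * A⁻ M) ≈⟨ solve 6 (λ B e i j x Q → B :* (e :* i :* x :+ e :* i :* j) := e :* (B :* i) :* (x :+ j)) refl B (e M) (i M) (A⁻ M) (A⁺ M) Q ⟩
      e M * (B * i M) * (A⁺ M + A⁻ M) ≈⟨ *-congʳ (*-congˡ (ι-law N M)) ⟩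
      e M * (Q * i M - Q * j M) * (A⁺ M + A⁻ M) ≈⟨ solve 5 (λ e Q i j x → e :* (Q :* i :- Q :* j) :* x := e :* (i :- j) :* (Q :* x)) refl _ _ _ _ _ ⟩
      e M * (i M - j M) * (Q * (A⁺ M + A⁻ M)) ≈⟨ *-congˡ (tri M) ⟩
      e M * (i M - j M) * (A M + Q * Q * A M - predecessor A M)
                                                        ≈⟨ solve 6 (λ e Q i j A A₋ → e :* (i :- j) :* (A :+ Q :* Q :* A :- A₋) := e :* i :* A :+ e :* Q :* A :* (Q :* i :- Q :* j) :- e :* j :* A :- e :* (i :- j) :* A₋) refl _ _ _ _ _ _ ⟩
      e M * i M * A M + e M * Q * A M * (Q * i M - Q * j M) - e M * j M * A M - f M
                                                        ≈⟨ +-congʳ (+-congʳ (+-congˡ (*-congˡ (ι-law N M)))) ⟨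
      e M * i M * A M + e M * Q * A M * (B * i M) - e M * j M * A M - f M
                                                        ≈⟨ +-congʳ (+-congʳ (+-congˡ (solve 5 (λ e Q A B i → e :* Q :* A :* (B :* i) := e :* A :* B :* (Q :* i)) refl _ _ _ _ _))) ⟩
      e M * i M * A M + e M * A M * B * (Q * i M) - e M * j M * A M - f M
                                                        ≈⟨ +-congʳ (+-congʳ (+-congˡ (*-congˡ (trans (solve 2 (λ x y → x := y :+ (x :- y)) refl _ _) (+-congˡ (law N M)))))) ⟩
      e M * i M * A M + e M * A M * B * (B * i M + Q * j M) - e M * j M * A M - f M
                                                        ≈⟨ solve 7 (λ e i A B Q j f → e :* i :* A :+ e :* A :* B :* (B :* i :+ Q :* j) :- e :* j :* A :- f := (e :* i :* A :+ B :* B :* (e :* i :* A) :- e :* j :* A) :+ (e :* Q :* B :* j :* A :- f)) refl _ _ _ _ _ _ _ ⟩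
      (e M * i M * A M + B * B * (e M * i M * A M) - e M * j M * A M) + (e M * Q * B * j M * A M - f M)
                                                        ≈⟨ +-congˡ (+-congʳ (f-suc M)) ⟨
      (e M * i M * A M + B * B * (e M * i M * A M) - e M * j M * A M) + (f (suc M) - f M) ∎
      where
      Q = q ^ M

  chain-cong : ∀ {A A′} → (∀ M → A M ≈ A′ M) → ∀ N → chain A N ≈ chain A′ N
  chain-cong eq N = ∑-cong K λ M → *-congˡ (eq M)

  -- Peeling off one `chain` lowers l and s together, so the relation propagates from shorter
  -- chains. A separate computation is due only at s = 0, where the linear exponent covers all of
  -- N₂, ..., N_{l+1} and `chain` meets the additional factor q^M.
  Y-tridiagonal : ∀ l {s} → s ≤ l → Tridiagonal (Y l (suc s)) (Y⁻ l s) (Y l s)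
  Y-tridiagonal zero    z≤n N = begin
    B * (y + B * y) ≈⟨ solve 2 (λ B y → B :* (y :+ B :* y) := y :+ B :* B :* y :- (:1 :- B) :* y) refl _ _ ⟩
    y + B * B * y - (1# - B) * y ≈⟨ +-congˡ (-‿cong (step N)) ⟩
    y + B * B * y - predecessor 1/⟨p⟩ N ∎
    where
    B = q ^ N
    y = 1/⟨p⟩ N
    step : ∀ N → (1# - q ^ N) * 1/⟨p⟩ N ≈ predecessor 1/⟨p⟩ N
    step zero    = solve 0 ((:1 :- :1) :* :1 := :0) refl
    step (suc N) = 1/⟨p⟩-step N
  Y-tridiagonal (suc l) {zero} z≤n N = begin
    B * (Y (suc l) 1 N + B * Y (suc l) 0 N) ≈⟨ solve 3 (λ B x y → B :* (x :+ B :* y) := y :+ B :* B :* y :- (y :- B :* x)) refl _ _ _ ⟩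
    Y (suc l) 0 N + B * B * Y (suc l) 0 N - (Y (suc l) 0 N - B * Y (suc l) 1 N) ≈⟨ +-congˡ (-‿cong difference) ⟩
    Y (suc l) 0 N + B * B * Y (suc l) 0 N - predecessor (Y (suc l) 0) N ∎
    where
    B = q ^ N
    A = Y l 0
    difference : Y (suc l) 0 N - B * Y (suc l) 1 N ≈ predecessor (Y (suc l) 0) N
    difference = begin
      chain (λ M → q ^ M * A M) N - B * chain A N ≈⟨ trans (+-congˡ (-‿cong (∑-*ˡ K _ _))) (sym (∑-- K _ _)) ⟩
      ∑ K (λ M → q ^ (M ℕ.* M) * ι N M * (q ^ M * A M) - B * (q ^ (M ℕ.* M) * ι N M * A M))
        ≈⟨ ∑-cong K (λ M → trans (solve 5 (λ e i Q A B → e :* i :* (Q :* A) :- B :* (e :* i :* A) := e :* (Q :* i :- B :* i) :* A) refl _ _ _ _ _)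
                           (trans (*-congʳ (*-congˡ (law N M))) (solve 4 (λ e Q j A → e :* (Q :* j) :* A := e :* j :* (Q :* A)) refl _ _ _ _))) ⟩
      ∑ K (λ M → q ^ (M ℕ.* M) * ι N (suc M) * (q ^ M * A M)) ≈⟨ predecessor-chain _ N ⟨
      predecessor (chain (λ M → q ^ M * A M)) N ≈⟨ reflexive (predecessor-cong N) ⟩
      predecessor (Y (suc l) 0) N ∎
      where
      predecessor-cong : ∀ N → predecessor (chain (λ M → q ^ M * A M)) N ≡ predecessor (Y (suc l) 0) N
      predecessor-cong zero    = ≡.refl
      predecessor-cong (suc N) = ≡.refl
  Y-tridiagonal (suc l) {suc zero}    (s≤s s≤l) N = chain-tridiagonal (Y-tridiagonal l s≤l) N
  Y-tridiagonal (suc l) {suc (suc s)} (s≤s s≤l) N = chain-tridiagonal (Y-tridiagonal l s≤l) N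

  chain-initial : ∀ {A} → A 0 ≈ 1# → chain A 0 ≈ 1#
  chain-initial {A} A₀≈1 = begin
    chain A 0 ≈⟨ ∑-truncate _ 0<K (λ { zero () ; (suc M) _ → trans (*-congʳ (zeroʳ _)) (zeroˡ _) }) ⟩
    0# + 1# * 1# * A 0 ≈⟨ +-congˡ (*-congˡ A₀≈1) ⟩
    0# + 1# * 1# * 1# ≈⟨ solve 0 (:0 :+ :1 :* :1 :* :1 := :1) refl ⟩
    1# ∎

  Y-initial : ∀ l s → Y l s 0 ≈ 1#
  Y-initial zero    s       = refl
  Y-initial (suc l) zero    = chain-initial (trans (*-identityˡ _) (Y-initial l 0))
  Y-initial (suc l) (suc s) = chain-initial (Y-initial l s)

  Y-last : ∀ l N → Y l (suc l) N ≈ Y l l N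
  Y-last zero    N = refl
  Y-last (suc l) N = chain-cong (Y-last l) N

  Y-isPeakSystem : ∀ l → IsPeakSystem K l (Y l)
  Y-isPeakSystem l = record
    { initial = λ {s} _ → Y-initial l s
    ; V-zero  = λ M → rearrange₀ (Y-tridiagonal l z≤n (suc M))
    ; V-suc   = λ s<l M → rearrange₁ (Y-tridiagonal l s<l (suc M))
    ; last    = λ {N} _ → Y-last l N
    }
    where
    rearrange₀ : ∀ {B y y⁺ x} → B * (y⁺ + B * y) ≈ y + B * B * y - x → y - B * y⁺ ≈ x
    rearrange₀ {B} {y} {y⁺} {x} eq = begin
      y - B * y⁺ ≈⟨ solve 3 (λ B y y⁺ → y :- B :* y⁺ := y :+ B :* B :* y :- B :* (y⁺ :+ B :* y)) refl B y y⁺ ⟩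
      y + B * B * y - B * (y⁺ + B * y) ≈⟨ +-congˡ (-‿cong eq) ⟩
      y + B * B * y - (y + B * B * y - x) ≈⟨ solve 2 (λ y x → y :- (y :- x) := x) refl _ x ⟩
      x ∎
    rearrange₁ : ∀ {B y y⁺ y⁻ x} → B * (y⁺ + y⁻) ≈ y + B * B * y - x → y - B * y⁺ ≈ x + B * (y⁻ - B * y)
    rearrange₁ {B} {y} {y⁺} {y⁻} {x} eq = begin
      y - B * y⁺ ≈⟨ solve 4 (λ B y y⁺ y⁻ → y :- B :* y⁺ := y :+ B :* y⁻ :- B :* (y⁺ :+ y⁻)) refl B y y⁺ y⁻ ⟩
      y + B * y⁻ - B * (y⁺ + y⁻) ≈⟨ +-congˡ (-‿cong eq) ⟩
      y + B * y⁻ - (y + B * B * y - x) ≈⟨ solve 4 (λ B y y⁻ x → y :+ B :* y⁻ :- (y :+ B :* B :* y :- x) := x :+ B :* (y⁻ :- B :* y)) refl B y y⁻ x ⟩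
      x + B * (y⁻ - B * y) ∎

  -- Uniqueness replaces each `Y` by a `Z`. At a = 0 the neighbour q^N Y corresponds to h = l + 2,
  -- which lies outside the system; there `W-top` identifies Z with q^N times its value at h = l +
  -- 1.
  Y+Y⁻≈Z : ∀ l {h a} → h ℕ.+ a ≡ suc l → ∀ N → N < K → Y l a N + Y⁻ l a N ≈ Z (suc l) K (suc h) a N + Z (suc l) K h (suc a) N
  Y+Y⁻≈Z l {h} {zero} eq N N<K rewrite ≡.trans (≡.sym (ℕ.+-identityʳ h)) eq = begin
    Y l 0 N + q ^ N * Y l 0 N ≈⟨ +-cong Y≈Z (*-congˡ Y≈Z) ⟩
    Z (suc l) K (suc l) 1 N + q ^ N * Z (suc l) K (suc l) 1 N ≈⟨ +-congˡ (sym Z-top) ⟩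
    Z (suc l) K (suc l) 1 N + Z (suc l) K (suc (suc l)) 0 N ≈⟨ +-comm _ _ ⟩
    Z (suc l) K (suc (suc l)) 0 N + Z (suc l) K (suc l) 1 N ∎
    where
    Y≈Z : Y l 0 N ≈ Z (suc l) K (suc l) 1 N
    Y≈Z = peakSystem-unique (Y-isPeakSystem l) (Z-isPeakSystem l 0<K) N N<K z≤n
    Z-top : Z (suc l) K (suc (suc l)) 0 N ≈ q ^ N * Z (suc l) K (suc l) 1 N
    Z-top = begin
      x ≈⟨ solve 2 (λ x y → x := (x :- y) :+ y) refl x y ⟩
      (x - y) + y ≈⟨ +-congʳ (trans (Z-difference (suc l) K (suc l) 0 N) (W-top (suc l) K N)) ⟩
      0# + y ≈⟨ +-identityˡ y ⟩
      y ∎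
      where
      x = Z (suc l) K (suc (suc l)) 0 N
      y = q ^ N * Z (suc l) K (suc l) 1 N
  Y+Y⁻≈Z l {h} {suc s} eq N N<K = begin
    Y l (suc s) N + Y l s N ≈⟨ +-cong (Y≈Z (suc s) h (s≤s s≤l) (≡.trans (≡.cong (ℕ._∸ suc s) (≡.sym eq)) (ℕ.m+n∸n≡m h (suc s))))
                                                                                 (Y≈Z s (suc h) (ℕ.m≤n⇒m≤1+n s≤l) (≡.trans (≡.cong (ℕ._∸ s) (≡.sym eq′)) (ℕ.m+n∸n≡m (suc h) s))) ⟩
    Z (suc l) K h (suc (suc s)) N + Z (suc l) K (suc h) (suc s) N ≈⟨ +-comm _ _ ⟩
    Z (suc l) K (suc h) (suc s) N + Z (suc l) K h (suc (suc s)) N ∎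
    where
    eq′ : suc h ℕ.+ s ≡ suc l
    eq′ = ≡.trans (≡.sym (ℕ.+-suc h s)) eq
    s≤l : s ≤ l
    s≤l = ℕ.≤-trans (ℕ.m≤n+m s h) (ℕ.≤-reflexive (ℕ.suc-injective eq′))
    Y≈Z : ∀ s h → s ≤ suc l → suc l ℕ.∸ s ≡ h → Y l s N ≈ Z (suc l) K h (suc s) N
    Y≈Z s h s≤ ≡.refl = peakSystem-unique (Y-isPeakSystem l) (Z-isPeakSystem l 0<K) N N<K s≤

  weighted-Y : ∀ l {h a} → h ℕ.+ a ≡ suc l → ∑ K (λ N → w N * (Y l a N + Y⁻ l a N)) ≈ P * Θ L≤K (suc (suc l)) h (suc a)
  weighted-Y l {h} {a} eq = trans (∑-cong< K (λ N N<K → *-congˡ (Y+Y⁻≈Z l eq N N<K))) (weighted-Z L≤K 0<K (suc l) h a)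

  sum-tuples : ∀ (f : List ℕ → Carrier) l b → sum (map f (tuples (suc l) b)) ≈ ∑ (suc b) (λ x → sum (map (λ Ns → f (x ∷ Ns)) (tuples l x)))
  sum-tuples f l b = begin
    sum (map f (concatMap (λ x → map (x ∷_) (tuples l x)) (upTo (suc b)))) ≈⟨ sum-concatMap f (λ x → map (x ∷_) (tuples l x)) (upTo (suc b)) ⟩
    sum (map (λ x → sum (map f (map (x ∷_) (tuples l x)))) (upTo (suc b))) ≈⟨ sum-applyUpTo _ (λ i → i) (suc b) ⟩
    ∑ (suc b) (λ x → sum (map f (map (x ∷_) (tuples l x)))) ≈⟨ ∑-cong (suc b) (λ x → reflexive (≡.cong sum (≡.sym (List.map-∘ (tuples l x))))) ⟩
    ∑ (suc b) (λ x → sum (map (λ Ns → f (x ∷ Ns)) (tuples l x))) ∎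

  y : ℕ → ℕ → List ℕ → Carrier
  y s       N []       = 1/⟨p⟩ N
  y zero    N (M ∷ Ms) = q ^ (M ℕ.* M) * 1/⟨p⟩ (N ℕ.∸ M) * (q ^ M * y zero M Ms)
  y (suc s) N (M ∷ Ms) = q ^ (M ℕ.* M) * 1/⟨p⟩ (N ℕ.∸ M) * y s M Ms

  sum-y : ∀ l s N → N < K → sum (map (y s N) (tuples l N)) ≈ Y l s N
  sum-y zero    s N N<K = +-identityʳ _
  sum-y (suc l) s N N<K = begin
    sum (map (y s N) (tuples (suc l) N)) ≈⟨ sum-tuples (y s N) l N ⟩
    ∑ (suc N) (λ M → sum (map (λ Ms → y s N (M ∷ Ms)) (tuples l M))) ≈⟨ ∑-cong< (suc N) (λ M M≤N → trans (inner s M (ℕ.<-≤-trans M≤N N<K)) (*-congʳ (*-congˡ (reflexive (≡.sym (ι-∸ (ℕ.s≤s⁻¹ M≤N))))))) ⟩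
    ∑ (suc N) (λ M → q ^ (M ℕ.* M) * ι N M * tail s M) ≈⟨ ∑-truncate _ N<K (λ M N<M → trans (*-congʳ (trans (*-congˡ (ι-zero N<M)) (zeroʳ _))) (zeroˡ _)) ⟨
    chain (tail s) N ≈⟨ reflexive (unfold s) ⟩
    Y (suc l) s N ∎
    where
    tail : ℕ → ℕ → Carrier
    tail zero    M = q ^ M * Y l 0 M
    tail (suc s) M = Y l s M
    inner : ∀ s M → M < K → sum (map (λ Ms → y s N (M ∷ Ms)) (tuples l M)) ≈ q ^ (M ℕ.* M) * 1/⟨p⟩ (N ℕ.∸ M) * tail s M
    inner zero    M M<K = trans (sum-*ˡ _ (λ Ms → q ^ M * y zero M Ms) (tuples l M)) (*-congˡ (trans (sum-*ˡ _ (y zero M) (tuples l M)) (*-congˡ (sum-y l 0 M M<K))))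
    inner (suc s) M M<K = trans (sum-*ˡ _ (y s M) (tuples l M)) (*-congˡ (sum-y l s M M<K))
    unfold : ∀ s → chain (tail s) N ≡ Y (suc l) s N
    unfold zero    = ≡.refl
    unfold (suc s) = ≡.refl

-- Generating functions of words over a finite alphabet.

words : {A : Set} → List A → ℕ → List (List A)
words alphabet zero    = [] ∷ []
words alphabet (suc F) = [] ∷ cartesianProductWith _∷_ alphabet (words alphabet F)

≡ᵇ-refl : ∀ n → (n ≡ᵇ n) ≡ true
≡ᵇ-refl zero    = ≡.refl
≡ᵇ-refl (suc n) = ≡ᵇ-refl n

≡ᵇ⇒≡ : ∀ m n → (m ≡ᵇ n) ≡ true → m ≡ n
≡ᵇ⇒≡ zero    zero    _  = ≡.refl
≡ᵇ⇒≡ (suc m) (suc n) eq = ≡.cong suc (≡ᵇ⇒≡ m n eq)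

<ᵇ⇒< : ∀ m n → (m <ᵇ n) ≡ true → m < n
<ᵇ⇒< m n eq = ℕ.<ᵇ⇒< m n (≡.subst T (≡.sym eq) _)

<⇒<ᵇ≡true : ∀ {m n} → m < n → (m <ᵇ n) ≡ true
<⇒<ᵇ≡true {m} {n} m<n with m <ᵇ n | ℕ.<⇒<ᵇ m<n
... | true | _ = ≡.refl

∧-true : ∀ {x y} → (x ∧ y) ≡ true → x ≡ true × y ≡ true
∧-true {true} eq = ≡.refl , eq

module WordSeries (R : CommutativeRing 0ℓ 0ℓ) (q : CommutativeRing.Carrier R) {A : Set} (alphabet : List A) where
  open CommutativeRing R hiding (zero)
  open SetoidReasoning setoid
  open Sums R
  open Powers R

  indicator : Bool → Carrier → Carrier
  indicator true  x = x
  indicator false x = 0#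

  gf : ℕ → (List A → Bool) → (List A → ℕ) → Carrier
  gf zero    P wt = indicator (P []) (q ^ wt [])
  gf (suc F) P wt = indicator (P []) (q ^ wt []) + sum (map (λ a → gf F (P ∘ (a ∷_)) (wt ∘ (a ∷_))) alphabet)

  gf-words : ∀ F P wt → gf F P wt ≈ sum (map (λ w → indicator (P w) (q ^ wt w)) (words alphabet F))
  gf-words zero    P wt = sym (+-identityʳ _)
  gf-words (suc F) P wt = +-congˡ (trans (sum-cong (λ a → gf-words F (P ∘ (a ∷_)) (wt ∘ (a ∷_))) alphabet)
    (sym (sum-cartesianProductWith (λ w → indicator (P w) (q ^ wt w)) _∷_ alphabet (words alphabet F))))

  gf-cong : ∀ F {P P′ wt wt′} → (∀ w → P w ≡ P′ w) → (∀ w → P w ≡ true → wt w ≡ wt′ w) → gf F P wt ≈ gf F P′ wt′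
  gf-cong F {P} {P′} {wt} {wt′} P≡ wt≡ = go F P≡ wt≡
    where
    head : ∀ {b b′ m m′} → b ≡ b′ → (b ≡ true → m ≡ m′) → indicator b (q ^ m) ≈ indicator b′ (q ^ m′)
    head {true}  ≡.refl eq = ^-congʳ q (eq ≡.refl)
    head {false} ≡.refl eq = refl
    go : ∀ F {P P′ wt wt′} → (∀ w → P w ≡ P′ w) → (∀ w → P w ≡ true → wt w ≡ wt′ w) → gf F P wt ≈ gf F P′ wt′
    go zero    P≡ wt≡ = head (P≡ []) (wt≡ [])
    go (suc F) P≡ wt≡ = +-cong (head (P≡ []) (wt≡ [])) (sum-cong (λ a → go F (P≡ ∘ (a ∷_)) (wt≡ ∘ (a ∷_))) alphabet)

  sum-zero : ∀ {B : Set} {f : B → Carrier} → (∀ x → f x ≈ 0#) → ∀ xs → sum (map f xs) ≈ 0#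
  sum-zero f≈0 []       = refl
  sum-zero f≈0 (x ∷ xs) = trans (+-cong (f≈0 x) (sum-zero f≈0 xs)) (+-identityˡ 0#)

  gf-false : ∀ F {P wt} → (∀ w → P w ≡ false) → gf F P wt ≈ 0#
  gf-false zero    {wt = wt} P≡ = reflexive (≡.cong (λ b → indicator b (q ^ wt [])) (P≡ []))
  gf-false (suc F) {wt = wt} P≡ = trans (+-cong (reflexive (≡.cong (λ b → indicator b (q ^ wt [])) (P≡ []))) (sum-zero (λ a → gf-false F (P≡ ∘ (a ∷_))) alphabet)) (+-identityˡ 0#)

  gf-scale : ∀ F P c wt → gf F P (λ w → c ℕ.+ wt w) ≈ q ^ c * gf F P wt
  gf-scale F P c wt = go F P wt
    where
    head : ∀ b m → indicator b (q ^ (c ℕ.+ m)) ≈ q ^ c * indicator b (q ^ m)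
    head true  m = ^-homo-* q c m
    head false m = sym (zeroʳ _)
    go : ∀ F P wt → gf F P (λ w → c ℕ.+ wt w) ≈ q ^ c * gf F P wt
    go zero    P wt = head (P []) (wt [])
    go (suc F) P wt = trans (+-cong (head (P []) (wt [])) (trans (sum-cong (λ a → go F (P ∘ (a ∷_)) (wt ∘ (a ∷_))) alphabet) (sum-*ˡ _ _ alphabet))) (sym (distribˡ _ _ _))

  gf-shift : ∀ F {P} c {wt wt′} → (∀ w → P w ≡ true → wt w ≡ c ℕ.+ wt′ w) → gf F P wt ≈ q ^ c * gf F P wt′
  gf-shift F {P} c {wt} {wt′} eq = trans (gf-cong F (λ _ → ≡.refl) eq) (gf-scale F P c wt′)

  -- Words of length exactly F + 1 contribute only vanishing powers of q. A recursion that consumes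
  -- one letter can therefore be closed up at a fixed length bound.
  gf-stable : ∀ F {P wt L} → q ^ L ≈ 0# → (∀ w → length w ≡ suc F → P w ≡ true → L ≤ wt w) → gf (suc F) P wt ≈ gf F P wt
  gf-stable zero {P} {wt} q^L≈0 large = trans (+-congˡ (sum-zero (λ a → vanish (P (a ∷ [])) (wt (a ∷ [])) (large (a ∷ []) ≡.refl)) alphabet)) (+-identityʳ _)
    where
    vanish : ∀ b m → (b ≡ true → _ ≤ m) → indicator b (q ^ m) ≈ 0#
    vanish true  m L≤m = nilpotent-above {q} q^L≈0 (L≤m ≡.refl)
    vanish false m L≤m = refl
  gf-stable (suc F) q^L≈0 large = +-congˡ (sum-cong (λ a → gf-stable F q^L≈0 (λ w eq → large (a ∷ w) (≡.cong suc eq))) alphabet)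

  indicator-partition : ∀ K b x m → m < K → indicator b x ≈ ∑ K (λ N → indicator (b ∧ (m ≡ᵇ N)) x)
  indicator-partition K false x m m<K = sym (∑-zero K λ _ → refl)
  indicator-partition K true  x m m<K = sym (begin
    ∑ K (λ N → indicator (m ≡ᵇ N) x) ≈⟨ ∑-truncate _ m<K (λ N m<N → reflexive (≡.cong (λ b → indicator b x) (different N (ℕ.<⇒≢ m<N)))) ⟩
    ∑ m (λ N → indicator (m ≡ᵇ N) x) + indicator (m ≡ᵇ m) x ≈⟨ +-cong (trans (∑-cong< m (λ N N<m → reflexive (≡.cong (λ b → indicator b x) (different N (ℕ.<⇒≢ N<m ∘ ≡.sym))))) (∑-zero m λ _ → refl)) (reflexive (≡.cong (λ b → indicator b x) (≡ᵇ-refl m))) ⟩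
    0# + x ≈⟨ +-identityˡ x ⟩
    x ∎)
    where
    different : ∀ N → (m ≡ N → ⊥) → (m ≡ᵇ N) ≡ false
    different N m≢N with m ≡ᵇ N in eq
    ... | true  = ⊥-elim (m≢N (≡ᵇ⇒≡ m N eq))
    ... | false = ≡.refl

  gf-partition : ∀ K F P wt (st : List A → ℕ) → (∀ w → length w ≤ F → st w < K) → gf F P wt ≈ ∑ K (λ N → gf F (λ w → P w ∧ (st w ≡ᵇ N)) wt)
  gf-partition K zero    P wt st st<K = indicator-partition K (P []) _ (st []) (st<K [] z≤n)
  gf-partition K (suc F) P wt st st<K = begin
    indicator (P []) _ + sum (map (λ a → gf F (P ∘ (a ∷_)) (wt ∘ (a ∷_))) alphabet)
      ≈⟨ +-cong (indicator-partition K (P []) _ (st []) (st<K [] z≤n))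
                (trans (sum-cong (λ a → gf-partition K F (P ∘ (a ∷_)) (wt ∘ (a ∷_)) (st ∘ (a ∷_)) (λ w w≤F → st<K (a ∷ w) (s≤s w≤F))) alphabet) (sum-∑-swap K _ alphabet)) ⟩
    ∑ K _ + ∑ K _
      ≈⟨ ∑-+ K _ _ ⟨
    ∑ K (λ N → gf (suc F) (λ w → P w ∧ (st w ≡ᵇ N)) wt) ∎

-- Lattice paths: peaks, length bounds and first-step decomposition.

peaks : Maybe Step → Path → ℕ
peaks prev []        = 0
peaks prev (SE ∷ ps) = (if isUp prev then 1 else 0) ℕ.+ peaks (just SE) ps
peaks prev (s ∷ ps)  = peaks (just s) ps

-- A shift to the right by one raises the weight of every peak by one. For this reason the paths are
-- refined by their number n of peaks: a horizontal first step then multiplies the series by a power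
-- of q determined by n.
majAux-suc : ∀ x prev ps → majAux (suc x) prev ps ≡ peaks prev ps ℕ.+ majAux x prev ps
majAux-suc x prev []        = ≡.refl
majAux-suc x prev (NE ∷ ps) = majAux-suc (suc x) (just NE) ps
majAux-suc x prev (N↑ ∷ ps)  = majAux-suc x (just N↑) ps
majAux-suc x prev (E ∷ ps)  = majAux-suc (suc x) (just E) ps
majAux-suc x prev (SE ∷ ps) with isUp prev
... | false = majAux-suc (suc x) (just SE) ps
... | true  = ≡.cong suc (≡.trans (≡.cong (x ℕ.+_) (majAux-suc (suc x) (just SE) ps)) (rearrange x (peaks (just SE) ps) _))
  where
  rearrange : ∀ x y z → x ℕ.+ (y ℕ.+ z) ≡ y ℕ.+ (x ℕ.+ z)
  rearrange = solve-∀

peaks≤length : ∀ prev ps → peaks prev ps ≤ length ps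
peaks≤length prev []        = z≤n
peaks≤length prev (NE ∷ ps) = ℕ.m≤n⇒m≤1+n (peaks≤length (just NE) ps)
peaks≤length prev (N↑ ∷ ps)  = ℕ.m≤n⇒m≤1+n (peaks≤length (just N↑) ps)
peaks≤length prev (E ∷ ps)  = ℕ.m≤n⇒m≤1+n (peaks≤length (just E) ps)
peaks≤length prev (SE ∷ ps) with isUp prev
... | false = ℕ.m≤n⇒m≤1+n (peaks≤length (just SE) ps)
... | true  = s≤s (peaks≤length (just SE) ps)

-- Two consecutive steps contain at least one horizontal unit, so a long path has its last
-- peak far to the right. The slack after a North step is smaller, as it has no width.
slack : ℕ → Maybe Step → ℕ
slack k (just N↑) = k
slack k _        = suc k

module _ (k : ℕ) where

  private
    k≤slack : ∀ prev → k ≤ slack k prev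
    k≤slack nothing    = ℕ.n≤1+n k
    k≤slack (just NE)  = ℕ.n≤1+n k
    k≤slack (just SE)  = ℕ.n≤1+n k
    k≤slack (just N↑)  = ℕ.≤-refl
    k≤slack (just E)   = ℕ.n≤1+n k

    horizontal : ∀ {m} x prev n → suc x ℕ.+ suc x ℕ.+ n ≤ m ℕ.+ suc k → x ℕ.+ x ℕ.+ suc n ≤ m ℕ.+ slack k prev
    horizontal {m} x prev n bound = ℕ.≤-trans (ℕ.s≤s⁻¹ (begin
      suc (x ℕ.+ x ℕ.+ suc n) ≡⟨ rearrange x n ⟩
      suc x ℕ.+ suc x ℕ.+ n ≤⟨ bound ⟩
      m ℕ.+ suc k ≡⟨ ℕ.+-suc m k ⟩
      suc (m ℕ.+ k) ∎)) (ℕ.+-monoʳ-≤ m (k≤slack prev))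
      where
      open ℕ.≤-Reasoning
      rearrange : ∀ x n → suc (x ℕ.+ x ℕ.+ suc n) ≡ suc x ℕ.+ suc x ℕ.+ n
      rearrange = solve-∀

  -- The first alternative is a straight descent without peaks. Otherwise the last peak has abscissa
  -- at most `x` plus the horizontal part already accounted for by the major index, and only
  -- South-East steps, at most k of them, follow it. Before it no two North steps are adjacent,
  -- whence the factor 2.
  walk-length : ∀ x h prev ps → h ≤ k → walkOK k h prev ps ≡ true →
    (isUp prev ≡ false × length ps ≤ h) ⊎ (x ℕ.+ x ℕ.+ length ps ≤ majAux x prev ps ℕ.+ majAux x prev ps ℕ.+ slack k prev)
  walk-length x zero    nothing   []        h≤k ok = inj₁ (≡.refl , z≤n)
  walk-length x zero    (just SE) []        h≤k ok = inj₁ (≡.refl , z≤n)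
  walk-length x h       prev      (NE ∷ ps) h≤k ok with ∧-true {suc h <ᵇ k} ok
  ... | 1+h<k , ok′ with walk-length (suc x) (suc h) (just NE) ps (ℕ.<⇒≤ (<ᵇ⇒< (suc h) k 1+h<k)) ok′
  ...   | inj₂ bound = inj₂ (horizontal x prev (length ps) bound)
  walk-length x h       prev      (N↑ ∷ ps) h≤k ok with ∧-true {suc h <ᵇ k} ok
  ... | 1+h<k , ok′ with ∧-true {nAllowedAfter prev} ok′
  ...   | allowed , ok″ with walk-length x (suc h) (just N↑) ps (ℕ.<⇒≤ (<ᵇ⇒< (suc h) k 1+h<k)) ok″
  ...     | inj₂ bound = inj₂ (vertical prev allowed bound)
    where
    vertical : ∀ {m n} prev → nAllowedAfter prev ≡ true → x ℕ.+ x ℕ.+ n ≤ m ℕ.+ k → x ℕ.+ x ℕ.+ suc n ≤ m ℕ.+ slack k prev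
    vertical {m} {n} (just SE) _ bound = ℕ.≤-trans (ℕ.≤-reflexive (ℕ.+-suc (x ℕ.+ x) n)) (ℕ.≤-trans (s≤s bound) (ℕ.≤-reflexive (≡.sym (ℕ.+-suc m k))))
    vertical {m} {n} (just E)  _ bound = ℕ.≤-trans (ℕ.≤-reflexive (ℕ.+-suc (x ℕ.+ x) n)) (ℕ.≤-trans (s≤s bound) (ℕ.≤-reflexive (≡.sym (ℕ.+-suc m k))))
  walk-length x zero    prev      (E ∷ ps)  h≤k ok with walk-length (suc x) 0 (just E) ps z≤n ok
  walk-length x zero    prev      (E ∷ [])  h≤k () | inj₁ (_ , z≤n)
  ... | inj₂ bound = inj₂ (horizontal x prev (length ps) bound)
  walk-length x (suc h) prev      (SE ∷ ps) h≤k ok with isUp prev in up | walk-length (suc x) h (just SE) ps (ℕ.<⇒≤ h≤k) ok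
  ... | false | inj₁ (_ , short) = inj₁ (≡.refl , s≤s short)
  ... | false | inj₂ bound       = inj₂ (horizontal x prev (length ps) bound)
  ... | true  | inj₁ (_ , short) = inj₂ (begin
    x ℕ.+ x ℕ.+ suc (length ps) ≤⟨ ℕ.+-monoʳ-≤ (x ℕ.+ x) (ℕ.≤-trans (s≤s short) h≤k) ⟩
    x ℕ.+ x ℕ.+ k ≤⟨ ℕ.+-mono-≤ (ℕ.+-mono-≤ (ℕ.m≤m+n x m) (ℕ.m≤m+n x m)) (k≤slack prev) ⟩
    x ℕ.+ m ℕ.+ (x ℕ.+ m) ℕ.+ slack k prev ∎)
    where
    open ℕ.≤-Reasoning
    m = majAux (suc x) (just SE) ps
  ... | true  | inj₂ bound       = inj₂ (ℕ.≤-trans (horizontal x prev (length ps) bound) (ℕ.+-monoˡ-≤ (slack k prev) (ℕ.+-mono-≤ (ℕ.m≤n+m _ x) (ℕ.m≤n+m _ x))))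

steps : List Step
steps = NE ∷ SE ∷ N↑ ∷ E ∷ []

n≮ᵇn : ∀ n → (n <ᵇ n) ≡ false
n≮ᵇn zero    = ≡.refl
n≮ᵇn (suc n) = n≮ᵇn n

long-walk-maj : ∀ k L h prev ps → h ≤ k → walkOK k h prev ps ≡ true → length ps ≡ suc (L ℕ.+ L ℕ.+ suc k) → L ≤ majAux 0 prev ps
long-walk-maj k L h prev ps h≤k ok len with walk-length k 0 h prev ps h≤k ok
... | inj₁ (_ , short) = ⊥-elim (ℕ.<-irrefl ≡.refl (begin-strict
  h ≤⟨ h≤k ⟩
  k <⟨ ℕ.m≤n+m (suc k) (L ℕ.+ L) ⟩
  L ℕ.+ L ℕ.+ suc k <⟨ ℕ.n<1+n _ ⟩
  suc (L ℕ.+ L ℕ.+ suc k) ≡⟨ len ⟨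
  length ps ≤⟨ short ⟩
  h ∎))
  where open ℕ.≤-Reasoning
... | inj₂ bound = ℕ.≮⇒≥ λ small → ℕ.<-irrefl ≡.refl (begin-strict
  L ℕ.+ L ℕ.+ suc k <⟨ ℕ.n<1+n _ ⟩
  suc (L ℕ.+ L ℕ.+ suc k) ≡⟨ len ⟨
  length ps ≤⟨ bound ⟩
  majAux 0 prev ps ℕ.+ majAux 0 prev ps ℕ.+ slack k prev
                           ≤⟨ ℕ.+-mono-≤ (ℕ.+-mono-≤ (ℕ.<⇒≤ small) (ℕ.<⇒≤ small)) (slack≤ prev) ⟩
  L ℕ.+ L ℕ.+ suc k ∎)
  where
  open ℕ.≤-Reasoning
  slack≤ : ∀ prev → slack k prev ≤ suc k
  slack≤ nothing   = ℕ.≤-refl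
  slack≤ (just NE) = ℕ.≤-refl
  slack≤ (just SE) = ℕ.≤-refl
  slack≤ (just N↑) = ℕ.n≤1+n k
  slack≤ (just E)  = ℕ.≤-refl

-- A walk that has just risen, or that stands on the axis after an East step, still has to end with
-- a South-East step, and so has a peak ahead.
peakless : ∀ k h prev ps → (isUp prev ≡ true) ⊎ (prev ≡ just E × h ≡ 0) → (walkOK k h prev ps ∧ (peaks prev ps ≡ᵇ 0)) ≡ false
peakless k zero    (just NE) []        _ = ≡.refl
peakless k zero    (just N↑) []        _ = ≡.refl
peakless k zero    (just E)  []        _ = ≡.refl
peakless k (suc h) prev      []        _ = ≡.refl
peakless k zero    nothing   []        (inj₁ ())
peakless k zero    nothing   []        (inj₂ (() , _))
peakless k zero    (just SE) []        (inj₁ ())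
peakless k zero    (just SE) []        (inj₂ (() , _))
peakless k h prev (NE ∷ ps) _ with suc h <ᵇ k
... | false = ≡.refl
... | true  = peakless k (suc h) (just NE) ps (inj₁ ≡.refl)
peakless k h prev (N↑ ∷ ps) _ with suc h <ᵇ k | nAllowedAfter prev
... | false | _     = ≡.refl
... | true  | false = ≡.refl
... | true  | true  = peakless k (suc h) (just N↑) ps (inj₁ ≡.refl)
peakless k zero    prev (E ∷ ps) _ = peakless k 0 (just E) ps (inj₂ (≡.refl , ≡.refl))
peakless k (suc h) prev (E ∷ ps) _ = ≡.refl
peakless k zero    prev (SE ∷ ps) _ = ≡.refl
peakless k (suc h) prev (SE ∷ ps) (inj₁ up) rewrite up = Bool.∧-zeroʳ _

module PathSeries (R : CommutativeRing 0ℓ 0ℓ) (L : ℕ) (q : CommutativeRing.Carrier R)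
                  (q^L≈0 : CommutativeRing._≈_ R (Powers._^_ R q L) (CommutativeRing.0# R))
                  (½ : CommutativeRing.Carrier R)
                  (½+½≈1 : CommutativeRing._≈_ R (CommutativeRing._+_ R ½ ½) (CommutativeRing.1# R)) (l : ℕ) where
  open CommutativeRing R hiding (zero)
  open SetoidReasoning setoid
  open IntegerCoefficients R
  open Sums R
  open Powers R
  open Pochhammer R L q q^L≈0
  open PeakSystem R L q q^L≈0
  open WeightedSum R L q q^L≈0 ½ ½+½≈1 hiding (t)
  open WordSeries R q steps

  -- The length bound of `long-walk-maj`: walks of length `suc F` vanish modulo q^L, which closes
  -- the recursions below at `F`.
  k F : ℕ
  k = suc (suc l)
  F = L ℕ.+ L ℕ.+ suc k

  walks : ℕ → Maybe Step → ℕ → ℕ → Carrier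
  walks f prev h n = gf f (λ ps → walkOK k h prev ps ∧ (peaks prev ps ≡ᵇ n)) (majAux 0 prev)

  walks-stable : ∀ prev h n → h ≤ k → walks (suc F) prev h n ≈ walks F prev h n
  walks-stable prev h n h≤k = gf-stable F {P = λ ps → walkOK k h prev ps ∧ (peaks prev ps ≡ᵇ n)} {wt = majAux 0 prev} q^L≈0 large
    where
    large : ∀ ps → length ps ≡ suc F → (walkOK k h prev ps ∧ (peaks prev ps ≡ᵇ n)) ≡ true → L ≤ majAux 0 prev ps
    large ps len ok = long-walk-maj k L h prev ps h≤k (proj₁ (∧-true ok)) len

  -- U, D, H, S: walks from height h after an upward step, a South-East step, an East step
  -- (at height 0), and at the start; n is the number of peaks.
  U D S : ℕ → ℕ → Carrier
  U = walks F (just NE)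
  D = walks F (just SE)
  S = walks F nothing

  H : ℕ → Carrier
  H = walks F (just E) 0

  private
    horizontal-shift : ∀ {Q : Path → Bool} prev n → (∀ ps → Q ps ≡ true → peaks prev ps ≡ n) → gf F Q (majAux 1 prev) ≈ q ^ n * gf F Q (majAux 0 prev)
    horizontal-shift prev n eq = gf-shift F n λ ps ok → ≡.trans (majAux-suc 0 prev ps) (≡.cong (ℕ._+ majAux 0 prev ps) (eq ps ok))

    shifted-walks : ∀ prev h n → gf F (λ ps → walkOK k h prev ps ∧ (peaks prev ps ≡ᵇ n)) (majAux 1 prev) ≈ q ^ n * walks F prev h n
    shifted-walks prev h n = horizontal-shift prev n λ ps ok → ≡ᵇ⇒≡ _ n (proj₂ (∧-true {walkOK k h prev ps} ok))

    after-NE : ∀ h n → gf F (λ ps → ((suc h <ᵇ k) ∧ walkOK k (suc h) (just NE) ps) ∧ (peaks (just NE) ps ≡ᵇ n)) (majAux 1 (just NE)) ≈ indicator (suc h <ᵇ k) (q ^ n * U (suc h) n)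
    after-NE h n with suc h <ᵇ k
    ... | true  = shifted-walks (just NE) (suc h) n
    ... | false = gf-false F λ _ → ≡.refl

    -- The rules for what follows do not tell a North step from a North-East step, so both lead to
    -- the series `U`. Having no width, the North step brings no power of q.
    after-N-allowed : ∀ h n → gf F (λ ps → ((suc h <ᵇ k) ∧ true ∧ walkOK k (suc h) (just N↑) ps) ∧ (peaks (just N↑) ps ≡ᵇ n)) (majAux 0 (just N↑)) ≈ indicator (suc h <ᵇ k) (U (suc h) n)
    after-N-allowed h n with suc h <ᵇ k
    ... | true  = gf-cong F same-walk λ ps _ → same-maj ps
      where
      same-end : ∀ h ps → walkOK k h (just N↑) ps ≡ walkOK k h (just NE) ps
      same-end h       []        = ≡.refl
      same-end h       (NE ∷ ps) = ≡.refl
      same-end zero    (SE ∷ ps) = ≡.refl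
      same-end (suc h) (SE ∷ ps) = ≡.refl
      same-end h       (N↑ ∷ ps) = ≡.refl
      same-end zero    (E ∷ ps)  = ≡.refl
      same-end (suc h) (E ∷ ps)  = ≡.refl
      same-peaks : ∀ ps → peaks (just N↑) ps ≡ peaks (just NE) ps
      same-peaks []        = ≡.refl
      same-peaks (NE ∷ ps) = ≡.refl
      same-peaks (SE ∷ ps) = ≡.refl
      same-peaks (N↑ ∷ ps) = ≡.refl
      same-peaks (E ∷ ps)  = ≡.refl
      same-maj : ∀ ps → majAux 0 (just N↑) ps ≡ majAux 0 (just NE) ps
      same-maj []        = ≡.refl
      same-maj (NE ∷ ps) = ≡.refl
      same-maj (SE ∷ ps) = ≡.refl
      same-maj (N↑ ∷ ps) = ≡.refl
      same-maj (E ∷ ps)  = ≡.refl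
      same-walk : ∀ ps → (walkOK k (suc h) (just N↑) ps ∧ (peaks (just N↑) ps ≡ᵇ n)) ≡ (walkOK k (suc h) (just NE) ps ∧ (peaks (just NE) ps ≡ᵇ n))
      same-walk ps = ≡.cong₂ (λ b m → b ∧ (m ≡ᵇ n)) (same-end (suc h) ps) (same-peaks ps)
    ... | false = gf-false F λ _ → ≡.refl

    after-N-forbidden : ∀ h n wt → gf F (λ ps → ((suc h <ᵇ k) ∧ false ∧ walkOK k (suc h) (just N↑) ps) ∧ (peaks (just N↑) ps ≡ᵇ n)) wt ≈ 0#
    after-N-forbidden h n wt = gf-false F λ ps → ≡.cong (_∧ (peaks (just N↑) ps ≡ᵇ n)) (Bool.∧-zeroʳ (suc h <ᵇ k))

    forbidden : ∀ {wt} → gf F (λ _ → false) wt ≈ 0#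
    forbidden = gf-false F λ _ → ≡.refl

    indicator-true : ∀ {b x} → b ≡ true → indicator b x ≈ x
    indicator-true ≡.refl = refl

    assemble : ∀ {t a b c d a′ b′ c′ d′} → a ≈ a′ → b ≈ b′ → c ≈ c′ → d ≈ d′ → t + (a + (b + (c + (d + 0#)))) ≈ t + (a′ + (b′ + (c′ + d′)))
    assemble a b c d = +-congˡ (+-cong a (+-cong b (+-cong c (trans (+-identityʳ _) d))))

  U-zero : ∀ h → U h 0 ≈ 0#
  U-zero h = gf-false F λ ps → peakless k h (just NE) ps (inj₁ ≡.refl)

  H-zero : H 0 ≈ 0#
  H-zero = gf-false F λ ps → peakless k 0 (just E) ps (inj₂ (≡.refl , ≡.refl))

  U-step : ∀ h n → h < k → U (suc h) (suc n) ≈ indicator (suc (suc h) <ᵇ k) (q ^ suc n * U (suc (suc h)) (suc n)) + q ^ n * D h n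
  U-step h n h<k = begin
    U (suc h) (suc n) ≈⟨ walks-stable (just NE) (suc h) (suc n) h<k ⟨
    walks (suc F) (just NE) (suc h) (suc n)
      ≈⟨ assemble (after-NE (suc h) (suc n)) (shifted-walks (just SE) h n) (after-N-forbidden (suc h) (suc n) (majAux 0 (just N↑))) forbidden ⟩
    0# + (indicator (suc (suc h) <ᵇ k) (q ^ suc n * U (suc (suc h)) (suc n)) + (q ^ n * D h n + (0# + 0#)))
      ≈⟨ solve 2 (λ x y → :0 :+ (x :+ (y :+ (:0 :+ :0))) := x :+ y) refl _ _ ⟩
    indicator (suc (suc h) <ᵇ k) (q ^ suc n * U (suc (suc h)) (suc n)) + q ^ n * D h n ∎

  -- The same continuations are permitted after an East and after a South-East step, except for the
  -- empty one, which has no peak.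
  H≈D : ∀ n → H (suc n) ≈ D 0 (suc n)
  H≈D n = gf-cong F same-walk λ ps _ → same-maj ps
    where
    same-walk : ∀ ps → (walkOK k 0 (just E) ps ∧ (peaks (just E) ps ≡ᵇ suc n)) ≡ (walkOK k 0 (just SE) ps ∧ (peaks (just SE) ps ≡ᵇ suc n))
    same-walk []        = ≡.refl
    same-walk (NE ∷ ps) = ≡.refl
    same-walk (SE ∷ ps) = ≡.refl
    same-walk (N↑ ∷ ps) = ≡.refl
    same-walk (E ∷ ps)  = ≡.refl
    same-maj : ∀ ps → majAux 0 (just E) ps ≡ majAux 0 (just SE) ps
    same-maj []        = ≡.refl
    same-maj (NE ∷ ps) = ≡.refl
    same-maj (SE ∷ ps) = ≡.refl
    same-maj (N↑ ∷ ps) = ≡.refl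
    same-maj (E ∷ ps)  = ≡.refl

  D-base : ∀ n → D 0 n ≈ indicator (0 ≡ᵇ n) (q ^ 0) + (q ^ n * U 1 n + (U 1 n + q ^ n * H n))
  D-base n = begin
    D 0 n ≈⟨ walks-stable (just SE) 0 n z≤n ⟨
    walks (suc F) (just SE) 0 n ≈⟨ assemble (after-NE 0 n) forbidden (after-N-allowed 0 n) (shifted-walks (just E) 0 n) ⟩
    _ ≈⟨ +-congˡ (+-congˡ (+-identityˡ _)) ⟩
    indicator (0 ≡ᵇ n) (q ^ 0) + (q ^ n * U 1 n + (U 1 n + q ^ n * H n)) ∎

  D-step : ∀ h n → suc h < k → D (suc h) n ≈ indicator (suc (suc h) <ᵇ k) (q ^ n * U (suc (suc h)) n) + (q ^ n * D h n + indicator (suc (suc h) <ᵇ k) (U (suc (suc h)) n))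
  D-step h n h<k = begin
    D (suc h) n ≈⟨ walks-stable (just SE) (suc h) n (ℕ.<⇒≤ h<k) ⟨
    walks (suc F) (just SE) (suc h) n ≈⟨ assemble (after-NE (suc h) n) (shifted-walks (just SE) h n) (after-N-allowed (suc h) n) forbidden ⟩
    _ ≈⟨ trans (+-identityˡ _) (+-congˡ (+-congˡ (+-identityʳ _))) ⟩
    indicator (suc (suc h) <ᵇ k) (q ^ n * U (suc (suc h)) n) + (q ^ n * D h n + indicator (suc (suc h) <ᵇ k) (U (suc (suc h)) n)) ∎

  -- Compared with `D-base` the term `U 1 n` without a power of q is missing, as a North step is
  -- forbidden at the start.
  S-base : ∀ n → S 0 n ≈ indicator (0 ≡ᵇ n) (q ^ 0) + (q ^ n * U 1 n + q ^ n * H n)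
  S-base n = begin
    S 0 n ≈⟨ walks-stable nothing 0 n z≤n ⟨
    walks (suc F) nothing 0 n ≈⟨ assemble (after-NE 0 n) forbidden (after-N-forbidden 0 n (majAux 0 (just N↑))) (shifted-walks (just E) 0 n) ⟩
    _ ≈⟨ +-congˡ (+-congˡ (trans (+-identityˡ _) (+-identityˡ _))) ⟩
    indicator (0 ≡ᵇ n) (q ^ 0) + (q ^ n * U 1 n + q ^ n * H n) ∎

  S-step : ∀ h n → suc h < k → S (suc h) n ≈ indicator (suc (suc h) <ᵇ k) (q ^ n * U (suc (suc h)) n) + q ^ n * D h n
  S-step h n h<k = begin
    S (suc h) n ≈⟨ walks-stable nothing (suc h) n (ℕ.<⇒≤ h<k) ⟨
    walks (suc F) nothing (suc h) n ≈⟨ assemble (after-NE (suc h) n) (shifted-walks (just SE) h n) (after-N-forbidden (suc h) n (majAux 0 (just N↑))) forbidden ⟩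
    _ ≈⟨ trans (+-identityˡ _) (+-congˡ (trans (+-congˡ (+-identityʳ 0#)) (+-identityʳ _))) ⟩
    indicator (suc (suc h) <ᵇ k) (q ^ n * U (suc (suc h)) n) + q ^ n * D h n ∎

  indicator-zero : ∀ b {x} → x ≈ 0# → indicator b x ≈ 0#
  indicator-zero true  x≈0 = x≈0
  indicator-zero false x≈0 = refl

  D-zero : ∀ h → h < k → D h 0 ≈ 1#
  D-zero zero    _   = begin
    D 0 0 ≈⟨ D-base 0 ⟩
    1# + (1# * U 1 0 + (U 1 0 + 1# * H 0)) ≈⟨ +-congˡ (+-cong (*-congˡ (U-zero 1)) (+-cong (U-zero 1) (*-congˡ H-zero))) ⟩
    1# + (1# * 0# + (0# + 1# * 0#)) ≈⟨ solve 0 (:1 :+ (:1 :* :0 :+ (:0 :+ :1 :* :0)) := :1) refl ⟩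
    1# ∎
  D-zero (suc h) h<k = begin
    D (suc h) 0 ≈⟨ D-step h 0 h<k ⟩
    indicator b (1# * U (suc (suc h)) 0) + (1# * D h 0 + indicator b (U (suc (suc h)) 0))
      ≈⟨ +-cong (indicator-zero b (trans (*-identityˡ _) (U-zero (suc (suc h))))) (+-cong (*-congˡ (D-zero h (ℕ.<⇒≤ h<k))) (indicator-zero b (U-zero (suc (suc h))))) ⟩
    0# + (1# * 1# + 0#) ≈⟨ solve 0 (:0 :+ (:1 :* :1 :+ :0) := :1) refl ⟩
    1# ∎
    where
    b = suc (suc h) <ᵇ k

  S-zero : ∀ h → h < k → S h 0 ≈ 1#
  S-zero zero    _   = begin
    S 0 0 ≈⟨ S-base 0 ⟩
    1# + (1# * U 1 0 + 1# * H 0) ≈⟨ +-congˡ (+-cong (*-congˡ (U-zero 1)) (*-congˡ H-zero)) ⟩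
    1# + (1# * 0# + 1# * 0#) ≈⟨ solve 0 (:1 :+ (:1 :* :0 :+ :1 :* :0) := :1) refl ⟩
    1# ∎
  S-zero (suc h) h<k = begin
    S (suc h) 0 ≈⟨ S-step h 0 h<k ⟩
    indicator (suc (suc h) <ᵇ k) (1# * U (suc (suc h)) 0) + 1# * D h 0
      ≈⟨ +-cong (indicator-zero (suc (suc h) <ᵇ k) (trans (*-identityˡ _) (U-zero (suc (suc h))))) (*-congˡ (D-zero h (ℕ.<⇒≤ h<k))) ⟩
    0# + 1# * 1# ≈⟨ solve 0 (:0 :+ :1 :* :1 := :1) refl ⟩
    1# ∎

  module _ {K : ℕ} {X : ℕ → ℕ → Carrier} (system : IsPeakSystem K l X) where
    open IsPeakSystem system

    private
      h<l : ∀ {h s} → h ℕ.+ suc s ≡ l → h < l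
      h<l {h} {s} eq = ℕ.≤-trans (ℕ.m≤m+n (suc h) s) (ℕ.≤-reflexive (≡.trans (≡.sym (ℕ.+-suc h s)) eq))

      allowed : ∀ {h s} → h ℕ.+ suc s ≡ l → (suc (suc h) <ᵇ k) ≡ true
      allowed eq = <⇒<ᵇ≡true (s≤s (s≤s (h<l eq)))

    module _ (n : ℕ) (n<K : suc n < K) (D-previous : ∀ s {h} → h ℕ.+ s ≡ l → D h n ≈ ⟨-q⟩ n * (q ^ triangle n * X s n)) where

      -- Up to normalisation, `V` is the series after an upward step: `V-zero` is the ceiling at
      -- height k - 1, where only a descent is left, and `V-suc` is the choice between rising
      -- further and making a peak.
      U-closed : ∀ s {h} → h ℕ.+ s ≡ l → U (suc h) (suc n) ≈ ⟨-q⟩ n * (q ^ triangle (suc n) * V s (suc n))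
      U-closed zero {h} eq = begin
        U (suc h) (suc n) ≈⟨ U-step h n (s≤s (ℕ.m≤n⇒m≤1+n (ℕ.≤-trans (ℕ.m≤m+n h 0) (ℕ.≤-reflexive eq)))) ⟩
        indicator (suc (suc h) <ᵇ k) _ + q ^ n * D h n ≈⟨ +-congʳ (reflexive (≡.cong (λ b → indicator b (q ^ suc n * U (suc (suc h)) (suc n))) top)) ⟩
        0# + q ^ n * D h n ≈⟨ +-congˡ (*-congˡ (D-previous 0 eq)) ⟩
        0# + q ^ n * (⟨-q⟩ n * (q ^ triangle n * X 0 n)) ≈⟨ solve 4 (λ Q m t x → :0 :+ Q :* (m :* (t :* x)) := m :* (t :* Q :* x)) refl _ _ _ _ ⟩
        ⟨-q⟩ n * (q ^ triangle n * q ^ n * X 0 n) ≈⟨ *-congˡ (*-cong (sym (^-homo-* q (triangle n) n)) (sym (V-zero n))) ⟩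
        ⟨-q⟩ n * (q ^ triangle (suc n) * V 0 (suc n)) ∎
        where
        top : (suc (suc h) <ᵇ k) ≡ false
        top rewrite ≡.trans (≡.sym (ℕ.+-identityʳ h)) eq = n≮ᵇn l
      U-closed (suc s) {h} eq = begin
        U (suc h) (suc n) ≈⟨ U-step h n (s≤s (ℕ.m≤n⇒m≤1+n (ℕ.<⇒≤ (h<l eq)))) ⟩
        indicator (suc (suc h) <ᵇ k) (q ^ suc n * U (suc (suc h)) (suc n)) + q ^ n * D h n
                                                                                       ≈⟨ +-cong (trans (indicator-true (allowed eq)) (*-congˡ (U-closed s (≡.trans (≡.sym (ℕ.+-suc h s)) eq)))) (*-congˡ (D-previous (suc s) eq)) ⟩
        q ^ suc n * (⟨-q⟩ n * (q ^ triangle (suc n) * V s (suc n))) + q ^ n * (⟨-q⟩ n * (q ^ triangle n * X (suc s) n))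
                                                                                       ≈⟨ +-congʳ (*-congˡ (*-congˡ (*-congʳ (^-homo-* q (triangle n) n)))) ⟩
        q ^ suc n * (⟨-q⟩ n * (q ^ triangle n * q ^ n * V s (suc n))) + q ^ n * (⟨-q⟩ n * (q ^ triangle n * X (suc s) n))
                                                                                       ≈⟨ solve 6 (λ A m t Q v x → A :* (m :* (t :* Q :* v)) :+ Q :* (m :* (t :* x)) := m :* (t :* Q :* (x :+ A :* v))) refl _ _ _ _ _ _ ⟩
        ⟨-q⟩ n * (q ^ triangle n * q ^ n * (X (suc s) n + q ^ suc n * V s (suc n))) ≈⟨ *-congˡ (*-cong (sym (^-homo-* q (triangle n) n)) (sym (V-suc (ℕ.≤-trans (ℕ.m≤n+m (suc s) h) (ℕ.≤-reflexive eq)) n))) ⟩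
        ⟨-q⟩ n * (q ^ triangle (suc n) * V (suc s) (suc n)) ∎

      -- At height 0 the East step makes `D 0` occur on both sides, and the factor 1 - q^(n+1) has
      -- to be cancelled. In the system the index `suc l` stands for a fictitious height -1, which
      -- the East step identifies with height 0; this is the meaning of `last`.
      D-next : ∀ h s → h ℕ.+ s ≡ l → D h (suc n) ≈ ⟨-q⟩ (suc n) * (q ^ triangle (suc n) * X s (suc n))
      D-next zero s ≡.refl = cancel-1-p^ n (begin
        (1# - A) * D 0 (suc n) ≈⟨ solve 2 (λ A d → (:1 :- A) :* d := d :- A :* d) refl _ _ ⟩
        D 0 (suc n) - A * D 0 (suc n) ≈⟨ +-congʳ (trans (D-base (suc n)) (+-congˡ (+-congˡ (+-congˡ (*-congˡ (H≈D n)))))) ⟩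
        0# + (A * u + (u + A * D 0 (suc n))) - A * D 0 (suc n) ≈⟨ solve 3 (λ A u d → :0 :+ (A :* u :+ (u :+ A :* d)) :- A :* d := (:1 :+ A) :* u) refl _ _ _ ⟩
        (1# + A) * u ≈⟨ *-congˡ (U-closed s ≡.refl) ⟩
        (1# + A) * (⟨-q⟩ n * (t * (X s (suc n) - A * X (suc s) (suc n)))) ≈⟨ *-congˡ (*-congˡ (*-congˡ (+-congˡ (-‿cong (*-congˡ (last n<K)))))) ⟩
        (1# + A) * (⟨-q⟩ n * (t * (X s (suc n) - A * X s (suc n)))) ≈⟨ solve 4 (λ A m t x → (:1 :+ A) :* (m :* (t :* (x :- A :* x))) := (:1 :- A) :* (m :* (:1 :+ A) :* (t :* x))) refl _ _ _ _ ⟩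
        (1# - A) * (⟨-q⟩ (suc n) * (t * X s (suc n))) ∎)
        where
        A = q ^ suc n
        t = q ^ triangle (suc n)
        u = U 1 (suc n)
      D-next (suc h) s eq = begin
        D (suc h) (suc n) ≈⟨ D-step h (suc n) (s≤s (ℕ.m≤n⇒m≤1+n h≤l)) ⟩
        indicator b (A * u) + (A * D h (suc n) + indicator b u) ≈⟨ +-cong u-closed (+-cong (*-congˡ (D-next h (suc s) eq′)) u-closed₁) ⟩
        A * (⟨-q⟩ n * (t * V s (suc n))) + (A * (⟨-q⟩ (suc n) * (t * X (suc s) (suc n))) + ⟨-q⟩ n * (t * V s (suc n)))
          ≈⟨ solve 5 (λ A m t x y → A :* (m :* (t :* (x :- A :* y))) :+ (A :* (m :* (:1 :+ A) :* (t :* y)) :+ m :* (t :* (x :- A :* y))) := m :* (:1 :+ A) :* (t :* x)) refl _ _ _ _ _ ⟩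
        ⟨-q⟩ (suc n) * (t * X s (suc n)) ∎
        where
        A = q ^ suc n
        t = q ^ triangle (suc n)
        u = U (suc (suc h)) (suc n)
        b = suc (suc h) <ᵇ k
        eq′ : h ℕ.+ suc s ≡ l
        eq′ = ≡.trans (ℕ.+-suc h s) eq
        h≤l : h < l
        h≤l = h<l eq′
        u-closed₁ : indicator b u ≈ ⟨-q⟩ n * (t * V s (suc n))
        u-closed₁ = trans (indicator-true (allowed eq′)) (U-closed s eq)
        u-closed : indicator b (A * u) ≈ A * (⟨-q⟩ n * (t * V s (suc n)))
        u-closed = trans (indicator-true (allowed eq′)) (*-congˡ (U-closed s eq))

    D-closed : ∀ n → n < K → ∀ s {h} → h ℕ.+ s ≡ l → D h n ≈ ⟨-q⟩ n * (q ^ triangle n * X s n)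
    D-closed zero    n<K s {h} eq = begin
      D h 0 ≈⟨ D-zero h (s≤s (ℕ.m≤n⇒m≤1+n (ℕ.≤-trans (ℕ.m≤m+n h s) (ℕ.≤-reflexive eq)))) ⟩
      1# ≈⟨ solve 0 (:1 := :1 :* (:1 :* :1)) refl ⟩
      1# * (1# * 1#) ≈⟨ *-congˡ (*-congˡ (initial (ℕ.m≤n⇒m≤1+n (ℕ.≤-trans (ℕ.m≤n+m s h) (ℕ.≤-reflexive eq))))) ⟨
      1# * (1# * X s 0) ∎
    D-closed (suc n) n<K s {h} eq = D-next n n<K (λ s {h} → D-closed n (ℕ.<⇒≤ n<K) s {h}) h s eq

    -- The initial height k - 1 belongs to a = 1. Only a descent is possible, and the second
    -- neighbour is q^n times the first, in accordance with `Y⁻` at index 0.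
    S-closed-top : ∀ n → n < K → S (suc l) n ≈ w n * (X 0 n + q ^ n * X 0 n)
    S-closed-top n n<K = begin
      S (suc l) n ≈⟨ S-step l n ℕ.≤-refl ⟩
      indicator (suc (suc l) <ᵇ k) _ + q ^ n * D l n ≈⟨ +-cong (reflexive (≡.cong (λ b → indicator b (q ^ n * U (suc (suc l)) n)) (n≮ᵇn l))) (*-congˡ (D-closed n n<K 0 (ℕ.+-identityʳ l))) ⟩
      0# + q ^ n * (⟨-q⟩ n * (q ^ triangle n * X 0 n)) ≈⟨ +-congˡ (*-congˡ (*-congʳ (⟨-q⟩-pred n))) ⟩
      0# + q ^ n * ((1# + q ^ n) * ⟨-q⟩₋₁ n * (q ^ triangle n * X 0 n))
                                                                  ≈⟨ solve 4 (λ Q m t x → :0 :+ Q :* ((:1 :+ Q) :* m :* (t :* x)) := t :* Q :* m :* (x :+ Q :* x)) refl _ _ _ _ ⟩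
      q ^ triangle n * q ^ n * ⟨-q⟩₋₁ n * (X 0 n + q ^ n * X 0 n) ≈⟨ *-congʳ (*-congʳ (^-homo-* q (triangle n) n)) ⟨
      w n * (X 0 n + q ^ n * X 0 n) ∎

    -- With the North step missing, the two remaining first steps give `V` and the next solution,
    -- which combine into the sum of two neighbours. This is the factor 1 + q^(N_a) as seen from the
    -- paths. At n = 0 the convention (-q)₋₁ = 1/2 turns 1 + 1 into 1.
    S-closed : ∀ n → n < K → ∀ s {h} → h ℕ.+ s ≡ l → S h n ≈ w n * (X (suc s) n + X s n)
    S-closed zero    n<K s {h} eq = begin
      S h 0 ≈⟨ S-zero h (s≤s (ℕ.m≤n⇒m≤1+n (ℕ.≤-trans (ℕ.m≤m+n h s) (ℕ.≤-reflexive eq)))) ⟩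
      1# ≈⟨ ½+½≈1 ⟨
      ½ + ½ ≈⟨ solve 1 (λ h → h :+ h := :1 :* h :* (:1 :+ :1)) refl ½ ⟩
      1# * ½ * (1# + 1#) ≈⟨ *-congˡ (+-cong (initial (s≤s s≤l)) (initial (ℕ.m≤n⇒m≤1+n s≤l))) ⟨
      w 0 * (X (suc s) 0 + X s 0) ∎
      where
      s≤l : s ≤ l
      s≤l = ℕ.≤-trans (ℕ.m≤n+m s h) (ℕ.≤-reflexive eq)
    S-closed (suc n) n<K s {h} eq = begin
      S h (suc n) ≈⟨ first-step h s eq ⟩
      A * U (suc h) (suc n) + A * (⟨-q⟩ (suc n) * (t * X (suc s) (suc n)))
                                             ≈⟨ +-congʳ (*-congˡ (U-closed n n<K (λ s {h} → D-closed n (ℕ.<⇒≤ n<K) s {h}) s eq)) ⟩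
      A * (⟨-q⟩ n * (t * (X s (suc n) - A * X (suc s) (suc n)))) + A * (⟨-q⟩ (suc n) * (t * X (suc s) (suc n)))
                                             ≈⟨ solve 5 (λ A m t x y → A :* (m :* (t :* (x :- A :* y))) :+ A :* (m :* (:1 :+ A) :* (t :* y)) := t :* A :* m :* (y :+ x)) refl _ _ _ _ _ ⟩
      t * A * ⟨-q⟩ n * (X (suc s) (suc n) + X s (suc n))
                                             ≈⟨ *-congʳ (*-congʳ (^-homo-* q (triangle (suc n)) (suc n))) ⟨
      w (suc n) * (X (suc s) (suc n) + X s (suc n)) ∎
      where
      A = q ^ suc n
      t = q ^ triangle (suc n)
      first-step : ∀ h s → h ℕ.+ s ≡ l → S h (suc n) ≈ A * U (suc h) (suc n) + A * (⟨-q⟩ (suc n) * (t * X (suc s) (suc n)))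
      first-step zero    s eq = begin
        S 0 (suc n) ≈⟨ S-base (suc n) ⟩
        0# + (A * U 1 (suc n) + A * H (suc n)) ≈⟨ +-identityˡ _ ⟩
        A * U 1 (suc n) + A * H (suc n) ≈⟨ +-congˡ (*-congˡ (trans (H≈D n) (trans (D-closed (suc n) n<K s eq) (*-congˡ (*-congˡ last′))))) ⟩
        A * U 1 (suc n) + A * (⟨-q⟩ (suc n) * (t * X (suc s) (suc n))) ∎
        where
        last′ : X s (suc n) ≈ X (suc s) (suc n)
        last′ = ≡.subst (λ i → X i (suc n) ≈ X (suc i) (suc n)) (≡.sym eq) (sym (last n<K))
      first-step (suc h) s eq = begin
        S (suc h) (suc n) ≈⟨ S-step h (suc n) (s≤s (ℕ.m≤n⇒m≤1+n (h<l eq′))) ⟩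
        indicator (suc (suc h) <ᵇ k) (A * U (suc (suc h)) (suc n)) + A * D h (suc n)
                                                         ≈⟨ +-cong (indicator-true (allowed eq′)) (*-congˡ (D-closed (suc n) n<K (suc s) eq′)) ⟩
        A * U (suc (suc h)) (suc n) + A * (⟨-q⟩ (suc n) * (t * X (suc s) (suc n))) ∎
        where
        eq′ : h ℕ.+ suc s ≡ l
        eq′ = ≡.trans (ℕ.+-suc h s) eq

  path-total : ∀ {K} (L≤K : L ≤ K) (F<K : F < K) {h a} → h ℕ.+ a ≡ suc l →
               gf F (λ ps → walkOK k h nothing ps) maj ≈ P * Θ L≤K k h (suc a)
  path-total {K} L≤K F<K {h} {a} eq = begin
    gf F (λ ps → walkOK k h nothing ps) maj
      ≈⟨ gf-partition K F _ maj (peaks nothing) (λ ps ps≤F → ℕ.≤-<-trans (ℕ.≤-trans (peaks≤length nothing ps) ps≤F) F<K) ⟩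
    ∑ K (S h)
      ≈⟨ ∑-cong< K (λ n n<K → closed a eq n n<K) ⟩
    ∑ K (λ n → w n * (Y l a n + Y⁻ l a n))
      ≈⟨ weighted-Y l eq ⟩
    P * Θ L≤K k h (suc a) ∎
    where
    open MultipleSum R L q q^L≈0 ½ ½+½≈1 L≤K (ℕ.≤-<-trans z≤n F<K)
    closed : ∀ a {h} → h ℕ.+ a ≡ suc l → ∀ n → n < K → S h n ≈ w n * (Y l a n + Y⁻ l a n)
    closed zero {h} eq n n<K rewrite ≡.trans (≡.sym (ℕ.+-identityʳ h)) eq = S-closed-top (Y-isPeakSystem l) n n<K
    closed (suc s) {h} eq n n<K = S-closed (Y-isPeakSystem l) n n<K s (ℕ.suc-injective (≡.trans (≡.sym (ℕ.+-suc h s)) eq))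

-- Overpartitions as words of multiplicities.

T-∧ : ∀ {x y} → T x → T y → T (x ∧ y)
T-∧ {true} _ y = y

T-∧⁻ : ∀ {x y} → T (x ∧ y) → T x × T y
T-∧⁻ {true} y = tt , y

data Overpartition : List Part → Set where
  []   : Overpartition []
  [_]  : ∀ {v o} → 1 ≤ v → Overpartition ((v , o) ∷ [])
  cons : ∀ {v o w o′ ps} → 1 ≤ v → w ≤ v → (v ≡ w → o′ ≡ false) → Overpartition ((w , o′) ∷ ps) → Overpartition ((v , o) ∷ (w , o′) ∷ ps)

overpartition : ∀ ps → T (isOverpartition ps) → Overpartition ps
overpartition []                        ok = []
overpartition ((v , o) ∷ [])            ok = [ ℕ.≤ᵇ⇒≤ 1 v ok ]
overpartition ((v , o) ∷ (w , o′) ∷ ps) ok =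
  cons (ℕ.≤ᵇ⇒≤ 1 v (proj₁ ok₀)) (ℕ.≤ᵇ⇒≤ w v (proj₁ ok₁)) (not-overlined o′ (proj₁ ok₂)) (overpartition ((w , o′) ∷ ps) (proj₂ ok₂))
  where
  ok₀ = T-∧⁻ {1 ≤ᵇ v} ok
  ok₁ = T-∧⁻ {w ≤ᵇ v} (proj₂ ok₀)
  ok₂ = T-∧⁻ {not (v ≡ᵇ w) ∨ not o′} (proj₂ ok₁)
  not-overlined : ∀ o → T (not (v ≡ᵇ w) ∨ not o) → v ≡ w → o ≡ false
  not-overlined false _ _ = ≡.refl
  not-overlined true  t ≡.refl rewrite ≡ᵇ-refl v = ⊥-elim t

isOverpartition-complete : ∀ {ps} → Overpartition ps → T (isOverpartition ps)
isOverpartition-complete []      = tt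
isOverpartition-complete [ 1≤v ] = ℕ.≤⇒≤ᵇ 1≤v
isOverpartition-complete (cons {v} {o} {w} {o′} 1≤v w≤v first ovp) = T-∧ (ℕ.≤⇒≤ᵇ 1≤v) (T-∧ (ℕ.≤⇒≤ᵇ w≤v) (T-∧ not-overlined (isOverpartition-complete ovp)))
  where
  not-overlined : T (not (v ≡ᵇ w) ∨ not o′)
  not-overlined with v ≡ᵇ w in eq
  ... | false = tt
  ... | true rewrite first (≡ᵇ⇒≡ v w eq) = tt

overpartition-tail : ∀ {p ps} → Overpartition (p ∷ ps) → Overpartition ps
overpartition-tail [ _ ]            = []
overpartition-tail (cons _ _ _ ovp) = ovp

Above : ℕ → List Part → Set
Above m = All (λ p → m < val p)

bit : Bool → ℕ
bit false = 0
bit true  = 1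

-- In a non-increasing list the parts counted here form an initial segment, so a comparison with the
-- entry at position k - 1 becomes a bound on their number. Unlike a position, this number is
-- additive under concatenation.
near : ℕ → ℕ → List Part → ℕ
near v δ []       = 0
near v δ (x ∷ xs) = bit (v <ᵇ (val x ℕ.+ δ)) ℕ.+ near v δ xs

δ : Part → ℕ
δ p = if ovl p then 1 else 2

-- The gap condition on λⱼ and λ_{j+k-1} says that fewer than k parts from λⱼ on are too close to λⱼ.
Gap : ℕ → List Part → Set
Gap k []       = ⊤
Gap k (p ∷ ps) = near (val p) (δ p) (p ∷ ps) < k × Gap k ps

≤⇒<ᵇ≡false : ∀ {m n} → n ≤ m → (m <ᵇ n) ≡ false
≤⇒<ᵇ≡false {m} {n} n≤m with m <ᵇ n in eq
... | false = ≡.refl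
... | true  = ⊥-elim (ℕ.<⇒≱ (<ᵇ⇒< m n eq) n≤m)

near-zero : ∀ {v d p ps} → Overpartition (p ∷ ps) → val p ℕ.+ d ≤ v → near v d ps ≡ 0
near-zero [ _ ] _ = ≡.refl
near-zero {v} {d} (cons {w = w} _ w≤ _ ovp) far
  rewrite ≤⇒<ᵇ≡false {v} {w ℕ.+ d} (ℕ.≤-trans (ℕ.+-monoˡ-≤ d w≤) far) = near-zero ovp (ℕ.≤-trans (ℕ.+-monoˡ-≤ d w≤) far)

nth⇒near : ∀ {v d} ps j → Overpartition ps → (∀ r → nth ps j ≡ just r → val r ℕ.+ d ≤ v) → near v d ps ≤ j
nth⇒near []       j       ovp far = z≤n
nth⇒near {v} {d} (p ∷ ps) j ovp far with v <ᵇ (val p ℕ.+ d) in eq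
nth⇒near (p ∷ ps) j       ovp far | false = ℕ.≤-trans (ℕ.≤-reflexive (near-zero ovp (ℕ.≮⇒≥ λ v< → Bool.not-¬ eq (<⇒<ᵇ≡true v<)))) z≤n
nth⇒near (p ∷ ps) zero    ovp far | true = ⊥-elim (ℕ.<⇒≱ (<ᵇ⇒< _ _ eq) (far p ≡.refl))
nth⇒near (p ∷ ps) (suc j) ovp far | true = s≤s (nth⇒near ps j (overpartition-tail ovp) far)

near⇒nth : ∀ {v d} ps j → Overpartition ps → near v d ps ≤ j → ∀ r → nth ps j ≡ just r → val r ℕ.+ d ≤ v
near⇒nth {v} {d} (p ∷ ps) j ovp few r eqr with v <ᵇ (val p ℕ.+ d) in eq
near⇒nth (p ∷ ps) zero    ovp few r ≡.refl | false = ℕ.≮⇒≥ λ v< → Bool.not-¬ eq (<⇒<ᵇ≡true v<)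
near⇒nth (p ∷ ps) (suc j) ovp few r eqr    | false =
  near⇒nth ps j (overpartition-tail ovp) (ℕ.≤-trans (ℕ.≤-reflexive (near-zero ovp (ℕ.≮⇒≥ λ v< → Bool.not-¬ eq (<⇒<ᵇ≡true v<)))) z≤n) r eqr
near⇒nth (p ∷ ps) (suc j) ovp (s≤s few) r eqr | true = near⇒nth ps j (overpartition-tail ovp) few r eqr

gapCond⇒Gap : ∀ κ {ps} → Overpartition ps → T (gapCond (suc κ) ps) → Gap (suc κ) ps
gapCond⇒Gap κ {[]}     ovp ok = tt
gapCond⇒Gap κ {p ∷ ps} ovp ok with nth (p ∷ ps) κ in eq
... | nothing = s≤s (nth⇒near (p ∷ ps) κ ovp λ r eqr → ⊥-elim (absurd (≡.trans (≡.sym eq) eqr))) , gapCond⇒Gap κ (overpartition-tail ovp) ok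
  where
  absurd : ∀ {r : Part} → nothing ≡ just r → ⊥
  absurd ()
... | just r with T-∧⁻ {(val r ℕ.+ δ p) ≤ᵇ val p} ok
...   | far , ok′ = s≤s (nth⇒near (p ∷ ps) κ ovp λ r′ eqr → ≡.subst (λ m → maybe-far m) (≡.trans (≡.sym eq) eqr) (ℕ.≤ᵇ⇒≤ _ _ far)) , gapCond⇒Gap κ (overpartition-tail ovp) ok′
  where
  maybe-far : Maybe Part → Set
  maybe-far nothing  = ⊤
  maybe-far (just r) = val r ℕ.+ δ p ≤ val p

Gap⇒gapCond : ∀ κ {ps} → Overpartition ps → Gap (suc κ) ps → T (gapCond (suc κ) ps)
Gap⇒gapCond κ {[]}     ovp gap = tt
Gap⇒gapCond κ {p ∷ ps} ovp (s≤s few , gap) with nth (p ∷ ps) κ in eq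
... | nothing = Gap⇒gapCond κ (overpartition-tail ovp) gap
... | just r  = T-∧ (ℕ.≤⇒≤ᵇ (near⇒nth (p ∷ ps) κ ovp few r eq)) (Gap⇒gapCond κ (overpartition-tail ovp) gap)

block : ℕ → ℕ → Bool → List Part
block v f false = replicate f (v , false)
block v f true  = (v , true) ∷ replicate f (v , false)

-- The word (f₁ , o₁) (f₂ , o₂) … encodes the overpartition in which m + j occurs fⱼ times
-- non-overlined, and overlined if oⱼ.
expand : ℕ → List (ℕ × Bool) → List Part
expand m []             = []
expand m ((f , o) ∷ ws) = expand (suc m) ws ++ block (suc m) f o

nonOvl : ℕ → List Part → ℕ
nonOvl u []             = 0
nonOvl u ((v , o) ∷ ps) = bit ((v ≡ᵇ u) ∧ not o) ℕ.+ nonOvl u ps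

nonOvl-one : ∀ ps → nonOvl 1 ps ≡ nonOvlOnes ps
nonOvl-one []             = ≡.refl
nonOvl-one ((v , o) ∷ ps) with (v ≡ᵇ 1) ∧ not o
... | false = nonOvl-one ps
... | true  = ≡.cong suc (nonOvl-one ps)

near-++ : ∀ v d xs ys → near v d (xs ++ ys) ≡ near v d xs ℕ.+ near v d ys
near-++ v d []       ys = ≡.refl
near-++ v d (x ∷ xs) ys rewrite near-++ v d xs ys = ≡.sym (ℕ.+-assoc (bit (v <ᵇ (val x ℕ.+ d))) _ _)

nonOvl-++ : ∀ u xs ys → nonOvl u (xs ++ ys) ≡ nonOvl u xs ℕ.+ nonOvl u ys
nonOvl-++ u []             ys = ≡.refl
nonOvl-++ u ((v , o) ∷ xs) ys rewrite nonOvl-++ u xs ys = ≡.sym (ℕ.+-assoc (bit ((v ≡ᵇ u) ∧ not o)) _ _)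

nonOvl-replicate : ∀ v f → nonOvl v (replicate f (v , false)) ≡ f
nonOvl-replicate v zero = ≡.refl
nonOvl-replicate v (suc f) rewrite ≡ᵇ-refl v = ≡.cong suc (nonOvl-replicate v f)

nonOvl-block : ∀ v f o → nonOvl v (block v f o) ≡ f
nonOvl-block v f false = nonOvl-replicate v f
nonOvl-block v f true rewrite Bool.∧-zeroʳ (v ≡ᵇ v) = nonOvl-replicate v f

nonOvl-above : ∀ {v ps} → Above v ps → nonOvl v ps ≡ 0
nonOvl-above []                          = ≡.refl
nonOvl-above {v} {(u , o) ∷ ps} (v<u ∷ above) with u ≡ᵇ v in eq
... | false = nonOvl-above above
... | true  = ⊥-elim (ℕ.<-irrefl (≡.sym (≡ᵇ⇒≡ u v eq)) v<u)

near-replicate : ∀ u d v f → u < v ℕ.+ d → near u d (replicate f (v , false)) ≡ f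
near-replicate u d v zero    u< = ≡.refl
near-replicate u d v (suc f) u< rewrite <⇒<ᵇ≡true u< = ≡.cong suc (near-replicate u d v f u<)

near-block : ∀ u d v f o → u < v ℕ.+ d → near u d (block v f o) ≡ bit o ℕ.+ f
near-block u d v f false u< = near-replicate u d v f u<
near-block u d v f true  u< rewrite <⇒<ᵇ≡true u< = ≡.cong suc (near-replicate u d v f u<)

far-replicate : ∀ u d v f → v ℕ.+ d ≤ u → near u d (replicate f (v , false)) ≡ 0
far-replicate u d v zero    far = ≡.refl
far-replicate u d v (suc f) far rewrite ≤⇒<ᵇ≡false far = far-replicate u d v f far

far-block : ∀ u d v f o → v ℕ.+ d ≤ u → near u d (block v f o) ≡ 0
far-block u d v f false far = far-replicate u d v f far
far-block u d v f true  far rewrite ≤⇒<ᵇ≡false far = far-replicate u d v f far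

near-above : ∀ {v ps} → Above v ps → near (suc v) 2 ps ≡ length ps
near-above []                                  = ≡.refl
near-above {v} {(u , o) ∷ ps} (v<u ∷ above) rewrite <⇒<ᵇ≡true {suc v} {u ℕ.+ 2} (ℕ.≤-trans (ℕ.m≤n⇒m≤1+n (s≤s v<u)) (ℕ.≤-reflexive (ℕ.+-comm 2 u))) = ≡.cong suc (near-above above)

nonOvl-run : ∀ {v o ps} → Overpartition ((suc v , o) ∷ ps) → Above v ps → nonOvl (suc v) ps ≡ length ps
nonOvl-run [ _ ] _ = ≡.refl
nonOvl-run {v} (cons {w = w} {o′} _ w≤ first ovp) (v<w ∷ above) with ℕ.≤-antisym v<w w≤
... | ≡.refl rewrite first ≡.refl | ≡ᵇ-refl v = ≡.cong suc (nonOvl-run ovp above)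

Gap-replicate : ∀ k v f → f < k → Gap k (replicate f (v , false))
Gap-replicate k v zero    f<k = tt
Gap-replicate k v (suc f) f<k = ≡.subst (_< k) (≡.sym (near-replicate v 2 v (suc f) (ℕ.m<m+n v (s≤s z≤n)))) f<k , Gap-replicate k v f (ℕ.<⇒≤ f<k)

Gap-block : ∀ k v f o → 0 < k → (Gap k (block v f o) → bit o ℕ.+ f < k) × (bit o ℕ.+ f < k → Gap k (block v f o))
Gap-block k v zero    false 0<k = (λ _ → 0<k) , (λ _ → tt)
Gap-block k v (suc f) false 0<k = (λ { (few , _) → ≡.subst (_< k) (near-replicate v 2 v (suc f) (ℕ.m<m+n v (s≤s z≤n))) few }) , Gap-replicate k v (suc f)
Gap-block k v f true 0<k = (λ { (few , _) → ≡.subst (_< k) count few })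
                         , (λ small → ≡.subst (_< k) (≡.sym count) small , Gap-replicate k v f (ℕ.<⇒≤ small))
  where
  count : near v 1 (block v f true) ≡ suc f
  count = near-block v 1 v f true (ℕ.m<m+n v (s≤s z≤n))

-- A part v can be too close only to non-overlined parts v + 1, because an overlined part asks for a
-- difference of 1 only. Of these the first is the most demanding: it sees all of them and the whole
-- block. The resulting inequality also covers the condition inside the block.
Gap-++ : ∀ k v f o {ps} → 0 < k → Overpartition ps → Above v ps →
  (Gap k (ps ++ block v f o) → Gap k ps × nonOvl (suc v) ps ℕ.+ (bit o ℕ.+ f) < k) ×
  (Gap k ps × nonOvl (suc v) ps ℕ.+ (bit o ℕ.+ f) < k → Gap k (ps ++ block v f o))
Gap-++ k v f o {[]} 0<k ovp above = (λ gap → tt , proj₁ (Gap-block k v f o 0<k) gap) , (λ (_ , small) → proj₂ (Gap-block k v f o 0<k) small)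
Gap-++ k v f o {(u , o′) ∷ ps} 0<k ovp (v<u ∷ above) with Gap-++ k v f o 0<k (overpartition-tail ovp) above | o′ | u ℕ.≟ suc v
... | to , from | false | yes ≡.refl =
    (λ (few , gap) → (ℕ.≤-<-trans (ℕ.m≤m+n _ _) (≡.subst (_< k) (near-++ (suc v) 2 ((suc v , false) ∷ ps) (block v f o)) few) , proj₁ (to gap)) , ≡.subst (_< k) count few)
  , (λ ((few , gap) , small) → ≡.subst (_< k) (≡.sym count) small , from (gap , ℕ.<⇒≤ (≡.subst (λ b → bit (b ∧ true) ℕ.+ nonOvl (suc v) ps ℕ.+ (bit o ℕ.+ f) < k) (≡ᵇ-refl v) small)))
  where
  count : near (suc v) 2 ((suc v , false) ∷ ps ++ block v f o) ≡ nonOvl (suc v) ((suc v , false) ∷ ps) ℕ.+ (bit o ℕ.+ f)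
  count rewrite near-++ (suc v) 2 ((suc v , false) ∷ ps) (block v f o)
              | near-block (suc v) 2 v f o (ℕ.≤-reflexive (ℕ.+-comm 2 v))
              | near-above {v} {(suc v , false) ∷ ps} (ℕ.≤-refl ∷ above)
              | ≡ᵇ-refl v | nonOvl-run ovp above = ≡.refl
... | to , from | true | _ =
    (λ (few , gap) → (≡.subst (_< k) count few , proj₁ (to gap)) , ≡.subst (λ n → n ℕ.+ (bit o ℕ.+ f) < k) (≡.sym skip) (proj₂ (to gap)))
  , (λ ((few , gap) , small) → ≡.subst (_< k) (≡.sym count) few , from (gap , ≡.subst (λ n → n ℕ.+ (bit o ℕ.+ f) < k) skip small))
  where
  count : near u 1 ((u , true) ∷ ps ++ block v f o) ≡ near u 1 ((u , true) ∷ ps)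
  count rewrite near-++ u 1 ((u , true) ∷ ps) (block v f o) | far-block u 1 v f o (ℕ.≤-trans (ℕ.≤-reflexive (ℕ.+-comm v 1)) v<u) = ℕ.+-identityʳ _
  skip : nonOvl (suc v) ((u , true) ∷ ps) ≡ nonOvl (suc v) ps
  skip rewrite Bool.∧-zeroʳ (u ≡ᵇ suc v) = ≡.refl
... | to , from | false | no u≢ =
    (λ (few , gap) → (≡.subst (_< k) count few , proj₁ (to gap)) , ≡.subst (λ n → n ℕ.+ (bit o ℕ.+ f) < k) (≡.sym skip) (proj₂ (to gap)))
  , (λ ((few , gap) , small) → ≡.subst (_< k) (≡.sym count) few , from (gap , ≡.subst (λ n → n ℕ.+ (bit o ℕ.+ f) < k) skip small))
  where
  count : near u 2 ((u , false) ∷ ps ++ block v f o) ≡ near u 2 ((u , false) ∷ ps)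
  count rewrite near-++ u 2 ((u , false) ∷ ps) (block v f o) | far-block u 2 v f o (ℕ.≤-trans (ℕ.≤-reflexive (ℕ.+-comm v 2)) (ℕ.≤∧≢⇒< v<u (u≢ ∘ ≡.sym))) = ℕ.+-identityʳ _
  skip : nonOvl (suc v) ((u , false) ∷ ps) ≡ nonOvl (suc v) ps
  skip with u ≡ᵇ suc v in eq
  ... | false = ≡.refl
  ... | true  = ⊥-elim (u≢ (≡ᵇ⇒≡ u (suc v) eq))

weaken-above : ∀ {m ps} → Above (suc m) ps → Above m ps
weaken-above = All.map ℕ.<⇒≤

block-above : ∀ m f o → Above m (block (suc m) f o)
block-above m f false = All.replicate⁺ f (ℕ.≤-refl {suc m})
block-above m f true  = ℕ.≤-refl ∷ All.replicate⁺ f (ℕ.≤-refl {suc m})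

expand-above : ∀ m ws → Above m (expand m ws)
expand-above m []             = []
expand-above m ((f , o) ∷ ws) = All.++⁺ (weaken-above (expand-above (suc m) ws)) (block-above m f o)

replicate-overpartition : ∀ v f → Overpartition (replicate f (suc v , false))
replicate-overpartition v zero          = []
replicate-overpartition v (suc zero)    = [ s≤s z≤n ]
replicate-overpartition v (suc (suc f)) = cons (s≤s z≤n) ℕ.≤-refl (λ _ → ≡.refl) (replicate-overpartition v (suc f))

block-overpartition : ∀ v f o → Overpartition (block (suc v) f o)
block-overpartition v f       false = replicate-overpartition v f
block-overpartition v zero    true  = [ s≤s z≤n ]
block-overpartition v (suc f) true  = cons (s≤s z≤n) ℕ.≤-refl (λ _ → ≡.refl) (replicate-overpartition v (suc f))

++-overpartition : ∀ v f o {ps} → Overpartition ps → Above (suc v) ps → Overpartition (ps ++ block (suc v) f o)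
++-overpartition v f o [] above = block-overpartition v f o
++-overpartition v f o (cons 1≤ w≤ first ovp) (_ ∷ above) = cons 1≤ w≤ first (++-overpartition v f o ovp above)
++-overpartition v zero    false [ 1≤u ] above         = [ 1≤u ]
++-overpartition v (suc f) false [ 1≤u ] (v<u ∷ above) = cons 1≤u (ℕ.<⇒≤ v<u) (λ _ → ≡.refl) (replicate-overpartition v (suc f))
++-overpartition v f       true  [ 1≤u ] (v<u ∷ above) = cons 1≤u (ℕ.<⇒≤ v<u) (λ u≡ → ⊥-elim (ℕ.<-irrefl (≡.sym u≡) v<u)) (block-overpartition v f true)

expand-overpartition : ∀ m ws → Overpartition (expand m ws)
expand-overpartition m []             = []
expand-overpartition m ((f , o) ∷ ws) = ++-overpartition m f o (expand-overpartition (suc m) ws) (expand-above (suc m) ws)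

-- After a block of `bit o + f` parts, `Gap-++` leaves the bound k - (bit o + f) for the
-- non-overlined multiplicity of the next value. Asking for 0 < i at the end of the word rejects a
-- last block with k or more parts.
Admissible : ℕ → ℕ → List (ℕ × Bool) → Set
Admissible k i []             = 0 < i
Admissible k i ((f , o) ∷ ws) = f < i × Admissible k (k ℕ.∸ (bit o ℕ.+ f)) ws

nonOvl-expand : ∀ m f o ws → nonOvl (suc m) (expand m ((f , o) ∷ ws)) ≡ f
nonOvl-expand m f o ws rewrite nonOvl-++ (suc m) (expand (suc m) ws) (block (suc m) f o) | nonOvl-above (expand-above (suc m) ws) = nonOvl-block (suc m) f o

m+n<o⇒m<o∸n : ∀ m n {o} → m ℕ.+ n < o → m < o ℕ.∸ n
m+n<o⇒m<o∸n m n lt = ℕ.m+n≤o⇒m≤o∸n (suc m) lt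

m<o∸n⇒m+n<o : ∀ m n {o} → m < o ℕ.∸ n → m ℕ.+ n < o
m<o∸n⇒m+n<o m n {o} lt = ℕ.≤-trans (ℕ.+-monoˡ-≤ n lt) (ℕ.≤-reflexive (ℕ.m∸n+n≡m (ℕ.<⇒≤ (ℕ.m∸n≢0⇒n<m {o} {n} λ eq → ℕ.n≮0 (≡.subst (m <_) eq lt)))))

admissible⇒gap : ∀ {k} i m ws → 0 < k → Admissible k i ws → nonOvl (suc m) (expand m ws) < i × Gap k (expand m ws)
admissible⇒gap i m [] 0<k adm = adm , tt
admissible⇒gap {k} i m ((f , o) ∷ ws) 0<k (f<i , adm) with admissible⇒gap _ (suc m) ws 0<k adm
... | few , gap = ≡.subst (_< i) (≡.sym (nonOvl-expand m f o ws)) f<i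
                , proj₂ (Gap-++ k (suc m) f o 0<k (expand-overpartition (suc m) ws) (expand-above (suc m) ws)) (gap , m<o∸n⇒m+n<o _ (bit o ℕ.+ f) few)

gap⇒admissible : ∀ {k} i m ws → 0 < k → nonOvl (suc m) (expand m ws) < i → Gap k (expand m ws) → Admissible k i ws
gap⇒admissible i m [] 0<k few gap = few
gap⇒admissible {k} i m ((f , o) ∷ ws) 0<k few gap
  with proj₁ (Gap-++ k (suc m) f o 0<k (expand-overpartition (suc m) ws) (expand-above (suc m) ws)) gap
... | gap′ , small = ≡.subst (_< i) (nonOvl-expand m f o ws) few , gap⇒admissible _ (suc m) ws 0<k (m+n<o⇒m<o∸n _ (bit o ℕ.+ f) small) gap′

-- Since only the first occurrence of m + 1 may be overlined, the final run of parts m + 1 has the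
-- shape of a `block`. Each part in front of it either prolongs this run or belongs to the
-- remainder.
split : ∀ m {ps} → Overpartition ps → Above m ps → ∃[ ps′ ] ∃[ f ] ∃[ o ] ps ≡ ps′ ++ block (suc m) f o × Overpartition ps′ × Above (suc m) ps′
split m [] above = [] , 0 , false , ≡.refl , [] , []
split m {(u , o) ∷ ps} ovp (m<u ∷ above) with split m (overpartition-tail ovp) above
... | ((w , o′) ∷ qs) , f , o″ , ≡.refl , ovp′ , w> ∷ above′ = (u , o) ∷ (w , o′) ∷ qs , f , o″ , ≡.refl , extend ovp , ℕ.<-≤-trans w> (head≥ ovp) ∷ w> ∷ above′
  where
  extend : Overpartition ((u , o) ∷ (w , o′) ∷ qs ++ block (suc m) f o″) → Overpartition ((u , o) ∷ (w , o′) ∷ qs)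
  extend (cons 1≤ w≤ first _) = cons 1≤ w≤ first ovp′
  head≥ : Overpartition ((u , o) ∷ (w , o′) ∷ qs ++ block (suc m) f o″) → w ≤ u
  head≥ (cons _ w≤ _ _) = w≤
... | [] , f , o′ , ≡.refl , _ , _ with ℕ.m≤n⇒m<n∨m≡n m<u
...   | inj₁ u> = (u , o) ∷ [] , f , o′ , ≡.refl , [ ℕ.≤-trans (s≤s z≤n) u> ] , u> ∷ []
...   | inj₂ ≡.refl = run o f o′ ovp
  where
  run : ∀ o f o′ → Overpartition ((suc m , o) ∷ block (suc m) f o′) →
        ∃[ ps′ ] ∃[ g ] ∃[ o″ ] (suc m , o) ∷ block (suc m) f o′ ≡ ps′ ++ block (suc m) g o″ × Overpartition ps′ × Above (suc m) ps′
  run false f false _ = [] , suc f , false , ≡.refl , [] , []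
  run true  f false _ = [] , f , true , ≡.refl , [] , []
  run o     f true (cons _ _ first _) with first ≡.refl
  ... | ()

Below : ℕ → List Part → Set
Below m = All (λ p → val p ≤ m)

collapse : ∀ d m {ps} → Overpartition ps → Above m ps → Below (m ℕ.+ d) ps → ∃[ ws ] length ws ≡ d × expand m ws ≡ ps
collapse zero    m {[]} ovp above below = [] , ≡.refl , ≡.refl
collapse zero    m {_ ∷ _} ovp (m<u ∷ _) (u≤m ∷ _) = ⊥-elim (ℕ.<⇒≱ m<u (ℕ.≤-trans u≤m (ℕ.≤-reflexive (ℕ.+-identityʳ m))))
collapse (suc d) m ovp above below with split m ovp above
... | ps′ , f , o , ≡.refl , ovp′ , above′ with collapse d (suc m) ovp′ above′ (≡.subst (λ b → Below b ps′) (ℕ.+-suc m d) (All.++⁻ˡ ps′ below))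
...   | ws , len , ≡.refl = (f , o) ∷ ws , ≡.cong suc len , ≡.refl

-- Equal lengths have to be required because trailing letters (0 , false) expand to nothing. Each
-- multiplicity is read off by `nonOvl`; if two marks differed, cancelling the common run would
-- leave a part m + 1 in a list of larger parts.
expand-injective : ∀ m ws ws′ → length ws ≡ length ws′ → expand m ws ≡ expand m ws′ → ws ≡ ws′
expand-injective m []             []               _   _  = ≡.refl
expand-injective m ((f , o) ∷ ws) ((f′ , o′) ∷ ws′) len eq
  with ≡.trans (≡.sym (nonOvl-expand m f o ws)) (≡.trans (≡.cong (nonOvl (suc m)) eq) (nonOvl-expand m f′ o′ ws′))
... | ≡.refl = same o o′ eq
  where
  A A′ r : List Part
  A = expand (suc m) ws
  A′ = expand (suc m) ws′
  r = replicate f (suc m , false)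
  overlined : ∀ {B B′} → Above (suc m) B′ → B ++ (suc m , true) ∷ r ≡ B′ ++ r → ⊥
  overlined {B} {B′} above eq with All.++⁻ʳ B (≡.subst (Above (suc m)) (≡.sym (List.++-cancelʳ r (B ++ (suc m , true) ∷ []) B′ (≡.trans (List.++-assoc B _ r) eq))) above)
  ... | lt ∷ [] = ℕ.<-irrefl ≡.refl lt
  same : ∀ o o′ → A ++ block (suc m) f o ≡ A′ ++ block (suc m) f o′ → (f , o) ∷ ws ≡ (f , o′) ∷ ws′
  same false false eq = ≡.cong ((f , false) ∷_) (expand-injective (suc m) ws ws′ (ℕ.suc-injective len) (List.++-cancelʳ r A A′ eq))
  same true  true  eq = ≡.cong ((f , true) ∷_) (expand-injective (suc m) ws ws′ (ℕ.suc-injective len) (List.++-cancelʳ _ A A′ eq))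
  same true  false eq = ⊥-elim (overlined (expand-above (suc m) ws′) eq)
  same false true  eq = ⊥-elim (overlined (expand-above (suc m) ws) (≡.sym eq))

wordWeight : ℕ → List (ℕ × Bool) → ℕ
wordWeight m []             = 0
wordWeight m ((f , o) ∷ ws) = suc m ℕ.* (bit o ℕ.+ f) ℕ.+ wordWeight (suc m) ws

weight-++ : ∀ xs ys → weight (xs ++ ys) ≡ weight xs ℕ.+ weight ys
weight-++ []       ys = ≡.refl
weight-++ (x ∷ xs) ys rewrite weight-++ xs ys = ≡.sym (ℕ.+-assoc (val x) _ _)

weight-replicate : ∀ v f → weight (replicate f (v , false)) ≡ v ℕ.* f
weight-replicate v zero    = ≡.sym (ℕ.*-zeroʳ v)
weight-replicate v (suc f) rewrite weight-replicate v f = ≡.sym (ℕ.*-suc v f)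

weight-block : ∀ v f o → weight (block v f o) ≡ v ℕ.* (bit o ℕ.+ f)
weight-block v f false = weight-replicate v f
weight-block v f true rewrite weight-replicate v f = ≡.sym (ℕ.*-suc v f)

weight-expand : ∀ m ws → weight (expand m ws) ≡ wordWeight m ws
weight-expand m []             = ≡.refl
weight-expand m ((f , o) ∷ ws) rewrite weight-++ (expand (suc m) ws) (block (suc m) f o) | weight-block (suc m) f o | weight-expand (suc m) ws = ℕ.+-comm (wordWeight (suc m) ws) _

val≤weight : ∀ ps → Below (weight ps) ps
val≤weight []       = []
val≤weight (p ∷ ps) = ℕ.m≤m+n _ _ ∷ All.map (λ le → ℕ.≤-trans le (ℕ.m≤n+m _ (val p))) (val≤weight ps)

overpartition-above : ∀ {ps} → Overpartition ps → Above 0 ps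
overpartition-above []                 = []
overpartition-above [ 1≤v ]            = 1≤v ∷ []
overpartition-above (cons 1≤v _ _ ovp) = 1≤v ∷ overpartition-above ovp

bressoud-expand : ∀ {κ a ws} → Admissible (suc κ) a ws → T (BressoudOvp (suc κ) a (expand 0 ws))
bressoud-expand {κ} {a} {ws} adm with admissible⇒gap a 0 ws (s≤s z≤n) adm
... | few , gap = T-∧ (isOverpartition-complete (expand-overpartition 0 ws))
                      (T-∧ (ℕ.<⇒<ᵇ (≡.subst (_< a) (nonOvl-one (expand 0 ws)) few)) (Gap⇒gapCond κ (expand-overpartition 0 ws) gap))

bressoud-collapse : ∀ {κ a ps n} → T (BressoudOvp (suc κ) a ps) → weight ps ≤ n → ∃[ ws ] length ws ≡ n × Admissible (suc κ) a ws × expand 0 ws ≡ ps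
bressoud-collapse {κ} {a} {ps} {n} ok ≤n with T-∧⁻ {isOverpartition ps} ok
... | isOvp , ok₁ with T-∧⁻ {nonOvlOnes ps <ᵇ a} ok₁ | overpartition ps isOvp
...   | few , gap | ovp with collapse n 0 ovp (overpartition-above ovp) (All.map (λ le → ℕ.≤-trans le ≤n) (val≤weight ps))
...     | ws , len , ≡.refl = ws , len , gap⇒admissible a 0 ws (s≤s z≤n) (≡.subst (_< a) (≡.sym (nonOvl-one ps)) (ℕ.<ᵇ⇒< (nonOvlOnes ps) a few)) (gapCond⇒Gap κ ovp gap) , ≡.refl

letters : ℕ → List (ℕ × Bool)
letters k = cartesianProduct (upTo k) (false ∷ true ∷ [])

admissible : ℕ → ℕ → List (ℕ × Bool) → Bool
admissible k i []             = 0 <ᵇ i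
admissible k i ((f , o) ∷ ws) = (f <ᵇ i) ∧ admissible k (k ℕ.∸ (bit o ℕ.+ f)) ws

admissible⇒Admissible : ∀ {k} i ws → T (admissible k i ws) → Admissible k i ws
admissible⇒Admissible i []             ok = ℕ.<ᵇ⇒< 0 i ok
admissible⇒Admissible i ((f , o) ∷ ws) ok = ℕ.<ᵇ⇒< f i (proj₁ (T-∧⁻ {f <ᵇ i} ok)) , admissible⇒Admissible _ ws (proj₂ (T-∧⁻ {f <ᵇ i} ok))

Admissible⇒admissible : ∀ {k} i ws → Admissible k i ws → T (admissible k i ws)
Admissible⇒admissible i []             0<i         = ℕ.<⇒<ᵇ 0<i
Admissible⇒admissible i ((f , o) ∷ ws) (f<i , adm) = T-∧ (ℕ.<⇒<ᵇ f<i) (Admissible⇒admissible _ ws adm)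

module FrequencySeries (R : CommutativeRing 0ℓ 0ℓ) (L : ℕ) (q : CommutativeRing.Carrier R)
                       (q^L≈0 : CommutativeRing._≈_ R (Powers._^_ R q L) (CommutativeRing.0# R))
                       (½ : CommutativeRing.Carrier R)
                       (½+½≈1 : CommutativeRing._≈_ R (CommutativeRing._+_ R ½ ½) (CommutativeRing.1# R))
                       {K : ℕ} (L≤K : L ≤ K) (0<K : 0 < K) (κ : ℕ) where
  open CommutativeRing R hiding (zero)
  open SetoidReasoning setoid
  open IntegerCoefficients R
  open Sums R
  open Powers R
  open OverpartitionSeries R L q q^L≈0 ½ ½+½≈1 using (b; b-theta)
  open WeightedSum R L q q^L≈0 ½ ½+½≈1 using (P; Θ)
  open WordSeries R q (letters (suc κ))

  private
    k = suc κ
    B = b L≤K 0<K κ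

  -- For each multiplicity f the two marks give the two summands of `b`, the overlined part adding a
  -- factor q^(m+1). Multiplicities f ≥ i are inadmissible, which cuts the k values in the alphabet
  -- down to the i terms of `b`.
  frequency-series : ∀ d m i → i ≤ k → gf d (λ ws → (length ws ≡ᵇ d) ∧ admissible k i ws) (wordWeight m) ≈ B d m i
  frequency-series zero    m zero    _   = refl
  frequency-series zero    m (suc i) _   = refl
  frequency-series (suc d) m i       i≤k = begin
    0# + sum (map h (letters k)) ≈⟨ +-identityˡ _ ⟩
    sum (map h (letters k)) ≈⟨ sum-cartesianProductWith h _,_ (upTo k) (false ∷ true ∷ []) ⟩
    sum (map (λ f → h (f , false) + (h (f , true) + 0#)) (upTo k)) ≈⟨ sum-applyUpTo _ (λ f → f) k ⟩
    ∑ k (λ f → h (f , false) + (h (f , true) + 0#)) ≈⟨ ∑-truncate _ i≤k (λ f i≤f → trans (+-cong (vanish false i≤f) (+-congʳ (vanish true i≤f))) (solve 0 (:0 :+ (:0 :+ :0) := :0) refl)) ⟩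
    ∑ i (λ f → h (f , false) + (h (f , true) + 0#)) ≈⟨ ∑-cong< i (λ f f<i → term f f<i) ⟩
    B (suc d) m i ∎
    where
    h : ℕ × Bool → Carrier
    h a = gf d (λ ws → (length ws ≡ᵇ d) ∧ admissible k i (a ∷ ws)) (λ ws → wordWeight m (a ∷ ws))
    vanish : ∀ {f} o → i ≤ f → h (f , o) ≈ 0#
    vanish {f} o i≤f = gf-false d λ ws → ≡.trans (≡.cong (λ c → (length ws ≡ᵇ d) ∧ c ∧ admissible k (k ℕ.∸ (bit o ℕ.+ f)) ws) (≤⇒<ᵇ≡false i≤f)) (Bool.∧-zeroʳ _)
    value : ∀ {f} o → f < i → h (f , o) ≈ q ^ (suc m ℕ.* (bit o ℕ.+ f)) * B d (suc m) (k ℕ.∸ (bit o ℕ.+ f))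
    value {f} o f<i = begin
      h (f , o) ≈⟨ gf-cong d (λ ws → ≡.cong (λ c → (length ws ≡ᵇ d) ∧ c ∧ admissible k (k ℕ.∸ (bit o ℕ.+ f)) ws) (<⇒<ᵇ≡true f<i)) (λ _ _ → ≡.refl) ⟩
      gf d (λ ws → (length ws ≡ᵇ d) ∧ admissible k (k ℕ.∸ (bit o ℕ.+ f)) ws) (λ ws → suc m ℕ.* (bit o ℕ.+ f) ℕ.+ wordWeight (suc m) ws)
                                                              ≈⟨ gf-scale d _ _ (wordWeight (suc m)) ⟩
      _ ≈⟨ *-congˡ (frequency-series d (suc m) _ (ℕ.m∸n≤m k (bit o ℕ.+ f))) ⟩
      q ^ (suc m ℕ.* (bit o ℕ.+ f)) * B d (suc m) (k ℕ.∸ (bit o ℕ.+ f)) ∎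
    term : ∀ f → f < i → h (f , false) + (h (f , true) + 0#) ≈ q ^ (suc m ℕ.* f) * (B d (suc m) (k ℕ.∸ f) + q ^ suc m * B d (suc m) (k ℕ.∸ suc f))
    term f f<i = begin
      h (f , false) + (h (f , true) + 0#) ≈⟨ +-cong (value false f<i) (+-congʳ (value true f<i)) ⟩
      q ^ (suc m ℕ.* f) * x + (q ^ (suc m ℕ.* suc f) * y + 0#) ≈⟨ +-congˡ (+-congʳ (*-congʳ (^-split q (suc m) (suc m ℕ.* f) (ℕ.*-suc (suc m) f)))) ⟩
      q ^ (suc m ℕ.* f) * x + (q ^ suc m * q ^ (suc m ℕ.* f) * y + 0#) ≈⟨ solve 4 (λ A B x y → A :* x :+ (B :* A :* y :+ :0) := A :* (x :+ B :* y)) refl _ _ _ _ ⟩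
      q ^ (suc m ℕ.* f) * (x + q ^ suc m * y) ∎
      where
      x = B d (suc m) (k ℕ.∸ f)
      y = B d (suc m) (k ℕ.∸ suc f)

  overpartition-total : ∀ {d a h} → a ℕ.+ h ≡ k → L ≤ d → gf d (λ ws → (length ws ≡ᵇ d) ∧ admissible k a ws) (wordWeight 0) ≈ P * Θ L≤K k h a
  overpartition-total {d} {a} {h} eq L≤d =
    trans (frequency-series d 0 a (ℕ.≤-trans (ℕ.m≤m+n a h) (ℕ.≤-reflexive eq))) (b-theta L≤K 0<K κ {d} {a} {h} eq L≤d)

-- The summands and the product of the statement in closed notation.

Nix-suc : ∀ M Ms i → Nix (M ∷ Ms) (suc (suc i)) ≡ Nix Ms (suc i)
Nix-suc M Ms i with nth Ms i
... | just _  = ≡.refl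
... | nothing = ≡.refl

sumFrom : ℕ → ℕ → (ℕ → ℕ) → ℕ
sumFrom lo zero    g = 0
sumFrom lo (suc m) g = sumFrom lo m g ℕ.+ g (lo ℕ.+ m)

mutual
  sumNat≡sumFrom : ∀ lo hi g → sumNat lo hi g ≡ sumFrom lo (suc hi ℕ.∸ lo) g
  sumNat≡sumFrom lo hi g with suc hi ℕ.∸ lo
  ... | m = go≡sumFrom lo hi g m

  -- The left-hand side is the local function of sumNat, found by unification.
  go≡sumFrom : ∀ lo hi g m → _ ≡ sumFrom lo m g
  go≡sumFrom lo hi g zero    = ≡.refl
  go≡sumFrom lo hi g (suc m) = ≡.cong (ℕ._+ g (lo ℕ.+ m)) (go≡sumFrom lo hi g m)

sumFrom-head : ∀ lo m g → sumFrom lo (suc m) g ≡ g lo ℕ.+ sumFrom (suc lo) m g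
sumFrom-head lo zero    g = ≡.trans (≡.cong g (ℕ.+-identityʳ lo)) (≡.sym (ℕ.+-identityʳ (g lo)))
sumFrom-head lo (suc m) g = ≡.trans (≡.cong₂ ℕ._+_ (sumFrom-head lo m g) (≡.cong g (ℕ.+-suc lo m))) (ℕ.+-assoc (g lo) _ _)

sumFrom-cong : ∀ lo lo′ m {g g′} → (∀ j → g (lo ℕ.+ j) ≡ g′ (lo′ ℕ.+ j)) → sumFrom lo m g ≡ sumFrom lo′ m g′
sumFrom-cong lo lo′ zero    eq = ≡.refl
sumFrom-cong lo lo′ (suc m) eq = ≡.cong₂ ℕ._+_ (sumFrom-cong lo lo′ m eq) (eq m)

sumOf : (ℕ → ℕ) → List ℕ → ℕ
sumOf h []       = 0
sumOf h (M ∷ Ms) = h M ℕ.+ sumOf h Ms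

sumFrom-Nix : ∀ h Ms → sumFrom 1 (length Ms) (λ i → h (Nix Ms i)) ≡ sumOf h Ms
sumFrom-Nix h []       = ≡.refl
sumFrom-Nix h (M ∷ Ms) = ≡.trans (sumFrom-head 1 (length Ms) (λ i → h (Nix (M ∷ Ms) i)))
  (≡.cong (h M ℕ.+_) (≡.trans (sumFrom-cong 2 1 (length Ms) (λ j → ≡.cong h (Nix-suc M Ms j))) (sumFrom-Nix h Ms)))

-- On (N₂, ..., N_{k-1}) this is N_{s+2} + ... + N_{k-1}, the linear exponent belonging to a = s +
-- 1.
linear : ℕ → List ℕ → ℕ
linear zero    Ms       = sumOf (λ M → M) Ms
linear (suc s) []       = 0
linear (suc s) (M ∷ Ms) = linear s Ms

sumFrom-linear : ∀ s Ms → sumFrom (suc s) (length Ms ℕ.∸ s) (Nix Ms) ≡ linear s Ms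
sumFrom-linear zero    Ms       = sumFrom-Nix (λ M → M) Ms
sumFrom-linear (suc s) []       = ≡.refl
sumFrom-linear (suc s) (M ∷ Ms) = ≡.trans (sumFrom-cong (suc (suc s)) (suc s) (length Ms ℕ.∸ s) (λ j → Nix-suc M Ms (s ℕ.+ j))) (sumFrom-linear s Ms)

linear-step : ∀ s Ms → linear s Ms ≡ Nix Ms (suc s) ℕ.+ linear (suc s) Ms
linear-step zero    []       = ≡.refl
linear-step zero    (M ∷ Ms) = ≡.refl
linear-step (suc s) []       = ≡.refl
linear-step (suc s) (M ∷ Ms) = ≡.trans (linear-step s Ms) (≡.cong (ℕ._+ linear (suc s) Ms) (≡.sym (Nix-suc M Ms s)))

exponent : ℕ → List ℕ → ℕ
exponent s Ms = sumOf (λ M → M ℕ.* M) Ms ℕ.+ linear s Ms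

triangle-/2 : ∀ n → suc n ℕ.* n / 2 ≡ triangle (suc n)
triangle-/2 n = ≡.trans (≡.cong (_/ 2) (≡.sym (≡.trans (rearrange (triangle n) n) (≡.trans (≡.cong (ℕ._+ n) (triangle-square n)) (square n))))) (m*n/n≡m (triangle (suc n)) 2)
  where
  rearrange : ∀ t n → (t ℕ.+ n) ℕ.* 2 ≡ t ℕ.+ t ℕ.+ n ℕ.+ n
  rearrange = solve-∀
  square : ∀ n → n ℕ.* n ℕ.+ n ≡ suc n ℕ.* n
  square = solve-∀

expo-exponent : ∀ a N Ms → expo (suc (suc (length Ms))) (suc a) (N ∷ Ms) ≡ triangle (suc N) ℕ.+ exponent a Ms
expo-exponent a N Ms = ≡.trans (≡.cong₂ ℕ._+_ (≡.cong₂ ℕ._+_ (triangle-/2 N) squares) linears) (ℕ.+-assoc (triangle (suc N)) _ _)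
  where
  l = length Ms
  squares : sumNat 2 (suc l) (λ i → Nix (N ∷ Ms) i ℕ.* Nix (N ∷ Ms) i) ≡ sumOf (λ M → M ℕ.* M) Ms
  squares = ≡.trans (sumNat≡sumFrom 2 (suc l) (λ i → Nix (N ∷ Ms) i ℕ.* Nix (N ∷ Ms) i))
    (≡.trans (sumFrom-cong 2 1 l (λ j → ≡.cong (λ M → M ℕ.* M) (Nix-suc N Ms j))) (sumFrom-Nix (λ M → M ℕ.* M) Ms))
  linears : sumNat (suc (suc a)) (suc l) (Nix (N ∷ Ms)) ≡ linear a Ms
  linears = ≡.trans (sumNat≡sumFrom (suc (suc a)) (suc l) (Nix (N ∷ Ms)))
    (≡.trans (sumFrom-cong (suc (suc a)) (suc a) (l ℕ.∸ a) (λ j → Nix-suc N Ms (a ℕ.+ j))) (sumFrom-linear a Ms))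

tuples-length : ∀ l b → All (λ Ns → length Ns ≡ l) (tuples l b)
tuples-length zero    b = ≡.refl ∷ []
tuples-length (suc l) b = All.concat⁺ (All.map⁺ {f = λ x → map (x ∷_) (tuples l x)} (All.universal extend (upTo (suc b))))
  where
  extend : ∀ x → All (λ Ns → length Ns ≡ suc l) (map (x ∷_) (tuples l x))
  extend x = All.map⁺ {f = x ∷_} (All.map (≡.cong suc) (tuples-length l x))

module Summands (R : CommutativeRing 0ℓ 0ℓ) (L : ℕ) (q : CommutativeRing.Carrier R)
                (q^L≈0 : CommutativeRing._≈_ R (Powers._^_ R q L) (CommutativeRing.0# R))
                (½ : CommutativeRing.Carrier R)
                (½+½≈1 : CommutativeRing._≈_ R (CommutativeRing._+_ R ½ ½) (CommutativeRing.1# R)) where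
  open CommutativeRing R hiding (zero)
  open SetoidReasoning setoid
  open IntegerCoefficients R
  open Sums R
  open Powers R
  open Pochhammer R L q q^L≈0
  open WeightedSum R L q q^L≈0 ½ ½+½≈1

  inverseDenominator : ℕ → List ℕ → Carrier
  inverseDenominator N []       = 1/⟨p⟩ N
  inverseDenominator N (M ∷ Ms) = 1/⟨p⟩ (N ℕ.∸ M) * inverseDenominator M Ms

  denominator-inverse : ∀ N Ms → ∏ (suc (length Ms)) (λ j → ⟨p⟩ (Nix (N ∷ Ms) (suc j) ℕ.∸ Nix (N ∷ Ms) (suc (suc j)))) * inverseDenominator N Ms ≈ 1#
  denominator-inverse N []       = trans (*-congʳ (*-identityˡ _)) (⟨p⟩-inverse N)
  denominator-inverse N (M ∷ Ms) = begin
    ∏ (suc (suc (length Ms))) f * (1/⟨p⟩ (N ℕ.∸ M) * inverseDenominator M Ms)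
      ≈⟨ *-congʳ (trans (∏-head (suc (length Ms)) f) (*-congˡ (∏-cong (suc (length Ms)) (λ j → reflexive (≡.cong ⟨p⟩ (≡.cong₂ ℕ._∸_ (Nix-suc N (M ∷ Ms) j) (Nix-suc N (M ∷ Ms) (suc j)))))))) ⟩
    ⟨p⟩ (N ℕ.∸ M) * ∏ (suc (length Ms)) _ * (1/⟨p⟩ (N ℕ.∸ M) * inverseDenominator M Ms)
      ≈⟨ solve 4 (λ a b c d → a :* b :* (c :* d) := a :* c :* (b :* d)) refl _ _ _ _ ⟩
    ⟨p⟩ (N ℕ.∸ M) * 1/⟨p⟩ (N ℕ.∸ M) * (∏ (suc (length Ms)) _ * inverseDenominator M Ms)
      ≈⟨ *-cong (⟨p⟩-inverse (N ℕ.∸ M)) (denominator-inverse M Ms) ⟩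
    1# * 1#
      ≈⟨ *-identityˡ 1# ⟩
    1# ∎
    where
    f = λ j → ⟨p⟩ (Nix (N ∷ M ∷ Ms) (suc j) ℕ.∸ Nix (N ∷ M ∷ Ms) (suc (suc j)))

  sum-cong-All : ∀ {A : Set} {Q : A → Set} {f g : A → Carrier} {xs} → All Q xs → (∀ x → Q x → f x ≈ g x) → sum (map f xs) ≈ sum (map g xs)
  sum-cong-All []       eq = refl
  sum-cong-All (q ∷ qs) eq = +-cong (eq _ q) (sum-cong-All qs eq)

  sum-+ : ∀ {A : Set} (f g : A → Carrier) xs → sum (map (λ x → f x + g x) xs) ≈ sum (map f xs) + sum (map g xs)
  sum-+ f g []       = sym (+-identityˡ 0#)
  sum-+ f g (x ∷ xs) = trans (+-congˡ (sum-+ f g xs)) (solve 4 (λ a b c d → (a :+ b) :+ (c :+ d) := (a :+ c) :+ (b :+ d)) refl _ _ _ _)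

  module _ {K : ℕ} (L≤K : L ≤ K) (0<K : 0 < K) where
    open MultipleSum R L q q^L≈0 ½ ½+½≈1 L≤K 0<K

    y⁻ : ℕ → ℕ → List ℕ → Carrier
    y⁻ zero    N Ms = q ^ N * y 0 N Ms
    y⁻ (suc s) N Ms = y s N Ms

    y-closed : ∀ s N Ms → y s N Ms ≈ q ^ exponent s Ms * inverseDenominator N Ms
    y-closed zero    N []       = sym (*-identityˡ _)
    y-closed (suc s) N []       = sym (*-identityˡ _)
    y-closed zero    N (M ∷ Ms) = begin
      q ^ (M ℕ.* M) * 1/⟨p⟩ (N ℕ.∸ M) * (q ^ M * y zero M Ms) ≈⟨ *-congˡ (*-congˡ (y-closed zero M Ms)) ⟩
      q ^ (M ℕ.* M) * 1/⟨p⟩ (N ℕ.∸ M) * (q ^ M * (q ^ exponent 0 Ms * inverseDenominator M Ms))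
                                                                                   ≈⟨ solve 5 (λ a b c d e → a :* b :* (c :* (d :* e)) := (a :* c) :* d :* (b :* e)) refl _ _ _ _ _ ⟩
      q ^ (M ℕ.* M) * q ^ M * q ^ exponent 0 Ms * inverseDenominator N (M ∷ Ms) ≈⟨ *-congʳ (trans (^-split q (M ℕ.* M ℕ.+ M) (exponent 0 Ms) (rearrange (M ℕ.* M) (sumOf (λ M → M ℕ.* M) Ms) M _)) (*-congʳ (^-homo-* q (M ℕ.* M) M))) ⟨
      q ^ exponent 0 (M ∷ Ms) * inverseDenominator N (M ∷ Ms) ∎
      where
      rearrange : ∀ a b c d → (a ℕ.+ b) ℕ.+ (c ℕ.+ d) ≡ a ℕ.+ c ℕ.+ (b ℕ.+ d)
      rearrange = solve-∀
    y-closed (suc s) N (M ∷ Ms) = begin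
      q ^ (M ℕ.* M) * 1/⟨p⟩ (N ℕ.∸ M) * y s M Ms ≈⟨ *-congˡ (y-closed s M Ms) ⟩
      q ^ (M ℕ.* M) * 1/⟨p⟩ (N ℕ.∸ M) * (q ^ exponent s Ms * inverseDenominator M Ms)
                                                                                   ≈⟨ solve 4 (λ a b c d → a :* b :* (c :* d) := a :* c :* (b :* d)) refl _ _ _ _ ⟩
      q ^ (M ℕ.* M) * q ^ exponent s Ms * inverseDenominator N (M ∷ Ms) ≈⟨ *-congʳ (^-split q (M ℕ.* M) (exponent s Ms) (ℕ.+-assoc (M ℕ.* M) _ _)) ⟨
      q ^ exponent (suc s) (M ∷ Ms) * inverseDenominator N (M ∷ Ms) ∎

    y⁻-closed : ∀ a N Ms → y⁻ a N Ms ≈ q ^ Nix (N ∷ Ms) (suc a) * (q ^ exponent a Ms * inverseDenominator N Ms)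
    y⁻-closed zero    N Ms = *-congˡ (y-closed 0 N Ms)
    y⁻-closed (suc s) N Ms = trans (y-closed s N Ms) (trans (*-congʳ (^-split q (Nix (N ∷ Ms) (suc (suc s))) (exponent (suc s) Ms) eq)) (*-assoc _ _ _))
      where
      rearrange : ∀ a b c → a ℕ.+ (b ℕ.+ c) ≡ b ℕ.+ (a ℕ.+ c)
      rearrange = solve-∀
      eq : exponent s Ms ≡ Nix (N ∷ Ms) (suc (suc s)) ℕ.+ exponent (suc s) Ms
      eq = ≡.trans (≡.cong (sumOf (λ M → M ℕ.* M) Ms ℕ.+_) (linear-step s Ms))
             (≡.trans (rearrange (sumOf (λ M → M ℕ.* M) Ms) (Nix Ms (suc s)) _) (≡.cong (ℕ._+ exponent (suc s) Ms) (≡.sym (Nix-suc N Ms s))))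

    summand-closed : ∀ a N Ms {x m b i} → x ≈ q ^ (triangle (suc N) ℕ.+ exponent a Ms) → m ≈ ⟨-q⟩₋₁ N → b ≈ q ^ Nix (N ∷ Ms) (suc a) →
                     i ≈ inverseDenominator N Ms → x * m * (1# + b) * i ≈ w N * (y a N Ms + y⁻ a N Ms)
    summand-closed a N Ms {x} {m} {b} {i} x≈ m≈ b≈ i≈ = begin
      x * m * (1# + b) * i ≈⟨ *-cong (*-cong (*-cong (trans x≈ (^-homo-* q (triangle (suc N)) (exponent a Ms))) m≈) (+-congˡ b≈)) i≈ ⟩
      q ^ triangle (suc N) * q ^ exponent a Ms * ⟨-q⟩₋₁ N * (1# + B) * inverseDenominator N Ms
                                              ≈⟨ solve 5 (λ t e m b i → t :* e :* m :* (:1 :+ b) :* i := t :* m :* (e :* i :+ b :* (e :* i))) refl _ _ _ B _ ⟩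
      w N * (q ^ exponent a Ms * inverseDenominator N Ms + B * (q ^ exponent a Ms * inverseDenominator N Ms))
                                              ≈⟨ *-congˡ (+-cong (y-closed a N Ms) (y⁻-closed a N Ms)) ⟨
      w N * (y a N Ms + y⁻ a N Ms) ∎
      where
      B = q ^ Nix (N ∷ Ms) (suc a)

    multisum-closed : ∀ l {h a} → h ℕ.+ a ≡ suc l → ∀ {B} → K ≡ suc B → (f : List ℕ → Carrier) →
      (∀ N Ms → length Ms ≡ l → f (N ∷ Ms) ≈ w N * (y a N Ms + y⁻ a N Ms)) →
      sum (map f (tuples (suc l) B)) ≈ P * Θ L≤K (suc (suc l)) h (suc a)
    multisum-closed l {h} {a} eq {B} ≡.refl f f≈ = begin
      sum (map f (tuples (suc l) B)) ≈⟨ sum-tuples f l B ⟩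
      ∑ K (λ N → sum (map (λ Ms → f (N ∷ Ms)) (tuples l N))) ≈⟨ ∑-cong< K inner ⟩
      ∑ K (λ N → w N * (Y l a N + Y⁻ l a N)) ≈⟨ weighted-Y l eq ⟩
      P * Θ L≤K (suc (suc l)) h (suc a) ∎
      where
      sum-y⁻ : ∀ a N → N < K → sum (map (y⁻ a N) (tuples l N)) ≈ Y⁻ l a N
      sum-y⁻ zero    N N<K = trans (sum-*ˡ (q ^ N) (y 0 N) (tuples l N)) (*-congˡ (sum-y l 0 N N<K))
      sum-y⁻ (suc s) N N<K = sum-y l s N N<K
      inner : ∀ N → N < K → sum (map (λ Ms → f (N ∷ Ms)) (tuples l N)) ≈ w N * (Y l a N + Y⁻ l a N)
      inner N N<K = begin
        sum (map (λ Ms → f (N ∷ Ms)) (tuples l N)) ≈⟨ sum-cong-All (tuples-length l N) (f≈ N) ⟩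
        sum (map (λ Ms → w N * (y a N Ms + y⁻ a N Ms)) (tuples l N)) ≈⟨ sum-*ˡ (w N) (λ Ms → y a N Ms + y⁻ a N Ms) (tuples l N) ⟩
        w N * sum (map (λ Ms → y a N Ms + y⁻ a N Ms) (tuples l N)) ≈⟨ *-congˡ (trans (sum-+ (y a N) (y⁻ a N) (tuples l N)) (+-cong (sum-y l a N N<K) (sum-y⁻ a N N<K))) ⟩
        w N * (Y l a N + Y⁻ l a N) ∎

  -- The exponents are at least r, so only r < L matters. This makes values comparable that were
  -- obtained with different ranges `K`.
  Θ-truncate : ∀ {K} (L≤K : L ≤ K) κ h a → Θ L≤K (suc κ) h a ≈ Θ (ℕ.≤-refl {L}) (suc κ) h a
  Θ-truncate {K} L≤K κ h a = ∑-truncate _ L≤K λ r L≤r →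
    trans (*-congˡ (+-cong (p^≈0 (ℕ.≤-trans L≤r (ℕ.≤-trans (large r) (ℕ.m≤m+n _ _)))) (-‿cong (p^≈0 (ℕ.≤-trans L≤r (ℕ.≤-trans (large r) (ℕ.≤-trans (ℕ.m≤m+n _ _) (ℕ.m≤m+n _ _))))))))
          (solve 1 (λ x → x :* (:0 :- :0) := :0) refl _)
    where
    large : ∀ r → r ≤ suc κ ℕ.* r ℕ.* r
    large zero    = z≤n
    large (suc r) = ℕ.m≤n*m (suc r) (suc κ ℕ.* suc r)

  module _ (κ h a : ℕ) (h+a≡κ : h ℕ.+ a ≡ κ) where
    private
      k = suc κ
      -- The exponents k + h and a + 1 are 2 k - a′ and a′ for a′ = a + 1.
      p = q ^ (k ℕ.+ k)
      z = q ^ (k ℕ.+ h)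
      z′ = q ^ suc a

    p^L≈0 : p ^ L ≈ 0#
    p^L≈0 = nilpotent-power {q} {L} (κ ℕ.+ k) q^L≈0

    private
      module J = JacobiTripleProduct R L p p^L≈0
      module Poch = Pochhammer R L p p^L≈0

    -- With base p = q^(2k) and z = q^(k+h) the power zʳ p^(r (r - 1) / 2) is q^(k r² + h r), and
    -- similarly for z′; hence the triple product is the theta series.
    product-closed : ∀ {B} (L+L≤B : L ℕ.+ L ≤ B) {x₁ x₂ x₃ x₄ i} → x₁ ≈ ⟨-q⟩ B → x₂ ≈ J.⟨ z′ ⟩ B → x₃ ≈ J.⟨ z ⟩ B → x₄ ≈ Poch.⟨p⟩ B → i ≈ 1/⟨p⟩ B →
                     x₁ * x₂ * x₃ * x₄ * i ≈ P * Θ (ℕ.≤-refl {L}) k h (suc a)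
    product-closed {B} L+L≤B {x₁} {x₂} {x₃} {x₄} {i} e₁ e₂ e₃ e₄ e₅ = begin
      x₁ * x₂ * x₃ * x₄ * i ≈⟨ *-cong (*-cong (*-cong (*-cong (trans e₁ (⟨-q⟩-stable L≤B)) e₂) e₃) e₄) (trans e₅ (1/⟨p⟩-stable L≤B)) ⟩
      ⟨-q⟩ L * J.⟨ z′ ⟩ B * J.⟨ z ⟩ B * Poch.⟨p⟩ B * 1/⟨p⟩ L ≈⟨ solve 5 (λ a b c d e → a :* b :* c :* d :* e := a :* e :* (c :* b :* d)) refl _ _ _ _ _ ⟩
      P * (J.⟨ z ⟩ B * J.⟨ z′ ⟩ B * Poch.⟨p⟩ B) ≈⟨ *-congˡ (J.triple-product z z′ zz′≈p (suc B) (nilpotent-power {q} {L} (κ ℕ.+ h) q^L≈0) (nilpotent-power {q} {L} a q^L≈0) L+L≤B ℕ.≤-refl) ⟩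
      P * ∑ (suc B) (λ r → J.ϑ z r + J.ϑ z′ (suc r)) ≈⟨ *-congˡ (∑-cong (suc B) term) ⟩
      P * Θ (ℕ.m≤n⇒m≤1+n L≤B) k h (suc a) ≈⟨ *-congˡ (Θ-truncate (ℕ.m≤n⇒m≤1+n L≤B) κ h (suc a)) ⟩
      P * Θ (ℕ.≤-refl {L}) k h (suc a) ∎
      where
      L≤B : L ≤ B
      L≤B = ℕ.≤-trans (ℕ.m≤m+n L L) L+L≤B
      zz′≈p : z * z′ ≈ p
      zz′≈p = sym (^-split q (k ℕ.+ h) (suc a) (exponents κ h a h+a≡κ))
        where
        rearrange : ∀ h a → suc (h ℕ.+ a) ℕ.+ suc (h ℕ.+ a) ≡ suc (h ℕ.+ a) ℕ.+ h ℕ.+ suc a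
        rearrange = solve-∀
        exponents : ∀ κ h a → h ℕ.+ a ≡ κ → suc κ ℕ.+ suc κ ≡ suc κ ℕ.+ h ℕ.+ suc a
        exponents _ h a ≡.refl = rearrange h a
      power : ∀ c r e → e ≡ c ℕ.* r ℕ.+ (k ℕ.+ k) ℕ.* triangle r → (q ^ c) ^ r * p ^ triangle r ≈ q ^ e
      power c r e eq = trans (*-cong (^-assocʳ q c r) (^-assocʳ q (k ℕ.+ k) (triangle r))) (sym (^-split q (c ℕ.* r) _ eq))
      exponent₁ : ∀ k h r t s → t ℕ.+ t ℕ.+ r ≡ s → (k ℕ.+ h) ℕ.* r ℕ.+ (k ℕ.+ k) ℕ.* t ≡ k ℕ.* s ℕ.+ h ℕ.* r
      exponent₁ k h r t _ ≡.refl = rearrange k h r t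
        where
        rearrange : ∀ k h r t → (k ℕ.+ h) ℕ.* r ℕ.+ (k ℕ.+ k) ℕ.* t ≡ k ℕ.* (t ℕ.+ t ℕ.+ r) ℕ.+ h ℕ.* r
        rearrange = solve-∀
      exponent₂ : ∀ k a r t s → t ℕ.+ t ℕ.+ r ≡ s → suc a ℕ.* suc r ℕ.+ (k ℕ.+ k) ℕ.* (t ℕ.+ r) ≡ k ℕ.* s ℕ.+ k ℕ.* r ℕ.+ suc a ℕ.* suc r
      exponent₂ k a r t _ ≡.refl = rearrange k a r t
        where
        rearrange : ∀ k a r t → suc a ℕ.* suc r ℕ.+ (k ℕ.+ k) ℕ.* (t ℕ.+ r) ≡ k ℕ.* (t ℕ.+ t ℕ.+ r) ℕ.+ k ℕ.* r ℕ.+ suc a ℕ.* suc r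
        rearrange = solve-∀
      term : ∀ r → J.ϑ z r + J.ϑ z′ (suc r) ≈ σ r * (q ^ (k ℕ.* r ℕ.* r ℕ.+ h ℕ.* r) - q ^ (k ℕ.* r ℕ.* r ℕ.+ k ℕ.* r ℕ.+ suc a ℕ.* suc r))
      term r = begin
        J.ϑ z r + J.ϑ z′ (suc r) ≈⟨ +-cong (J.ϑ-closed z r) (J.ϑ-closed z′ (suc r)) ⟩
        σ r * (z ^ r * p ^ triangle r) + - σ r * (z′ ^ suc r * p ^ triangle (suc r))
          ≈⟨ +-cong (*-congˡ (power (k ℕ.+ h) r _ (≡.trans (≡.cong (ℕ._+ h ℕ.* r) (ℕ.*-assoc k r r)) (≡.sym (exponent₁ k h r (triangle r) (r ℕ.* r) (triangle-square r))))))
                    (*-congˡ (power (suc a) (suc r) _ (≡.trans (≡.cong (λ e → e ℕ.+ k ℕ.* r ℕ.+ suc a ℕ.* suc r) (ℕ.*-assoc k r r)) (≡.sym (exponent₂ k a r (triangle r) (r ℕ.* r) (triangle-square r)))))) ⟩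
        σ r * q ^ (k ℕ.* r ℕ.* r ℕ.+ h ℕ.* r) + - σ r * q ^ (k ℕ.* r ℕ.* r ℕ.+ k ℕ.* r ℕ.+ suc a ℕ.* suc r)
          ≈⟨ solve 3 (λ s x y → s :* x :+ (:- s) :* y := s :* (x :- y)) refl _ _ _ ⟩
        σ r * (q ^ (k ℕ.* r ℕ.* r ℕ.+ h ℕ.* r) - q ^ (k ℕ.* r ℕ.* r ℕ.+ k ℕ.* r ℕ.+ suc a ℕ.* suc r)) ∎

-- Rational power series modulo a power of q.

fromℕℚ-injective : ∀ {m n} → fromℕℚ m ≡ fromℕℚ n → m ≡ n
fromℕℚ-injective {m} {n} eq with ℚ.fromℚᵘ-injective {mkℚᵘ (+ m) 0} {mkℚᵘ (+ n) 0} eq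
... | *≡* eq′ = ℤ.+-injective (≡.trans (≡.sym (ℤ.*-identityʳ (+ m))) (≡.trans eq′ (ℤ.*-identityʳ (+ n))))

fromℕℚ-suc : ∀ n → fromℕℚ (suc n) ≡ 1ℚ ℚ.+ fromℕℚ n
fromℕℚ-suc n = ℚ.toℚᵘ-injective (begin
  ℚ.toℚᵘ (fromℕℚ (suc n)) ≈⟨ ℚ.toℚᵘ-fromℚᵘ (mkℚᵘ (+ suc n) 0) ⟩
  mkℚᵘ (+ suc n) 0 ≈⟨ *≡* (≡.cong (ℤ._* + 1) (≡.cong (ℤ._+_ (+ 1)) (≡.sym (ℤ.*-identityʳ (+ n))))) ⟩
  mkℚᵘ (+ 1) 0 ℚᵘ.+ mkℚᵘ (+ n) 0 ≈⟨ ℚᵘ.+-congʳ (mkℚᵘ (+ 1) 0) (ℚ.toℚᵘ-fromℚᵘ (mkℚᵘ (+ n) 0)) ⟨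
  ℚ.toℚᵘ 1ℚ ℚᵘ.+ ℚ.toℚᵘ (fromℕℚ n) ≈⟨ ℚ.toℚᵘ-homo-+ 1ℚ (fromℕℚ n) ⟨
  ℚ.toℚᵘ (1ℚ ℚ.+ fromℕℚ n) ∎)
  where open SetoidReasoning ℚᵘ.≃-setoid

module Convolution where
  open CommutativeRing ℚ.+-*-commutativeRing hiding (zero)
  open Sums ℚ.+-*-commutativeRing
  open ≡.≡-Reasoning

  sumBelow≡∑ : ∀ n h → sumBelow n h ≡ ∑ n h
  sumBelow≡∑ zero    h = ≡.refl
  sumBelow≡∑ (suc n) h = ≡.cong (ℚ._+ h n) (sumBelow≡∑ n h)

  tail : PS → PS
  tail f n = f (suc n)

  ⊗≡∑ : ∀ f g n → (f ⊗ g) n ≡ ∑ (suc n) (λ i → f i * g (n ∸ i))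
  ⊗≡∑ f g n = sumBelow≡∑ (suc n) _

  ⊗-zero : ∀ f g → (f ⊗ g) 0 ≡ f 0 * g 0
  ⊗-zero f g = +-identityˡ _

  -- Splitting off `f 0` replaces `f` by its tail and lowers the index of the coefficient;
  -- associativity and commutativity then follow by induction on the index instead of a
  -- rearrangement of double sums.
  ⊗-sucˡ : ∀ f g n → (f ⊗ g) (suc n) ≡ f 0 * g (suc n) + (tail f ⊗ g) n
  ⊗-sucˡ f g n = begin
    (f ⊗ g) (suc n) ≡⟨ ⊗≡∑ f g (suc n) ⟩
    ∑ (suc (suc n)) (λ i → f i * g (suc n ∸ i)) ≡⟨ ∑-head (suc n) (λ i → f i * g (suc n ∸ i)) ⟩
    f 0 * g (suc n) + ∑ (suc n) (λ i → tail f i * g (n ∸ i)) ≡⟨ ≡.cong (_+_ (f 0 * g (suc n))) (⊗≡∑ (tail f) g n) ⟨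
    f 0 * g (suc n) + (tail f ⊗ g) n ∎

  ⊗-sucʳ : ∀ f g n → (f ⊗ g) (suc n) ≡ (f ⊗ tail g) n + f (suc n) * g 0
  ⊗-sucʳ f g n = begin
    (f ⊗ g) (suc n) ≡⟨ ⊗≡∑ f g (suc n) ⟩
    ∑ (suc n) (λ i → f i * g (suc n ∸ i)) + f (suc n) * g (n ∸ n) ≡⟨ ≡.cong₂ _+_ (∑-cong< (suc n) λ i i≤n → ≡.cong (λ j → f i * g j) (ℕ.+-∸-assoc 1 (ℕ.s≤s⁻¹ i≤n))) (≡.cong (λ j → f (suc n) * g j) (ℕ.n∸n≡0 n)) ⟩
    ∑ (suc n) (λ i → f i * tail g (n ∸ i)) + f (suc n) * g 0 ≡⟨ ≡.cong (_+ f (suc n) * g 0) (⊗≡∑ f (tail g) n) ⟨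
    (f ⊗ tail g) n + f (suc n) * g 0 ∎

  ⊗-cong : ∀ {f f′ g g′} n → (∀ j → j ≤ n → f j ≡ f′ j) → (∀ j → j ≤ n → g j ≡ g′ j) → (f ⊗ g) n ≡ (f′ ⊗ g′) n
  ⊗-cong {f} {f′} {g} {g′} n f≡ g≡ = begin
    (f ⊗ g) n ≡⟨ ⊗≡∑ f g n ⟩
    ∑ (suc n) (λ i → f i * g (n ∸ i)) ≡⟨ ∑-cong< (suc n) (λ i i≤n → ≡.cong₂ _*_ (f≡ i (ℕ.s≤s⁻¹ i≤n)) (g≡ (n ∸ i) (ℕ.m∸n≤m n i))) ⟩
    ∑ (suc n) (λ i → f′ i * g′ (n ∸ i)) ≡⟨ ⊗≡∑ f′ g′ n ⟨
    (f′ ⊗ g′) n ∎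

  ⊗-comm : ∀ f g n → (f ⊗ g) n ≡ (g ⊗ f) n
  ⊗-comm f g zero    = ≡.trans (⊗-zero f g) (≡.trans (*-comm (f 0) (g 0)) (≡.sym (⊗-zero g f)))
  ⊗-comm f g (suc n) = begin
    (f ⊗ g) (suc n) ≡⟨ ⊗-sucˡ f g n ⟩
    f 0 * g (suc n) + (tail f ⊗ g) n ≡⟨ ≡.cong₂ _+_ (*-comm (f 0) (g (suc n))) (⊗-comm (tail f) g n) ⟩
    g (suc n) * f 0 + (g ⊗ tail f) n ≡⟨ +-comm (g (suc n) * f 0) ((g ⊗ tail f) n) ⟩
    (g ⊗ tail f) n + g (suc n) * f 0 ≡⟨ ⊗-sucʳ g f n ⟨
    (g ⊗ f) (suc n) ∎

  ⊗-distribʳ : ∀ f g h n → ((g ⊕ h) ⊗ f) n ≡ (g ⊗ f) n + (h ⊗ f) n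
  ⊗-distribʳ f g h n = begin
    ((g ⊕ h) ⊗ f) n ≡⟨ ⊗≡∑ (g ⊕ h) f n ⟩
    ∑ (suc n) (λ i → (g i + h i) * f (n ∸ i)) ≡⟨ ∑-cong (suc n) (λ i → distribʳ (f (n ∸ i)) (g i) (h i)) ⟩
    ∑ (suc n) (λ i → g i * f (n ∸ i) + h i * f (n ∸ i)) ≡⟨ ∑-+ (suc n) (λ i → g i * f (n ∸ i)) (λ i → h i * f (n ∸ i)) ⟩
    ∑ (suc n) (λ i → g i * f (n ∸ i)) + ∑ (suc n) (λ i → h i * f (n ∸ i)) ≡⟨ ≡.cong₂ _+_ (⊗≡∑ g f n) (⊗≡∑ h f n) ⟨
    (g ⊗ f) n + (h ⊗ f) n ∎

  ⊗-scale : ∀ c f g n → ((λ i → c * f i) ⊗ g) n ≡ c * (f ⊗ g) n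
  ⊗-scale c f g n = begin
    ((λ i → c * f i) ⊗ g) n ≡⟨ ⊗≡∑ (λ i → c * f i) g n ⟩
    ∑ (suc n) (λ i → c * f i * g (n ∸ i)) ≡⟨ ∑-cong (suc n) (λ i → *-assoc c (f i) (g (n ∸ i))) ⟩
    ∑ (suc n) (λ i → c * (f i * g (n ∸ i))) ≡⟨ ∑-*ˡ (suc n) c (λ i → f i * g (n ∸ i)) ⟨
    c * ∑ (suc n) (λ i → f i * g (n ∸ i)) ≡⟨ ≡.cong (_*_ c) (⊗≡∑ f g n) ⟨
    c * (f ⊗ g) n ∎

  ⊗-assoc : ∀ f g h n → ((f ⊗ g) ⊗ h) n ≡ (f ⊗ (g ⊗ h)) n
  ⊗-assoc f g h zero = begin
    ((f ⊗ g) ⊗ h) 0 ≡⟨ ≡.trans (⊗-zero (f ⊗ g) h) (≡.cong (_* h 0) (⊗-zero f g)) ⟩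
    f 0 * g 0 * h 0 ≡⟨ *-assoc (f 0) (g 0) (h 0) ⟩
    f 0 * (g 0 * h 0) ≡⟨ ≡.trans (⊗-zero f (g ⊗ h)) (≡.cong (_*_ (f 0)) (⊗-zero g h)) ⟨
    (f ⊗ (g ⊗ h)) 0 ∎
  ⊗-assoc f g h (suc n) = begin
    ((f ⊗ g) ⊗ h) (suc n) ≡⟨ ⊗-sucˡ (f ⊗ g) h n ⟩
    (f ⊗ g) 0 * h (suc n) + (tail (f ⊗ g) ⊗ h) n ≡⟨ ≡.cong₂ _+_ (≡.cong (_* h (suc n)) (⊗-zero f g)) (⊗-cong {g = h} n (λ j _ → ⊗-sucˡ f g j) (λ _ _ → ≡.refl)) ⟩
    f 0 * g 0 * h (suc n) + (((λ j → f 0 * tail g j) ⊕ (tail f ⊗ g)) ⊗ h) n ≡⟨ ≡.cong (_+_ (f 0 * g 0 * h (suc n))) (⊗-distribʳ h (λ j → f 0 * tail g j) (tail f ⊗ g) n) ⟩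
    f 0 * g 0 * h (suc n) + (((λ j → f 0 * tail g j) ⊗ h) n + ((tail f ⊗ g) ⊗ h) n) ≡⟨ ≡.cong₂ (λ x y → f 0 * g 0 * h (suc n) + (x + y)) (⊗-scale (f 0) (tail g) h n) (⊗-assoc (tail f) g h n) ⟩
    f 0 * g 0 * h (suc n) + (f 0 * (tail g ⊗ h) n + (tail f ⊗ (g ⊗ h)) n) ≡⟨ ≡.trans (≡.cong (_+ (f 0 * (tail g ⊗ h) n + (tail f ⊗ (g ⊗ h)) n)) (*-assoc (f 0) (g 0) (h (suc n)))) (≡.sym (+-assoc (f 0 * (g 0 * h (suc n))) (f 0 * (tail g ⊗ h) n) ((tail f ⊗ (g ⊗ h)) n))) ⟩
    f 0 * (g 0 * h (suc n)) + f 0 * (tail g ⊗ h) n + (tail f ⊗ (g ⊗ h)) n ≡⟨ ≡.cong (_+ (tail f ⊗ (g ⊗ h)) n) (distribˡ (f 0) (g 0 * h (suc n)) ((tail g ⊗ h) n)) ⟨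
    f 0 * (g 0 * h (suc n) + (tail g ⊗ h) n) + (tail f ⊗ (g ⊗ h)) n ≡⟨ ≡.cong (λ x → f 0 * x + (tail f ⊗ (g ⊗ h)) n) (⊗-sucˡ g h n) ⟨
    f 0 * (g ⊗ h) (suc n) + (tail f ⊗ (g ⊗ h)) n ≡⟨ ⊗-sucˡ f (g ⊗ h) n ⟨
    (f ⊗ (g ⊗ h)) (suc n) ∎

  ⊗-zeroˡ : ∀ g n → ((λ _ → 0ℚ) ⊗ g) n ≡ 0ℚ
  ⊗-zeroˡ g n = ≡.trans (⊗≡∑ (λ _ → 0ℚ) g n) (∑-zero (suc n) (λ i → zeroˡ (g (n ∸ i))))

  ⊗-identityˡ : ∀ g n → (oneS ⊗ g) n ≡ g n
  ⊗-identityˡ g zero    = ≡.trans (⊗-zero oneS g) (*-identityˡ (g 0))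
  ⊗-identityˡ g (suc n) = ≡.trans (⊗-sucˡ oneS g n) (≡.trans (≡.cong₂ _+_ (*-identityˡ (g (suc n))) (⊗-zeroˡ g n)) (+-identityʳ _))

  shift-zero : ∀ g → (mono 1ℚ 1 ⊗ g) 0 ≡ 0ℚ
  shift-zero g = ≡.trans (⊗-zero (mono 1ℚ 1) g) (zeroˡ (g 0))

  shift-suc : ∀ g n → (mono 1ℚ 1 ⊗ g) (suc n) ≡ g n
  shift-suc g n = ≡.trans (⊗-sucˡ (mono 1ℚ 1) g n) (≡.trans (≡.cong₂ _+_ (zeroˡ (g (suc n))) (⊗-identityˡ g n)) (+-identityˡ _))

  recipTab-stable : ∀ f n j → j ≤ n → recipTab f n j ≡ recip f j
  recipTab-stable f zero    zero    _ = ≡.refl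
  recipTab-stable f (suc n) j j≤1+n with j ≤ᵇ n in eq
  ... | true  = recipTab-stable f n j (ℕ.≤ᵇ⇒≤ j n (≡.subst T (≡.sym eq) _))
  ... | false with ℕ.≤-antisym j≤1+n (ℕ.≰⇒> λ j≤n → ≡.subst T eq (ℕ.≤⇒≤ᵇ j≤n))
  ...   | ≡.refl rewrite eq = ≡.refl

  recip-suc : ∀ f n → recip f (suc n) ≡ - (tail f ⊗ recip f) n
  recip-suc f n with suc n ≤ᵇ n in eq
  ... | true  = Data.Empty.⊥-elim (ℕ.<-irrefl ≡.refl (ℕ.≤ᵇ⇒≤ (suc n) n (≡.subst T (≡.sym eq) _)))
    where import Data.Empty
  ... | false = ≡.cong -_ (begin
    sumBelow (suc n) (λ i → f (suc i) * recipTab f n (n ∸ i)) ≡⟨ sumBelow≡∑ (suc n) _ ⟩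
    ∑ (suc n) (λ i → f (suc i) * recipTab f n (n ∸ i)) ≡⟨ ∑-cong (suc n) (λ i → ≡.cong (_*_ (f (suc i))) (recipTab-stable f n (n ∸ i) (ℕ.m∸n≤m n i))) ⟩
    ∑ (suc n) (λ i → f (suc i) * recip f (n ∸ i)) ≡⟨ ⊗≡∑ (tail f) (recip f) n ⟨
    (tail f ⊗ recip f) n ∎)

  recip-inverse : ∀ f → f 0 ≡ 1ℚ → ∀ n → (f ⊗ recip f) n ≡ oneS n
  recip-inverse f f₀≡1 zero    = ≡.trans (⊗-zero f (recip f)) (≡.trans (≡.cong (_* 1ℚ) f₀≡1) (*-identityˡ 1ℚ))
  recip-inverse f f₀≡1 (suc n) = begin
    (f ⊗ recip f) (suc n) ≡⟨ ⊗-sucˡ f (recip f) n ⟩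
    f 0 * recip f (suc n) + (tail f ⊗ recip f) n ≡⟨ ≡.cong (_+ (tail f ⊗ recip f) n) (≡.trans (≡.cong₂ _*_ f₀≡1 (recip-suc f n)) (*-identityˡ (- (tail f ⊗ recip f) n))) ⟩
    - (tail f ⊗ recip f) n + (tail f ⊗ recip f) n ≡⟨ -‿inverseˡ ((tail f ⊗ recip f) n) ⟩
    0ℚ ∎

open Convolution using (⊗-zero; ⊗-cong; ⊗-comm; ⊗-distribʳ; ⊗-assoc; ⊗-identityˡ; shift-zero; shift-suc; recip-inverse)

-- The quotient of ℚ[[q]] by q^L, obtained by coarsening equality rather than by changing the
-- carrier, so that the series of the statement are elements as they stand.
truncatedSeries : ℕ → CommutativeRing 0ℓ 0ℓ
truncatedSeries L = record
  { Carrier = PS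
  ; _≈_ = λ f g → ∀ j → j < L → f j ≡ g j
  ; _+_ = _⊕_
  ; _*_ = _⊗_
  ; -_ = λ f j → ℚ.- f j
  ; 0# = λ _ → 0ℚ
  ; 1# = oneS
  ; isCommutativeRing = record
    { isRing = record
      { +-isAbelianGroup = record
        { isGroup = record
          { isMonoid = record
            { isSemigroup = record
              { isMagma = record
                { isEquivalence = record
                  { refl = λ _ _ → ≡.refl
                  ; sym = λ eq j j<L → ≡.sym (eq j j<L)
                  ; trans = λ eq eq′ j j<L → ≡.trans (eq j j<L) (eq′ j j<L)
                  }
                ; ∙-cong = λ eq eq′ j j<L → ≡.cong₂ ℚ._+_ (eq j j<L) (eq′ j j<L)
                }
              ; assoc = λ f g h j _ → ℚ.+-assoc (f j) (g j) (h j)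
              }
            ; identity = (λ f j _ → ℚ.+-identityˡ (f j)) , (λ f j _ → ℚ.+-identityʳ (f j))
            }
          ; inverse = (λ f j _ → ℚ.+-inverseˡ (f j)) , (λ f j _ → ℚ.+-inverseʳ (f j))
          ; ⁻¹-cong = λ eq j j<L → ≡.cong ℚ.-_ (eq j j<L)
          }
        ; comm = λ f g j _ → ℚ.+-comm (f j) (g j)
        }
      ; *-cong = λ eq eq′ j j<L → ⊗-cong j (λ i i≤j → eq i (ℕ.≤-<-trans i≤j j<L)) (λ i i≤j → eq′ i (ℕ.≤-<-trans i≤j j<L))
      ; *-assoc = λ f g h j _ → ⊗-assoc f g h j
      ; *-identity = (λ f j _ → ⊗-identityˡ f j) , (λ f j _ → ≡.trans (⊗-comm f oneS j) (⊗-identityˡ f j))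
      ; distrib = (λ f g h j _ → ≡.trans (⊗-comm f (g ⊕ h) j) (≡.trans (⊗-distribʳ f g h j) (≡.cong₂ ℚ._+_ (⊗-comm g f j) (⊗-comm h f j))))
                , (λ f g h j _ → ⊗-distribʳ f g h j)
      }
    ; *-comm = λ f g j _ → ⊗-comm f g j
    }
  }

q : PS
q = mono 1ℚ 1

module _ (L : ℕ) where
  open CommutativeRing (truncatedSeries L) using (_≈_)
  open Powers (truncatedSeries L) using (_^_)

  q^≡mono : ∀ m j → (q ^ m) j ≡ mono 1ℚ m j
  q^≡mono zero    j       = ≡.refl
  q^≡mono (suc m) zero    = shift-zero (q ^ m)
  q^≡mono (suc m) (suc j) = ≡.trans (shift-suc (q ^ m) j) (q^≡mono m j)

  q^L≈0 : q ^ L ≈ λ _ → 0ℚ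
  q^L≈0 j j<L = ≡.trans (q^≡mono L j) (vanish j<L)
    where
    vanish : ∀ {L j} → j < L → mono 1ℚ L j ≡ 0ℚ
    vanish {suc L} {zero}  _         = ≡.refl
    vanish {suc L} {suc j} (s≤s j<L) = vanish j<L

  ½+½≈1 : mono ℚ.½ 0 ⊕ mono ℚ.½ 0 ≈ oneS
  ½+½≈1 zero    _ = ≡.refl
  ½+½≈1 (suc j) _ = ≡.refl

-- From coefficients to explicit enumerations.

lookup-injective : ∀ {A : Set} {xs : List A} → Unique xs → ∀ i j → lookup xs i ≡ lookup xs j → i ≡ j
lookup-injective (_ ∷ _)  Fin.zero    Fin.zero    eq = ≡.refl
lookup-injective (x∉ ∷ _) Fin.zero    (Fin.suc j) eq = ⊥-elim (All.lookup x∉ (∈-lookup j) eq)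
lookup-injective (x∉ ∷ _) (Fin.suc i) Fin.zero    eq = ⊥-elim (All.lookup x∉ (∈-lookup i) (≡.sym eq))
lookup-injective (_ ∷ u)  (Fin.suc i) (Fin.suc j) eq = ≡.cong Fin.suc (lookup-injective u i j eq)

enumeration : ∀ {A C : Set} {B : A → Set} (g : C → A) {xs : List C} → Unique xs →
  (∀ {x y} → x ∈ xs → y ∈ xs → g x ≡ g y → x ≡ y) →
  (∀ {x} → x ∈ xs → B (g x)) →
  (∀ {a} → B a → ∃[ x ] x ∈ xs × g x ≡ a) →
  (∀ {a} (b b′ : B a) → b ≡ b′) →
  Fin (length xs) ↔ Σ A B
enumeration {A} {C} {B} g {xs} unique injective sound complete irrelevant = mk↔ₛ′ to from to∘from from∘to
  where
  to : Fin (length xs) → Σ A B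
  to i = g (lookup xs i) , sound (∈-lookup i)
  from : Σ A B → Fin (length xs)
  from (a , b) = index (proj₁ (proj₂ (complete b)))
  equal : ∀ {a a′} {b : B a} {b′ : B a′} → a ≡ a′ → (a , b) ≡ (a′ , b′)
  equal ≡.refl = ≡.cong (_ ,_) (irrelevant _ _)
  to∘from : ∀ p → to (from p) ≡ p
  to∘from (a , b) with complete b
  ... | x , x∈ , gx≡a = equal (≡.trans (≡.cong g (≡.sym (lookup-index x∈))) gx≡a)
  from∘to : ∀ i → from (to i) ≡ i
  from∘to i with complete (sound {lookup xs i} (∈-lookup i))
  ... | x , x∈ , gx≡ = lookup-injective unique _ i (≡.trans (≡.sym (lookup-index x∈)) (injective x∈ (∈-lookup i) gx≡))

words-unique : ∀ {A : Set} {alphabet : List A} → Unique alphabet → ∀ F → Unique (words alphabet F)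
words-unique unique zero = [] ∷ []
words-unique {alphabet = alphabet} unique (suc F) =
  All.tabulate (λ w∈ → nonempty (∈-cartesianProductWith⁻ _∷_ alphabet (words alphabet F) w∈))
  ∷ Unique.cartesianProductWith⁺ _∷_ (λ { ≡.refl → ≡.refl , ≡.refl }) unique (words-unique unique F)
  where
  nonempty : ∀ {w} → (∃[ a ] ∃[ v ] a ∈ alphabet × v ∈ words alphabet F × w ≡ a ∷ v) → [] ≡ w → _
  nonempty (_ , _ , _ , _ , ≡.refl) ()

words-complete : ∀ {A : Set} {alphabet : List A} F {w} → All (_∈ alphabet) w → length w ≤ F → w ∈ words alphabet F
words-complete zero    []        z≤n       = here ≡.refl
words-complete (suc F) []        z≤n       = here ≡.refl
words-complete (suc F) (a∈ ∷ w∈) (s≤s w≤F) = there (∈-cartesianProductWith⁺ _∷_ a∈ (words-complete F w∈ w≤F))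

∈-steps : ∀ s → s ∈ steps
∈-steps NE = here ≡.refl
∈-steps SE = there (here ≡.refl)
∈-steps N↑ = there (there (here ≡.refl))
∈-steps E  = there (there (there (here ≡.refl)))

steps-unique : Unique steps
steps-unique = ((λ ()) ∷ (λ ()) ∷ (λ ()) ∷ []) ∷ ((λ ()) ∷ (λ ()) ∷ []) ∷ ((λ ()) ∷ []) ∷ [] ∷ []

letters-unique : ∀ k → Unique (letters k)
letters-unique k = Unique.cartesianProduct⁺ (Unique.upTo⁺ k) (((λ ()) ∷ []) ∷ [] ∷ [])

Admissible-letters : ∀ {k i} ws → i ≤ k → Admissible k i ws → All (_∈ letters k) ws
Admissible-letters []             i≤k adm         = []
Admissible-letters {k} ((f , o) ∷ ws) i≤k (f<i , adm) =
  ∈-cartesianProduct⁺ (∈-upTo⁺ (ℕ.<-≤-trans f<i i≤k)) (∈-Bool o) ∷ Admissible-letters ws (ℕ.m∸n≤m k (bit o ℕ.+ f)) adm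
  where
  ∈-Bool : ∀ o → o ∈ false ∷ true ∷ []
  ∈-Bool false = here ≡.refl
  ∈-Bool true  = there (here ≡.refl)

T-irrelevant : ∀ {b} (x y : T b) → x ≡ y
T-irrelevant {true} _ _ = ≡.refl

module Count (n : ℕ) where
  R : CommutativeRing _ _
  R = truncatedSeries (suc n)

  selected : ∀ {A : Set} → (A → Bool) → (A → ℕ) → List A → List A
  selected Q wt = filter (λ w → T? (Q w ∧ (wt w ≡ᵇ n)))

  module _ {A : Set} (alphabet : List A) where
    open WordSeries R q alphabet
    open Sums R using (sum)

    coefficient : ∀ (Q : List A → Bool) wt ws → sum (map (λ w → indicator (Q w) (Powers._^_ R q (wt w))) ws) n ≡ fromℕℚ (length (selected Q wt ws))
    coefficient Q wt []       = ≡.refl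
    coefficient Q wt (w ∷ ws) with Q w
    ... | false = ≡.trans (ℚ.+-identityˡ _) (coefficient Q wt ws)
    ... | true with wt w ≡ᵇ n in eq
    ...   | true  = ≡.trans (≡.cong₂ ℚ._+_ (≡.trans (q^≡mono (suc n) (wt w) n) (≡.cong (λ b → if b then 1ℚ else 0ℚ) eq)) (coefficient Q wt ws)) (≡.sym (fromℕℚ-suc (length (selected Q wt ws))))
    ...   | false = ≡.trans (≡.cong₂ ℚ._+_ (≡.trans (q^≡mono (suc n) (wt w) n) (≡.cong (λ b → if b then 1ℚ else 0ℚ) eq)) (coefficient Q wt ws)) (ℚ.+-identityˡ _)

    gf-coefficient : ∀ F (Q : List A → Bool) wt → gf F Q wt n ≡ fromℕℚ (length (selected Q wt (words alphabet F)))
    gf-coefficient F Q wt = ≡.trans (gf-words F Q wt n (ℕ.n<1+n n)) (coefficient Q wt (words alphabet F))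

∈-selected⁻ : ∀ n {A : Set} (Q : A → Bool) (wt : A → ℕ) xs {w} → w ∈ Count.selected n Q wt xs → w ∈ xs × T (Q w) × wt w ≡ n
∈-selected⁻ n Q wt xs {w} w∈ with ∈-filter⁻ (λ w → T? (Q w ∧ (wt w ≡ᵇ n))) w∈
... | w∈xs , ok = w∈xs , proj₁ (T-∧⁻ ok) , ℕ.≡ᵇ⇒≡ (wt w) n (proj₂ (T-∧⁻ {Q w} ok))

∈-selected⁺ : ∀ n {A : Set} (Q : A → Bool) (wt : A → ℕ) xs {w} → w ∈ xs → T (Q w) → wt w ≡ n → w ∈ Count.selected n Q wt xs
∈-selected⁺ n Q wt xs {w} w∈ ok eq = ∈-filter⁺ (λ w → T? (Q w ∧ (wt w ≡ᵇ n))) w∈ (T-∧ ok (ℕ.≡⇒≡ᵇ (wt w) n eq))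

selected-unique : ∀ n {A : Set} (Q : A → Bool) (wt : A → ℕ) xs → Unique xs → Unique (Count.selected n Q wt xs)
selected-unique n Q wt xs = Unique.filter⁺ (λ w → T? (Q w ∧ (wt w ≡ᵇ n)))

module _ (κ a : ℕ) (a≤κ : a ≤ κ) (n : ℕ) where
  private
    k = suc κ
    h = κ ∸ a
    L = suc n

  fuel : ℕ
  fuel = L ℕ.+ L ℕ.+ suc k

  walk : Path → Bool
  walk = walkOK k h nothing

  walks : List Path
  walks = Count.selected n walk maj (words steps fuel)

  h≤k : h ≤ k
  h≤k = ℕ.m≤n⇒m≤1+n (ℕ.m∸n≤m κ a)

  paths↔ : Fin (length walks) ↔ SpecialPaths k (suc a) n
  paths↔ = enumeration (λ ps → ps) {walks} (selected-unique n walk maj (words steps fuel) (words-unique steps-unique fuel)) (λ _ _ eq → eq) sound complete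
    (λ (t , e) (t′ , e′) → ≡.cong₂ _,_ (T-irrelevant t t′) (ℕ.≡-irrelevant e e′))
    where
    sound : ∀ {ps} → ps ∈ walks → T (SpecialPath k (suc a) ps) × maj ps ≡ n
    sound ps∈ with ∈-selected⁻ n walk maj (words steps fuel) ps∈
    ... | _ , ok , eq = T-∧ (ℕ.<⇒<ᵇ (s≤s (ℕ.m∸n≤m κ a))) ok , eq
    short : ∀ ps → T (walk ps) → maj ps ≡ n → length ps ≤ fuel
    short ps ok ≡.refl with walk-length k 0 h nothing ps h≤k (T⇒≡true ok)
      where
      T⇒≡true : ∀ {b} → T b → b ≡ true
      T⇒≡true {true} _ = ≡.refl
    ... | inj₁ (_ , short) = ℕ.≤-trans short (ℕ.≤-trans h≤k (ℕ.≤-trans (ℕ.n≤1+n k) (ℕ.m≤n+m (suc k) (L ℕ.+ L))))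
    ... | inj₂ bound       = ℕ.≤-trans bound (ℕ.+-monoˡ-≤ (suc k) (ℕ.+-mono-≤ (ℕ.n≤1+n (maj ps)) (ℕ.n≤1+n (maj ps))))
    complete : ∀ {ps} → T (SpecialPath k (suc a) ps) × maj ps ≡ n → ∃[ x ] x ∈ walks × x ≡ ps
    complete {ps} (ok , eq) = ps , ∈-selected⁺ n walk maj (words steps fuel) (words-complete fuel (All.universal ∈-steps ps) (short ps ok′ eq)) ok′ eq , ≡.refl
      where
      ok′ : T (walk ps)
      ok′ = proj₂ (T-∧⁻ {h <ᵇ k} ok)

  -- The length is fixed because `expand` is injective only on words of equal length, and it is n +
  -- 1 because `b-theta` asks for at least L values. The last value, n + 1, is too large to occur in
  -- an overpartition of n.
  encodes : List (ℕ × Bool) → Bool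
  encodes ws = (length ws ≡ᵇ L) ∧ admissible k (suc a) ws

  codes : List (List (ℕ × Bool))
  codes = Count.selected n encodes (wordWeight 0) (words (letters k) L)

  codes-length : ∀ {ws} → ws ∈ codes → length ws ≡ L
  codes-length {ws} ws∈ = ℕ.≡ᵇ⇒≡ (length ws) L (proj₁ (T-∧⁻ (proj₁ (proj₂ (∈-selected⁻ n encodes (wordWeight 0) (words (letters k) L) ws∈)))))

  overpartitions↔ : Fin (length codes) ↔ BOverpartitions k (suc a) n
  overpartitions↔ = enumeration (expand 0) {codes} (selected-unique n encodes (wordWeight 0) (words (letters k) L) (words-unique (letters-unique k) L))
    (λ {ws} {ws′} ws∈ ws′∈ eq → expand-injective 0 ws ws′ (≡.trans (codes-length ws∈) (≡.sym (codes-length ws′∈))) eq)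
    sound complete (λ (t , e) (t′ , e′) → ≡.cong₂ _,_ (T-irrelevant t t′) (ℕ.≡-irrelevant e e′))
    where
    sound : ∀ {ws} → ws ∈ codes → T (BressoudOvp k (suc a) (expand 0 ws)) × weight (expand 0 ws) ≡ n
    sound {ws} ws∈ with ∈-selected⁻ n encodes (wordWeight 0) (words (letters k) L) ws∈
    ... | _ , ok , eq = bressoud-expand {ws = ws} (admissible⇒Admissible (suc a) ws (proj₂ (T-∧⁻ {length ws ≡ᵇ L} ok))) , ≡.trans (weight-expand 0 ws) eq
    complete : ∀ {ps} → T (BressoudOvp k (suc a) ps) × weight ps ≡ n → ∃[ ws ] ws ∈ codes × expand 0 ws ≡ ps
    complete {ps} (ok , eq) with bressoud-collapse {κ} {suc a} {ps} {L} ok (ℕ.≤-trans (ℕ.≤-reflexive eq) (ℕ.n≤1+n n))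
    ... | ws , len , adm , ≡.refl =
      ws , ∈-selected⁺ n encodes (wordWeight 0) (words (letters k) L) (words-complete L (Admissible-letters ws (s≤s a≤κ) adm) (ℕ.≤-reflexive len))
             (T-∧ (ℕ.≡⇒≡ᵇ (length ws) L len) (Admissible⇒admissible (suc a) ws adm)) (≡.trans (≡.sym (weight-expand 0 ws)) eq) , ≡.refl

-- The four quantities in the ring of truncated series.

module Series (L : ℕ) where
  open CommutativeRing (truncatedSeries L) hiding (zero)
  open SetoidReasoning setoid
  open Sums (truncatedSeries L)
  open Powers (truncatedSeries L)
  open Pochhammer (truncatedSeries L) L q (q^L≈0 L)
  open WeightedSum (truncatedSeries L) L q (q^L≈0 L) (mono ℚ.½ 0) (½+½≈1 L) public using (P; Θ; ⟨-q⟩; ⟨-q⟩₋₁; w)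
  open Summands (truncatedSeries L) L q (q^L≈0 L) (mono ℚ.½ 0) (½+½≈1 L)

  mono≈q^ : ∀ m → mono 1ℚ m ≈ q ^ m
  mono≈q^ m j _ = ≡.sym (q^≡mono L m j)

  mono-neg : ∀ m → mono (ℚ.- 1ℚ) m ≈ - mono 1ℚ m
  mono-neg m j _ with m ≡ᵇ j
  ... | true  = ≡.refl
  ... | false = ≡.refl

  factor⁻ : ∀ m {x} → q ^ m ≈ x → (oneS ⊕ mono (ℚ.- 1ℚ) m) ≈ 1# - x
  factor⁻ m eq = +-congˡ {oneS} (trans (mono-neg m) (-‿cong (trans (mono≈q^ m) eq)))

  factor⁺ : ∀ m {x} → q ^ m ≈ x → (oneS ⊕ mono (ℚ.- (ℚ.- 1ℚ)) m) ≈ 1# + x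
  factor⁺ m eq = +-congˡ {oneS} (trans (mono≈q^ m) eq)

  qPoch≈ : ∀ n → qPoch n ≈ ⟨p⟩ n
  qPoch≈ zero    = refl
  qPoch≈ (suc n) = *-cong (qPoch≈ n) (factor⁻ (1 ℕ.+ 1 ℕ.* n) (^-congʳ q (≡.cong suc (ℕ.*-identityˡ n))))

  mqPoch≈ : ∀ n → mqPoch n ≈ ⟨-q⟩ n
  mqPoch≈ zero    = refl
  mqPoch≈ (suc n) = *-cong (mqPoch≈ n) (factor⁺ (1 ℕ.+ 1 ℕ.* n) (^-congʳ q (≡.cong suc (ℕ.*-identityˡ n))))

  mqPochPred≈ : ∀ n → mqPochPred n ≈ ⟨-q⟩₋₁ n
  mqPochPred≈ zero    = refl
  mqPochPred≈ (suc n) = mqPoch≈ n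

  recip≈ : ∀ {f g} → f 0 ≡ 1ℚ → f * g ≈ 1# → recip f ≈ g
  recip≈ {f} f₀≡1 fg≈1 = inverse-unique {f} (λ j _ → recip-inverse f f₀≡1 j) fg≈1

  prodBelow-0 : ∀ n {F : ℕ → PS} → (∀ i → F i 0 ≡ 1ℚ) → prodBelow n F 0 ≡ 1ℚ
  prodBelow-0 zero        F₀≡1 = ≡.refl
  prodBelow-0 (suc n) {F} F₀≡1 = ≡.trans (⊗-zero (prodBelow n F) (F n)) (≡.cong₂ ℚ._*_ (prodBelow-0 n F₀≡1) (F₀≡1 n))

  qPoch-0 : ∀ n → qPoch n 0 ≡ 1ℚ
  qPoch-0 n = prodBelow-0 n λ i → ≡.refl

  prodBelow≈∏ : ∀ n {F G : ℕ → PS} → (∀ i → F i ≈ G i) → prodBelow n F ≈ ∏ n G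
  prodBelow≈∏ zero    eq = refl
  prodBelow≈∏ (suc n) eq = *-cong (prodBelow≈∏ n eq) (eq n)

  denom-inverse : ∀ N Ms → recip (denom (suc (suc (length Ms))) (N ∷ Ms)) ≈ inverseDenominator N Ms
  denom-inverse N Ms = recip≈ (prodBelow-0 (suc (length Ms)) (λ i → qPoch-0 (Nix (N ∷ Ms) (suc i) ∸ Nix (N ∷ Ms) (suc (suc i)))))
    (trans (*-congʳ {inverseDenominator N Ms} (prodBelow≈∏ (suc (length Ms)) (λ j → qPoch≈ (Nix (N ∷ Ms) (suc j) ∸ Nix (N ∷ Ms) (suc (suc j)))))) (denominator-inverse N Ms))

  multisum≈ : ∀ κ h a → h ℕ.+ a ≡ κ → ∀ B → L ≤ B → multisumPartial (suc κ) (suc a) B ≈ P * Θ (ℕ.≤-refl {L}) (suc κ) h (suc a)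
  multisum≈ (suc l) h a eq B L≤B = trans
    (multisum-closed L≤K (s≤s z≤n) l eq ≡.refl (summand (suc (suc l)) (suc a)) (λ { N Ms ≡.refl → summand-closed L≤K (s≤s z≤n) a N Ms
      (trans (mono≈q^ (expo (suc (suc (length Ms))) (suc a) (N ∷ Ms))) (^-congʳ q (expo-exponent a N Ms)))
      (mqPochPred≈ N) (mono≈q^ (Nix (N ∷ Ms) (suc a))) (denom-inverse N Ms) }))
    (*-congˡ {P} (Θ-truncate L≤K (suc l) h (suc a)))
    where
    L≤K : L ≤ suc B
    L≤K = ℕ.m≤n⇒m≤1+n L≤B
  -- For k = 1 there is one summand, that of the empty tuple with N₁ = N_a = 0, and its value is (1
  -- + 1) / 2.
  multisum≈ zero zero zero eq B L≤B = begin
    multisumPartial 1 1 B ≈⟨ +-identityʳ (summand 1 1 []) ⟩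
    oneS * mono ℚ.½ 0 * (oneS + oneS) * recip oneS ≈⟨ *-congˡ {oneS * mono ℚ.½ 0 * (oneS + oneS)} (recip≈ {oneS} {oneS} ≡.refl (*-identityˡ oneS)) ⟩
    oneS * mono ℚ.½ 0 * (oneS + oneS) * oneS ≈⟨ solve 1 (λ x → :1 :* x :* (:1 :+ :1) :* :1 := x :+ x) refl (mono ℚ.½ 0) ⟩
    mono ℚ.½ 0 + mono ℚ.½ 0 ≈⟨ ½+½≈1 L ⟩
    oneS ≈⟨ trivial ⟨
    P * Θ (ℕ.≤-refl {L}) 1 0 1 ∎
    where
    open IntegerCoefficients (truncatedSeries L)
    open OverpartitionSeries (truncatedSeries L) L q (q^L≈0 L) (mono ℚ.½ 0) (½+½≈1 L) using (product-trivial)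
    trivial : P * Θ (ℕ.≤-refl {L}) 1 0 1 ≈ oneS
    trivial = trans (*-congˡ {P} (sym (Θ-truncate (ℕ.n≤1+n L) 0 0 1))) (product-trivial (ℕ.n≤1+n L) (s≤s z≤n))

  product≈ : ∀ κ h a → h ℕ.+ a ≡ κ → ∀ B → L ℕ.+ L ≤ B → productPartial (suc κ) (suc a) B ≈ P * Θ (ℕ.≤-refl {L}) (suc κ) h (suc a)
  product≈ κ h a eq B L+L≤B = trans (reflexive exponents)
    (product-closed κ h a eq L+L≤B (mqPoch≈ B) (poch≈ (suc a) B) (poch≈ (k ℕ.+ h) B) (poch-p≈ B)
      (recip≈ (qPoch-0 B) (trans (*-congʳ {1/⟨p⟩ B} (qPoch≈ B)) (⟨p⟩-inverse B))))
    where
    k = suc κ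
    module J = JacobiTripleProduct (truncatedSeries L) L (q ^ (k ℕ.+ k)) (p^L≈0 κ h a eq)
    module Poch = Pochhammer (truncatedSeries L) L (q ^ (k ℕ.+ k)) (p^L≈0 κ h a eq)
    exponents : productPartial k (suc a) B ≡ ((((poch (ℚ.- 1ℚ) 1 1 B ⊗ poch 1ℚ (suc a) (k ℕ.+ k) B) ⊗ poch 1ℚ (k ℕ.+ h) (k ℕ.+ k) B) ⊗ poch 1ℚ (k ℕ.+ k) (k ℕ.+ k) B) ⊘ poch 1ℚ 1 1 B)
    exponents = ≡.cong₂ (λ d e → (((poch (ℚ.- 1ℚ) 1 1 B ⊗ poch 1ℚ (suc a) d B) ⊗ poch 1ℚ e d B) ⊗ poch 1ℚ d d B) ⊘ poch 1ℚ 1 1 B)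
      (≡.cong (k ℕ.+_) (ℕ.+-identityʳ k)) (≡.trans (≡.cong (_∸ suc a) (double κ h a eq)) (ℕ.m+n∸n≡m (k ℕ.+ h) (suc a)))
      where
      rearrange : ∀ h a → 2 ℕ.* suc (h ℕ.+ a) ≡ suc (h ℕ.+ a) ℕ.+ h ℕ.+ suc a
      rearrange = solve-∀
      double : ∀ κ h a → h ℕ.+ a ≡ κ → 2 ℕ.* suc κ ≡ suc κ ℕ.+ h ℕ.+ suc a
      double _ h a ≡.refl = rearrange h a
    poch≈ : ∀ m B → poch 1ℚ m (k ℕ.+ k) B ≈ J.⟨ q ^ m ⟩ B
    poch≈ m zero    = refl
    poch≈ m (suc B) = *-cong (poch≈ m B) (factor⁻ (m ℕ.+ (k ℕ.+ k) ℕ.* B) (trans (^-homo-* q m ((k ℕ.+ k) ℕ.* B)) (*-congˡ {q ^ m} (sym (^-assocʳ q (k ℕ.+ k) B)))))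
    poch-p≈ : ∀ B → poch 1ℚ (k ℕ.+ k) (k ℕ.+ k) B ≈ Poch.⟨p⟩ B
    poch-p≈ zero    = refl
    poch-p≈ (suc B) = *-cong (poch-p≈ B) (factor⁻ ((k ℕ.+ k) ℕ.+ (k ℕ.+ k) ℕ.* B) (trans (^-homo-* q (k ℕ.+ k) ((k ℕ.+ k) ℕ.* B)) (*-congˡ {q ^ (k ℕ.+ k)} (sym (^-assocʳ q (k ℕ.+ k) B)))))

  open WordSeries (truncatedSeries L) q steps using (gf; gf-cong; gf-false)

  walks≈ : ∀ κ h a → h ℕ.+ a ≡ κ → gf (L ℕ.+ L ℕ.+ suc (suc κ)) (walkOK (suc κ) h nothing) maj ≈ P * Θ (ℕ.≤-refl {L}) (suc κ) h (suc a)
  walks≈ (suc l) h a eq = trans (path-total L≤K (ℕ.n<1+n F) eq) (*-congˡ {P} (Θ-truncate L≤K (suc l) h (suc a)))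
    where
    open PathSeries (truncatedSeries L) L q (q^L≈0 L) (mono ℚ.½ 0) (½+½≈1 L) l using (F; path-total)
    L≤K : L ≤ suc F
    L≤K = ℕ.m≤n⇒m≤1+n (ℕ.≤-trans (ℕ.m≤m+n L L) (ℕ.m≤m+n (L ℕ.+ L) _))
  -- For k = 1 all heights are 0, so only East steps are possible; since no path may end with one,
  -- the empty path alone remains.
  walks≈ zero zero zero eq = begin
    gf (L ℕ.+ L ℕ.+ 2) (walkOK 1 0 nothing) maj ≈⟨ only-empty (L ℕ.+ L ℕ.+ 2) ⟩
    oneS ≈⟨ product-trivial (ℕ.n≤1+n L) (s≤s z≤n) ⟨
    P * Θ (ℕ.n≤1+n L) 1 0 1 ≈⟨ *-congˡ {P} (Θ-truncate (ℕ.n≤1+n L) 0 0 1) ⟩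
    P * Θ (ℕ.≤-refl {L}) 1 0 1 ∎
    where
    open OverpartitionSeries (truncatedSeries L) L q (q^L≈0 L) (mono ℚ.½ 0) (½+½≈1 L) using (product-trivial)
    after-E : ∀ ps → walkOK 1 0 (just E) ps ≡ false
    after-E []        = ≡.refl
    after-E (NE ∷ ps) = ≡.refl
    after-E (SE ∷ ps) = ≡.refl
    after-E (N↑ ∷ ps) = ≡.refl
    after-E (E ∷ ps)  = after-E ps
    only-empty : ∀ F → gf F (walkOK 1 0 nothing) maj ≈ oneS
    only-empty zero    = refl
    only-empty (suc F) = trans (+-congˡ {oneS} (trans (+-cong (gf-false F {wt = λ ps → maj (NE ∷ ps)} λ _ → ≡.refl)
      (trans (+-cong (gf-false F {wt = λ ps → maj (SE ∷ ps)} λ _ → ≡.refl) (trans (+-cong (gf-false F {wt = λ ps → maj (N↑ ∷ ps)} λ _ → ≡.refl)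
      (trans (+-congʳ (gf-false F {wt = λ ps → maj (E ∷ ps)} after-E)) (+-identityˡ 0#))) (+-identityˡ 0#))) (+-identityˡ 0#))) (+-identityˡ 0#))) (+-identityʳ oneS)

  open FrequencySeries (truncatedSeries L) L q (q^L≈0 L) (mono ℚ.½ 0) (½+½≈1 L) {suc L} (ℕ.n≤1+n L) (s≤s z≤n) using (overpartition-total)

  codes≈ : ∀ κ h a → h ℕ.+ a ≡ κ → WordSeries.gf (truncatedSeries L) q (letters (suc κ)) L (λ ws → (length ws ≡ᵇ L) ∧ admissible (suc κ) (suc a) ws) (wordWeight 0)
           ≈ P * Θ (ℕ.≤-refl {L}) (suc κ) h (suc a)
  codes≈ κ h a eq = trans (overpartition-total κ {L} {suc a} {h} (≡.cong suc (≡.trans (ℕ.+-comm a h) eq)) ℕ.≤-refl) (*-congˡ {P} (Θ-truncate (ℕ.n≤1+n L) κ h (suc a)))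

theorem1p3 : (k a : ℕ) → 1 ≤ a → a ≤ k → (n : ℕ) →
    Σ ℕ (λ c →
    (Fin c ↔ SpecialPaths k a n)
    × (Fin c ↔ BOverpartitions k a n)
    × CoeffLimit (multisumPartial k a) n (fromℕℚ c)
    × CoeffLimit (productPartial k a) n (fromℕℚ c))
theorem1p3 (suc κ) (suc a) (s≤s _) (s≤s a≤κ) n =
    c , paths↔ κ a a≤κ n
  , ≡.subst (λ m → Fin m ↔ BOverpartitions (suc κ) (suc a) n) same-count (overpartitions↔ κ a a≤κ n)
  , (L , λ B L≤B → ≡.trans (multisum≈ κ (κ ∸ a) a eq B L≤B n n<L) (≡.sym c-coefficient))
  -- The threshold is doubled because the finite triple product is compared with its limit, where n
  -- - r ≥ L is required for all r ≤ L.
  , (L ℕ.+ L , λ B L+L≤B → ≡.trans (product≈ κ (κ ∸ a) a eq B L+L≤B n n<L) (≡.sym c-coefficient))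
  where
  L = suc n
  open Series L
  c = length (walks κ a a≤κ n)
  n<L : n < L
  n<L = ℕ.n<1+n n
  eq : κ ∸ a ℕ.+ a ≡ κ
  eq = ℕ.m∸n+n≡m a≤κ
  value : ℚ
  value = (P ⊗ Θ (ℕ.≤-refl {L}) (suc κ) (κ ∸ a) (suc a)) n
  c-coefficient : fromℕℚ c ≡ value
  c-coefficient = ≡.trans (≡.sym (Count.gf-coefficient n steps (fuel κ a a≤κ n) (walk κ a a≤κ n) maj)) (walks≈ κ (κ ∸ a) a eq n n<L)
  -- Both lists have the same coefficient of P Θ as their length, first as a rational number and
  -- then, since ℕ embeds into ℚ, as a natural number.
  same-count : length (codes κ a a≤κ n) ≡ c
  same-count = fromℕℚ-injective (≡.trans (≡.trans (≡.sym (Count.gf-coefficient n (letters (suc κ)) L (encodes κ a a≤κ n) (wordWeight 0))) (codes≈ κ (κ ∸ a) a eq n n<L)) (≡.sym c-coefficient))
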